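{- Let $\Gamma$ be a reduct of $(\mathbb{Z};<)$ with finite relational signature that is preserved by $\max_d$ or by $\min_d$ for some positive integer $d$. Then $\mathrm{CSP}(\Gamma)$ is solvable in polynomial time.
   Context: A reduct of $(\mathbb{Z};<)$ is a relational structure with domain $\mathbb{Z}$ whose relations are first-order definable in $(\mathbb{Z};<)$. $\mathrm{CSP}(\Gamma)$ is the problem of deciding, for a primitive positive sentence in the signature of $\Gamma$, whether it holds in $\Gamma$. For a positive integer $d$, $\max_d\colon\mathbb{Z}^2\to\mathbb{Z}$ is $\max_d(x,y)=\max(x,y)$ if $x\equiv y\pmod d$ and $\max_d(x,y)=x$ otherwise; $\min_d$ is defined analogously. A binary operation preserves $\Gamma$ if for every relation $R$ of $\Gamma$ and tuples $\bar a,\bar b\in R$, the componentwise image is in $R$. -}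

module Defs where

open import Data.Bool.Base using (Bool; true; false; if_then_else_)
open import Data.Fin.Base using (Fin; zero; suc; toℕ)
open import Data.Integer.Base using (ℤ; +_; _-_; _<_; _⊔_; _⊓_)
open import Data.Integer.Divisibility.Signed using (_∣?_)
open import Data.List.Base as List using (List; []; _∷_; _++_; concatMap; length; replicate)
open import Data.List.Relation.Unary.All using (All)
open import Data.Maybe.Base using (Maybe; just; nothing)
open import Data.Nat.Base using (ℕ; zero; suc; _+_; _*_; _^_)
open import Data.Product.Base using (Σ; ∃; ∃-syntax; _×_; _,_; proj₁; proj₂)
open import Data.Sum.Base using (_⊎_; inj₁; inj₂)
open import Data.Vec.Base as Vec using (Vec; []; _∷_; lookup; zipWith; toList)
open import Function.Bundles using (_⇔_; _↔_)
open import Level using (0ℓ)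
open import Relation.Binary.PropositionalEquality using (_≡_)
open import Relation.Nullary.Decidable using (does)
open import Relation.Nullary.Negation using (¬_)
open import Relation.Unary using (Pred)

------------------------------------------------------------------------
-- Relational structures and first-order logic

record Signature : Set where
  field
    size  : ℕ
    arity : Fin size → ℕ

open Signature public

Structure : Signature → Set → Set₁
Structure τ D = (i : Fin (size τ)) → Pred (Vec D (arity τ i)) 0ℓ

data Atom (τ : Signature) (n : ℕ) : Set where
  rel : (i : Fin (size τ)) → Vec (Fin n) (arity τ i) → Atom τ n
  eq  : Fin n → Fin n → Atom τ n

-- A quantifier binds the variable zero of its body.
data Formula (τ : Signature) (n : ℕ) : Set where
  atom    : Atom τ n → Formula τ n
  not     : Formula τ n → Formula τ n
  and or  : Formula τ n → Formula τ n → Formula τ n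
  ex all  : Formula τ (suc n) → Formula τ n

module _ {τ : Signature} {D : Set} (A : Structure τ D) where

  HoldsAtom : ∀ {n} → Vec D n → Atom τ n → Set
  HoldsAtom s (rel i xs) = A i (Vec.map (lookup s) xs)
  HoldsAtom s (eq x y)   = lookup s x ≡ lookup s y

  Holds : ∀ {n} → Vec D n → Formula τ n → Set
  Holds s (atom a)  = HoldsAtom s a
  Holds s (not φ)   = ¬ Holds s φ
  Holds s (and φ ψ) = Holds s φ × Holds s ψ
  Holds s (or φ ψ)  = Holds s φ ⊎ Holds s ψ
  Holds s (ex φ)    = ∃[ x ] Holds (x ∷ s) φ
  Holds s (all φ)   = ∀ x → Holds (x ∷ s) φ

  Definable : ∀ {n} → Pred (Vec D n) 0ℓ → Set
  Definable {n} R = ∃[ φ ] (∀ (s : Vec D n) → R s ⇔ Holds s φ)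

  Preserves : (D → D → D) → Set
  Preserves f = ∀ i (a b : Vec D (arity τ i)) → A i a → A i b → A i (zipWith f a b)

orderSig : Signature
orderSig = record { size = 1 ; arity = λ _ → 2 }

ℤ-order : Structure orderSig ℤ
ℤ-order zero (x ∷ y ∷ []) = x < y

IsReduct : {τ : Signature} → Structure τ ℤ → Set
IsReduct Γ = ∀ i → Definable ℤ-order (Γ i)

max[_] min[_] : ℕ → ℤ → ℤ → ℤ
max[ d ] x y = if does (+ d ∣? (x - y)) then x ⊔ y else x
min[ d ] x y = if does (+ d ∣? (x - y)) then x ⊓ y else x

------------------------------------------------------------------------
-- Primitive positive sentences

-- ∃ x₀ … xₙ₋₁ (a₁ ∧ … ∧ aₘ), where n = vars.
record PPSentence (τ : Signature) : Set where
  field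
    vars  : ℕ
    atoms : List (Atom τ vars)

open PPSentence public

_⊨_ : {τ : Signature} {D : Set} → Structure τ D → PPSentence τ → Set
_⊨_ {D = D} A φ = Σ (Vec D (vars φ)) λ s → All (HoldsAtom A s) (atoms φ)

unary : ℕ → List Bool
unary n = replicate n true ++ false ∷ []

-- Equality has code 0 and the i-th relation symbol code i + 1.
encodeAtom : ∀ {τ n} → Atom τ n → List Bool
encodeAtom (rel i xs) = unary (suc (toℕ i)) ++ concatMap (λ x → unary (toℕ x)) (toList xs)
encodeAtom (eq x y)   = unary 0 ++ unary (toℕ x) ++ unary (toℕ y)

-- Each code word is self-delimiting and arities are fixed, so this is
-- injective.  Variable names are written in unary, which is harmless: the
-- prefix ∃ x₀ … xₙ₋₁ already has length at least n, so the length of the code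
-- is polynomially related to that of the sentence with names in binary.
encode : ∀ {τ} → PPSentence τ → List Bool
encode φ = unary (vars φ) ++ concatMap encodeAtom (atoms φ)

------------------------------------------------------------------------
-- Deterministic multi-tape Turing machines

Finite : Set → Set
Finite A = ∃[ n ] (A ↔ Fin n)

data Cell (Work : Set) : Set where
  blank : Cell Work
  bit   : Bool → Cell Work
  work  : Work → Cell Work

data Move : Set where
  left stay right : Move

-- The transition function either halts with a verdict or gives the next state
-- and, for every tape, the symbol to write and the move of the head.
record TuringMachine : Set₁ where
  field
    State        : Set
    state-finite : Finite State
    Work         : Set
    work-finite  : Finite Work
    extraTapes   : ℕ
    start        : State
    δ            : State → Vec (Cell Work) (suc extraTapes) →
                   Bool ⊎ (State × Vec (Cell Work × Move) (suc extraTapes))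

-- A two-way infinite tape.  Both lists are read outwards from the head, and all
-- cells beyond them are blank.
record Tape (Work : Set) : Set where
  constructor tape
  field
    before : List (Cell Work)
    head   : Cell Work
    after  : List (Cell Work)

module _ {Work : Set} where

  pop : List (Cell Work) → Cell Work × List (Cell Work)
  pop []       = blank , []
  pop (c ∷ cs) = c , cs

  fromList : List (Cell Work) → Tape Work
  fromList cs = tape [] (proj₁ (pop cs)) (proj₂ (pop cs))

  act : Tape Work → Cell Work × Move → Tape Work
  act (tape l _ r) (c , left)  = tape (proj₂ (pop l)) (proj₁ (pop l)) (c ∷ r)
  act (tape l _ r) (c , stay)  = tape l c r
  act (tape l _ r) (c , right) = tape (c ∷ l) (proj₁ (pop r)) (proj₂ (pop r))

module _ (M : TuringMachine) where
  open TuringMachine M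

  Config : Set
  Config = State × Vec (Tape Work) (suc extraTapes)

  initial : List Bool → Config
  initial w = start , fromList (List.map bit w) ∷ Vec.replicate extraTapes (fromList [])

  step : Config → Bool ⊎ Config
  step (q , ts) with δ q (Vec.map Tape.head ts)
  ... | inj₁ b          = inj₁ b
  ... | inj₂ (q′ , as) = inj₂ (q′ , zipWith act ts as)

  -- The verdict, provided that it is given within the stated number of steps.
  run : ℕ → Config → Maybe Bool
  run zero    c = nothing
  run (suc t) c with step c
  ... | inj₁ b  = just b
  ... | inj₂ c′ = run t c′

-- Every polynomial in n is bounded by one of the form c * n ^ k + c.
SolvableInPolynomialTime : {I : Set} → (I → List Bool) → Pred I 0ℓ → Set₁
SolvableInPolynomialTime enc Yes =
  Σ TuringMachine λ M → ∃[ c ] ∃[ k ] (∀ x → ∃[ b ]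
    (run M (c * length (enc x) ^ k + c) (initial M (enc x)) ≡ just b
     × (b ≡ true ⇔ Yes x)))

CSPSolvableInPolynomialTime : {τ : Signature} {D : Set} → Structure τ D → Set₁
CSPSolvableInPolynomialTime A = SolvableInPolynomialTime encode (A ⊨_)

{-# OPTIONS --safe #-}
module Submission where

-- A relation definable in (ℤ;<) cannot tell apart tuples whose differences agree up to a threshold
-- (a back-and-forth argument). Reflecting ℤ, assume that min_d is a polymorphism. Combining a
-- solution a with b - c for large c lowers exactly the coordinates where a and b - c agree modulo d;
-- hence a set of coordinates whose residues are not tied to the others can be lowered arbitrarily,
-- and thereby be given any residue. So residues can be assigned to the variables greedily:
-- propagate what is forced, otherwise choose freely. Once the residues r are fixed, the relations in
-- y, where x = r + d y, are closed under minima. Starting from y = 0, every violated constraint has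
-- a coordinate that is smaller than in every solution above y, and which one it is depends only on
-- the clamped differences; raise it. If there is a solution there is one with all heights at most
-- linear in the number of variables, so a quadratic number of rounds decides satisfiability. The
-- rounds are carried out by a program on stacks, compiled to a Turing machine.

-- The obstacle is that residues might be tied together by many coordinates at once, while
-- propagation only looks at pairs. Pairs suffice because of the structure of the sets that can be
-- lowered from a fixed solution a: they include, for every tuple b of the relation, the set of all
-- i with a i congruent to b i modulo d, and they are closed under complement and union. So a set is
-- among them as soon as each of its points is separated from each point outside. What makes the
-- closure work is that a relation notices a large difference only as large, so an amount of
-- lowering may be changed modulo d; this prepares the congruences for the next use of the
-- operation. Since all large amounts work, one amount serves all constraints. Soundness and
-- completeness are asymmetric. A round in which no rule fires exhibits a solution whatever happened
-- before, so only completeness needs an invariant. If a solution exists, every round that fires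
-- either settles one residue for good or raises one height that is still below a bounded solution,
-- which limits the number of such rounds.

open import Data.Bool.Base using (Bool; true; false; if_then_else_; _∧_; _∨_)
open import Data.Fin.Base using (Fin; zero; suc; toℕ)
open import Data.List.Base using (List; []; _∷_)
open import Data.Maybe.Base using (Maybe; just; nothing; is-just; is-nothing; fromMaybe; maybe′)
open import Data.Nat.Base using (ℕ; zero; suc)
open import Data.Product.Base using (Σ; ∃; ∃-syntax; _×_; _,_; proj₁; proj₂)
open import Data.Sum.Base using (_⊎_; inj₁; inj₂)
open import Data.Vec.Base using (Vec; []; _∷_; lookup; tabulate)
open import Function.Base using (_∘_; id)
open import Function.Bundles using (_⇔_; Equivalence; mk⇔)
open import Data.List.Membership.Propositional using (_∈_)
open import Data.List.Membership.Propositional.Properties using (∈-allFin)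
open import Data.List.Relation.Unary.Any using (here; there)
open import Data.Vec.Properties using (lookup∘tabulate; lookup-map; tabulate-cong; tabulate∘lookup; lookup-replicate)
open import Data.Integer.Divisibility.Signed using (_∣_; divides; _∣?_; ∣m⇒∣-m)
open import Relation.Nullary using (Dec; yes; no; ¬_; contradiction)
open import Relation.Binary.PropositionalEquality
import Data.Nat.Base as ℕ
import Data.Nat.Properties as ℕ
import Data.Integer.Base as ℤ
import Data.Integer.Properties as ℤ
import Data.Fin.Properties as Fin
import Data.Bool.Base as Bool
import Data.Bool.Properties as Bool
import Data.List.Base as List
import Data.List.Properties as List

-- Finite codes for symbols and states.

module Codes where

  open import Data.Fin.Base using (combine; remQuot; join; splitAt; _↑ˡ_; _↑ʳ_)
  open import Data.Fin.Properties using (any?; remQuot-combine; splitAt-join; splitAt-↑ˡ; splitAt-↑ʳ)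
  open import Data.Nat.Base using (_+_; _*_)
  import Data.Product.Base as Product
  open import Data.Sum.Base using ([_,_]′)
  import Data.Sum.Base as Sum
  open import Data.Unit.Base using (⊤; tt)
  open import Relation.Nullary using (map′)

  -- A one-sided inverse is enough: the machine takes all of `Fin size` as states or symbols, and a
  -- code outside the image of `to` merely decodes to something.
  record Enc (A : Set) : Set where
    field
      size : ℕ
      to   : A → Fin size
      from : Fin size → A
      inv  : ∀ a → from (to a) ≡ a

  open Enc public

  Enc-retract : {A B : Set} (f : A → B) (g : B → A) → (∀ a → g (f a) ≡ a) → Enc B → Enc A
  Enc-retract f g gf e = record
    { size = size e
    ; to   = to e ∘ f
    ; from = g ∘ from e
    ; inv  = λ a → trans (cong g (inv e (f a))) (gf a)
    }

  Enc-Fin : ∀ {n} → Enc (Fin n)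
  Enc-Fin = record { to = id ; from = id ; inv = λ _ → refl }

  Enc-⊤ : Enc ⊤
  Enc-⊤ = record { size = 1 ; to = λ _ → zero ; from = λ _ → tt ; inv = λ _ → refl }

  Enc-⊎ : {A B : Set} → Enc A → Enc B → Enc (A ⊎ B)
  Enc-⊎ a b = record
    { size = size a + size b
    ; to   = join (size a) (size b) ∘ Sum.map (to a) (to b)
    ; from = Sum.map (from a) (from b) ∘ splitAt (size a)
    ; inv  = λ x → trans (cong (Sum.map (from a) (from b)) (splitAt-join (size a) (size b) (Sum.map (to a) (to b) x))) (back x)
    }
    where
    back : ∀ x → Sum.map (from a) (from b) (Sum.map (to a) (to b) x) ≡ x
    back (inj₁ x) = cong inj₁ (inv a x)
    back (inj₂ y) = cong inj₂ (inv b y)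

  Enc-× : {A B : Set} → Enc A → Enc B → Enc (A × B)
  Enc-× a b = record
    { size = size a * size b
    ; to   = λ (x , y) → combine (to a x) (to b y)
    ; from = Product.map (from a) (from b) ∘ remQuot (size b)
    ; inv  = λ (x , y) → trans (cong (Product.map (from a) (from b)) (remQuot-combine (to a x) (to b y)))
                               (cong₂ _,_ (inv a x) (inv b y))
    }

  Enc-Maybe : {A : Set} → Enc A → Enc (Maybe A)
  Enc-Maybe e = Enc-retract f g (λ { nothing → refl ; (just _) → refl }) (Enc-⊎ Enc-⊤ e)
    where
    f : Maybe _ → ⊤ ⊎ _
    f nothing  = inj₁ tt
    f (just x) = inj₂ x
    g : ⊤ ⊎ _ → Maybe _
    g (inj₁ _) = nothing
    g (inj₂ x) = just x

  Enc-Bool : Enc Bool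
  Enc-Bool = Enc-retract f g (λ { false → refl ; true → refl }) (Enc-⊎ Enc-⊤ Enc-⊤)
    where
    f : Bool → ⊤ ⊎ ⊤
    f false = inj₁ tt
    f true  = inj₂ tt
    g : ⊤ ⊎ ⊤ → Bool
    g (inj₁ _) = false
    g (inj₂ _) = true

  Enc-Vec : {A : Set} → Enc A → ∀ n → Enc (Vec A n)
  Enc-Vec e zero    = Enc-retract (λ _ → tt) (λ _ → []) (λ { [] → refl }) Enc-⊤
  Enc-Vec e (suc n) = Enc-retract (λ { (x ∷ xs) → x , xs }) (λ (x , xs) → x ∷ xs)
                                  (λ { (x ∷ xs) → refl }) (Enc-× e (Enc-Vec e n))

  Enc-any? : {A : Set} → Enc A → {P : A → Set} → (∀ a → Dec (P a)) → Dec (∃ P)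
  Enc-any? e {P} P? = map′ (λ (i , p) → from e i , p)
                           (λ (a , p) → to e a , subst P (sym (inv e a)) p)
                           (any? (λ i → P? (from e i)))

  -- One alphabet shared by a family of types. The reader of a symbol supplies `i` itself, so the
  -- types attached to different relation symbols fit on the same stack.
  record Joint {m : ℕ} (F : Fin m → Set) : Set where
    field
      width  : ℕ
      pack   : ∀ i → F i → Fin width
      unpack : ∀ i → Fin width → F i
      unpack-pack : ∀ i x → unpack i (pack i x) ≡ x

  open Joint public

  -- The elements `x i` are defaults for symbols that belong to another index.
  joint : ∀ {m} {F : Fin m → Set} → (∀ i → Enc (F i)) → (∀ i → F i) → Joint F
  joint {zero}  e x = record { width = 0 ; pack = λ () ; unpack = λ () ; unpack-pack = λ () }
  joint {suc m} {F} e x = record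
    { width = size (e zero) + width rest ; pack = p ; unpack = u ; unpack-pack = up }
    where
    rest : Joint (F ∘ suc)
    rest = joint (e ∘ suc) (x ∘ suc)
    p : ∀ i → F i → Fin (size (e zero) + width rest)
    p zero    y = to (e zero) y ↑ˡ width rest
    p (suc i) y = size (e zero) ↑ʳ pack rest i y
    u : ∀ i → Fin (size (e zero) + width rest) → F i
    u zero    = [ from (e zero) , (λ _ → x zero) ]′ ∘ splitAt (size (e zero))
    u (suc i) = [ (λ _ → x (suc i)) , unpack rest i ]′ ∘ splitAt (size (e zero))
    up : ∀ i y → u i (p i y) ≡ y
    up zero    y rewrite splitAt-↑ˡ (size (e zero)) (to (e zero) y) (width rest) = inv (e zero) y
    up (suc i) y rewrite splitAt-↑ʳ (size (e zero)) (width rest) (pack rest i y) = unpack-pack rest i y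

-- Programs on stacks and their compilation to Turing machines.

module StackMachines where

  open import Defs
  open Codes
  import Data.List.Base as List
  import Data.Maybe.Base as Maybe
  open import Data.Nat.Base using (_+_; _≤_; s≤s)
  open import Data.Nat.Properties
  import Data.Product.Base as Product
  open import Data.Unit.Base using (⊤; tt)
  open import Data.Vec.Base as Vec using (zipWith)
  open import Data.Vec.Relation.Unary.All as All using ([]; _∷_)
  open import Data.Vec.Relation.Binary.Pointwise.Inductive as PW using (Pointwise; []; _∷_)
  open import Function.Properties.Inverse using (↔-refl)

  module StackMachine (A : Set) (encA : Enc A) (extra : ℕ) where

    Elem : Set
    Elem = Bool ⊎ A

    Store Tops : Set
    Store = Vec (List Elem) (suc extra)
    Tops  = Vec (Maybe Elem) (suc extra)

    data Op : Set where
      keep remove : Op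
      push put : Elem → Op

    apply : Op → List Elem → List Elem
    apply keep     xs = xs
    apply remove     xs = List.drop 1 xs
    apply (push x) xs = x ∷ xs
    apply (put x)  xs = x ∷ List.drop 1 xs

    tops : Store → Tops
    tops = Vec.map List.head

    data Prog : Set where
      prim  : (Tops → Vec Op (suc extra)) → Prog
      _⨾_   : Prog → Prog → Prog
      while : (Tops → Bool) → Prog → Prog
      ite   : (Tops → Bool) → Prog → Prog → Prog

    infixr 5 _⨾_

    -- The last index is an upper bound for the running time: `within` may raise it, so that the
    -- cost of a loop can be stated in terms of a bound for its data.
    data Run : Prog → Store → Store → ℕ → Set where
      prim   : ∀ {f s} → Run (prim f) s (zipWith apply (f (tops s)) s) 2
      _⨾_    : ∀ {p q s s′ s″ a b} → Run p s s′ a → Run q s′ s″ b → Run (p ⨾ q) s s″ (a + b)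
      stop   : ∀ {t p s} → t (tops s) ≡ false → Run (while t p) s s 1
      again  : ∀ {t p s s′ s″ a b} → t (tops s) ≡ true → Run p s s′ a →
               Run (while t p) s′ s″ b → Run (while t p) s s″ (suc a + b)
      then   : ∀ {t p q s s′ a} → t (tops s) ≡ true → Run p s s′ a → Run (ite t p q) s s′ (suc a)
      else   : ∀ {t p q s s′ a} → t (tops s) ≡ false → Run q s s′ a → Run (ite t p q) s s′ (suc a)
      within : ∀ {p s s′ a b} → a ≤ b → Run p s s′ a → Run p s s′ b

    -- A primitive instruction takes two steps of the machine, since a pushed
    -- symbol is written to the cell that the head moves to: the pending
    -- operations are kept in the state.
    Control : Prog → Set
    Control (prim f)    = Maybe (Vec Op (suc extra))
    Control (p ⨾ q)     = Control p ⊎ Control q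
    Control (while t p) = Maybe (Control p)
    Control (ite t p q) = Maybe (Control p ⊎ Control q)

    entry : ∀ p → Control p
    entry (prim f)    = nothing
    entry (p ⨾ q)     = inj₁ (entry p)
    entry (while t p) = nothing
    entry (ite t p q) = nothing

    Symbol : Set
    Symbol = Cell (Fin (size encA))

    symbol : Elem → Symbol
    symbol (inj₁ b) = bit b
    symbol (inj₂ a) = work (to encA a)

    element : Symbol → Maybe Elem
    element blank    = nothing
    element (bit b)  = just (inj₁ b)
    element (work i) = just (inj₂ (from encA i))

    element-symbol : ∀ x → element (symbol x) ≡ just x
    element-symbol (inj₁ b) = refl
    element-symbol (inj₂ a) = cong (just ∘ inj₂) (inv encA a)

    -- The input tape is a stack growing to the left, all others grow to the right.
    data Side : Set where
      input other : Side

    up down : Side → Move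
    up   input = left
    up   other = right
    down input = right
    down other = left

    Act : Set
    Act = Symbol × Move

    before-write after-move : Side → Op → Symbol → Act
    before-write d keep     h = h , stay
    before-write d remove     h = blank , down d
    before-write d (push x) h = h , up d
    before-write d (put x)  h = symbol x , stay
    after-move d (push x) h = symbol x , stay
    after-move d _        h = h , stay

    onTapes : {X : Set} → (Side → X → Symbol → Act) →
              Vec X (suc extra) → Vec Symbol (suc extra) → Vec Act (suc extra)
    onTapes g (x ∷ xs) (h ∷ hs) = g input x h ∷ zipWith (g other) xs hs

    idle : Vec Symbol (suc extra) → Vec Act (suc extra)
    idle = Vec.map (_, stay)

    -- The control `nothing` in the result means that the program is left after this move;
    -- sequencing and loops redirect this exit.
    δ′ : ∀ p → Control p → Vec Symbol (suc extra) → Maybe (Control p) × Vec Act (suc extra)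
    δ′ (prim f) nothing hs =
      just (just (f (Vec.map element hs))) , onTapes before-write (f (Vec.map element hs)) hs
    δ′ (prim f) (just os) hs = nothing , onTapes after-move os hs
    δ′ (p ⨾ q) (inj₁ s) hs =
      Product.map₁ (just ∘ maybe′ inj₁ (inj₂ (entry q))) (δ′ p s hs)
    δ′ (p ⨾ q) (inj₂ s) hs = Product.map₁ (Maybe.map inj₂) (δ′ q s hs)
    δ′ (while t p) nothing hs =
      (if t (Vec.map element hs) then just (just (entry p)) else nothing) , idle hs
    δ′ (while t p) (just s) hs = Product.map₁ just (δ′ p s hs)
    δ′ (ite t p q) nothing hs =
      just (just (if t (Vec.map element hs) then inj₁ (entry p) else inj₂ (entry q))) , idle hs
    δ′ (ite t p q) (just (inj₁ s)) hs = Product.map₁ (Maybe.map (just ∘ inj₁)) (δ′ p s hs)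
    δ′ (ite t p q) (just (inj₂ s)) hs = Product.map₁ (Maybe.map (just ∘ inj₂)) (δ′ q s hs)

    Enc-Op : Enc Op
    Enc-Op = Enc-retract f g fg (Enc-⊎ (Enc-⊎ Enc-⊤ Enc-⊤) (Enc-⊎ eE eE))
      where
      eE : Enc Elem
      eE = Enc-⊎ Enc-Bool encA
      f : Op → (⊤ ⊎ ⊤) ⊎ (Elem ⊎ Elem)
      f keep     = inj₁ (inj₁ tt)
      f remove   = inj₁ (inj₂ tt)
      f (push x) = inj₂ (inj₁ x)
      f (put x)  = inj₂ (inj₂ x)
      g : (⊤ ⊎ ⊤) ⊎ (Elem ⊎ Elem) → Op
      g (inj₁ (inj₁ _)) = keep
      g (inj₁ (inj₂ _)) = remove
      g (inj₂ (inj₁ x)) = push x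
      g (inj₂ (inj₂ x)) = put x
      fg : ∀ o → g (f o) ≡ o
      fg keep     = refl
      fg remove     = refl
      fg (push x) = refl
      fg (put x)  = refl

    Enc-Control : ∀ p → Enc (Control p)
    Enc-Control (prim f)    = Enc-Maybe (Enc-Vec Enc-Op _)
    Enc-Control (p ⨾ q)     = Enc-⊎ (Enc-Control p) (Enc-Control q)
    Enc-Control (while t p) = Enc-Maybe (Enc-Control p)
    Enc-Control (ite t p q) = Enc-Maybe (Enc-⊎ (Enc-Control p) (Enc-Control q))

    Rep : List Elem → Symbol → List Symbol → Set
    Rep []       h cs = h ≡ blank × cs ≡ []
    Rep (x ∷ xs) h cs = h ≡ symbol x × Rep xs (proj₁ (pop cs)) (proj₂ (pop cs))

    -- Nothing is demanded of the cells beyond the top of the stack: a push overwrites the cell it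
    -- moves to, whatever that holds.
    RepT : Side → List Elem → Tape (Fin (size encA)) → Set
    RepT input xs (tape l h r) = Rep xs h r
    RepT other xs (tape l h r) = Rep xs h l

    RepS : Store → Vec (Tape (Fin (size encA))) (suc extra) → Set
    RepS (xs ∷ s) (t ∷ ts) = RepT input xs t × Pointwise (RepT other) s ts

    Rep-drop : ∀ xs {h cs} → Rep xs h cs → Rep (List.drop 1 xs) (proj₁ (pop cs)) (proj₂ (pop cs))
    Rep-drop []       (_ , refl) = refl , refl
    Rep-drop (x ∷ xs) (_ , r)    = r

    Rep-put : ∀ xs x {h cs} → Rep xs h cs → Rep (x ∷ List.drop 1 xs) (symbol x) cs
    Rep-put xs x r = refl , Rep-drop xs r

    Rep-top : ∀ xs {h cs} → Rep xs h cs → element h ≡ List.head xs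
    Rep-top []       (refl , _) = refl
    Rep-top (x ∷ xs) (refl , _) = element-symbol x

    act₂ : Side → Op → Tape (Fin (size encA)) → Tape (Fin (size encA))
    act₂ d o t = act t₁ (after-move d o (Tape.head t₁))
      where t₁ = act t (before-write d o (Tape.head t))

    RepT-apply : ∀ d o xs t → RepT d xs t → RepT d (apply o xs) (act₂ d o t)
    RepT-apply input keep     xs (tape l h r) p = p
    RepT-apply input remove     xs (tape l h r) p = Rep-drop xs p
    RepT-apply input (push x) xs (tape l h r) p = refl , p
    RepT-apply input (put x)  xs (tape l h r) p = Rep-put xs x p
    RepT-apply other keep     xs (tape l h r) p = p
    RepT-apply other remove     xs (tape l h r) p = Rep-drop xs p
    RepT-apply other (push x) xs (tape l h r) p = refl , p
    RepT-apply other (put x)  xs (tape l h r) p = Rep-put xs x p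

    RepS-tops : ∀ s ts → RepS s ts → Vec.map element (Vec.map Tape.head ts) ≡ tops s
    RepS-tops (xs ∷ s) (t ∷ ts) (p , ps) = cong₂ _∷_ (Rep-top xs p) (go s ts ps)
      where
      go : ∀ {n} (s : Vec (List Elem) n) ts → Pointwise (RepT other) s ts →
           Vec.map element (Vec.map Tape.head ts) ≡ Vec.map List.head s
      go []       []       []       = refl
      go (xs ∷ s) (t ∷ ts) (p ∷ ps) = cong₂ _∷_ (Rep-top xs p) (go s ts ps)

    Tapes : Set
    Tapes = Vec (Tape (Fin (size encA))) (suc extra)

    heads : Tapes → Vec Symbol (suc extra)
    heads = Vec.map Tape.head

    idle-act : ∀ (ts : Tapes) → zipWith act ts (idle (heads ts)) ≡ ts
    idle-act = go
      where
      go : ∀ {n} (ts : Vec (Tape (Fin (size encA))) n) →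
           zipWith act ts (Vec.map (_, stay) (Vec.map Tape.head ts)) ≡ ts
      go []       = refl
      go (t ∷ ts) = cong (t ∷_) (go ts)

    module _ (os : Vec Op (suc extra)) where

      first second : Tapes → Tapes
      first  ts = zipWith act ts (onTapes before-write os (heads ts))
      second ts = zipWith act ts (onTapes after-move os (heads ts))

    RepS-apply : ∀ os s ts → RepS s ts → RepS (zipWith apply os s) (second os (first os ts))
    RepS-apply (o ∷ os) (xs ∷ s) (t ∷ ts) (p , ps) = RepT-apply input o xs t p , go os s ts ps
      where
      go : ∀ {n} (os : Vec Op n) (s : Vec (List Elem) n) ts → Pointwise (RepT other) s ts →
           let ts₁ = zipWith act ts (zipWith (before-write other) os (Vec.map Tape.head ts)) in
           Pointwise (RepT other) (zipWith apply os s)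
             (zipWith act ts₁ (zipWith (after-move other) os (Vec.map Tape.head ts₁)))
      go []       []       []       []       = []
      go (o ∷ os) (xs ∷ s) (t ∷ ts) (p ∷ ps) = RepT-apply other o xs t p ∷ go os s ts ps

    -- Terminating traces at the level of `δ′`, before states are encoded; in this form a trace of a
    -- subprogram embeds directly into one of the surrounding program.
    data Exits (p : Prog) : Control p → Tapes → Tapes → ℕ → Set where
      exit : ∀ {s ts as} → δ′ p s (heads ts) ≡ (nothing , as) →
             Exits p s ts (zipWith act ts as) 1
      more : ∀ {s s′ ts ts′ as n} → δ′ p s (heads ts) ≡ (just s′ , as) →
             Exits p s′ (zipWith act ts as) ts′ n → Exits p s ts ts′ (suc n)

    Exits-seqʳ : ∀ {p q s ts ts′ n} → Exits q s ts ts′ n → Exits (p ⨾ q) (inj₂ s) ts ts′ n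
    Exits-seqʳ (exit eqn)   = exit (cong (Product.map₁ (Maybe.map inj₂)) eqn)
    Exits-seqʳ (more eqn e) = more (cong (Product.map₁ (Maybe.map inj₂)) eqn) (Exits-seqʳ e)

    Exits-seq : ∀ {p q s ts ts′ ts″ m n} → Exits p s ts ts′ m → Exits q (entry q) ts′ ts″ n →
                Exits (p ⨾ q) (inj₁ s) ts ts″ (m + n)
    Exits-seq {q = q} (exit eqn)   f =
      more (cong (Product.map₁ (just ∘ maybe′ inj₁ (inj₂ (entry q)))) eqn) (Exits-seqʳ f)
    Exits-seq {q = q} (more eqn e) f =
      more (cong (Product.map₁ (just ∘ maybe′ inj₁ (inj₂ (entry q)))) eqn) (Exits-seq e f)

    Exits-while : ∀ {t p s ts ts′ ts″ m n} → Exits p s ts ts′ m → Exits (while t p) nothing ts′ ts″ n →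
                  Exits (while t p) (just s) ts ts″ (m + n)
    Exits-while (exit eqn)   f = more (cong (Product.map₁ just) eqn) f
    Exits-while (more eqn e) f = more (cong (Product.map₁ just) eqn) (Exits-while e f)

    Exits-then : ∀ {t p q s ts ts′ n} → Exits p s ts ts′ n → Exits (ite t p q) (just (inj₁ s)) ts ts′ n
    Exits-then (exit eqn)   = exit (cong (Product.map₁ (Maybe.map (just ∘ inj₁))) eqn)
    Exits-then (more eqn e) = more (cong (Product.map₁ (Maybe.map (just ∘ inj₁))) eqn) (Exits-then e)

    Exits-else : ∀ {t p q s ts ts′ n} → Exits q s ts ts′ n → Exits (ite t p q) (just (inj₂ s)) ts ts′ n
    Exits-else (exit eqn)   = exit (cong (Product.map₁ (Maybe.map (just ∘ inj₂))) eqn)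
    Exits-else (more eqn e) = more (cong (Product.map₁ (Maybe.map (just ∘ inj₂))) eqn) (Exits-else e)

    simulate : ∀ {p s s′ n} → Run p s s′ n → ∀ ts → RepS s ts →
               ∃[ ts′ ] ∃[ m ] m ≤ n × Exits p (entry p) ts ts′ m × RepS s′ ts′
    simulate {prim f} {s} prim ts r =
      second os (first os ts) , 2 , ≤-refl , more refl (exit refl) ,
      subst (λ os → RepS (zipWith apply (f (tops s)) s) (second os (first os ts)))
            (cong f (sym (RepS-tops s ts r))) (RepS-apply (f (tops s)) s ts r)
      where os = f (Vec.map element (heads ts))
    simulate (_⨾_ e f) ts r
      with ts₁ , m , m≤ , e₁ , r₁ ← simulate e ts r
      with ts₂ , n , n≤ , e₂ , r₂ ← simulate f ts₁ r₁
      = ts₂ , m + n , +-mono-≤ m≤ n≤ , Exits-seq e₁ e₂ , r₂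
    simulate {while t p} {s} (stop eqn) ts r =
      ts , 1 , ≤-refl ,
      subst (λ ts′ → Exits (while t p) nothing ts ts′ 1) (idle-act ts)
        (exit (cong (λ b → (if b then just (just (entry p)) else nothing) , idle (heads ts))
                    (trans (cong t (RepS-tops s ts r)) eqn))) , r
    simulate {while t p} {s} (again eqn e f) ts r
      with ts₁ , m , m≤ , e₁ , r₁ ← simulate e ts r
      with ts₂ , n , n≤ , e₂ , r₂ ← simulate f ts₁ r₁
      = ts₂ , suc m + n , +-mono-≤ (s≤s m≤) n≤ ,
        more (cong (λ b → (if b then just (just (entry p)) else nothing) , idle (heads ts))
                   (trans (cong t (RepS-tops s ts r)) eqn))
             (subst (λ ts → Exits (while t p) (just (entry p)) ts ts₂ (m + n)) (sym (idle-act ts))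
               (Exits-while e₁ e₂)) , r₂
    simulate {ite t p q} {s} (then eqn e) ts r
      with ts₁ , m , m≤ , e₁ , r₁ ← simulate e ts r
      = ts₁ , suc m , s≤s m≤ ,
        more (cong (λ b → just (just (if b then inj₁ (entry p) else inj₂ (entry q))) , idle (heads ts))
                   (trans (cong t (RepS-tops s ts r)) eqn))
             (subst (λ ts → Exits (ite t p q) (just (inj₁ (entry p))) ts ts₁ m) (sym (idle-act ts))
               (Exits-then e₁)) , r₁
    simulate {ite t p q} {s} (else eqn e) ts r
      with ts₁ , m , m≤ , e₁ , r₁ ← simulate e ts r
      = ts₁ , suc m , s≤s m≤ ,
        more (cong (λ b → just (just (if b then inj₁ (entry p) else inj₂ (entry q))) , idle (heads ts))
                   (trans (cong t (RepS-tops s ts r)) eqn))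
             (subst (λ ts → Exits (ite t p q) (just (inj₂ (entry q))) ts ts₁ m) (sym (idle-act ts))
               (Exits-else e₁)) , r₁
    simulate (within a≤b e) ts r
      with ts₁ , m , m≤ , e₁ , r₁ ← simulate e ts r
      = ts₁ , m , ≤-trans m≤ a≤b , e₁ , r₁

    -- The code of the control is a parameter, so that correctness of the machine is proved without
    -- unfolding a concrete state space.
    module Machine (p : Prog) (verdict : Tops → Bool) (enc : Enc (Maybe (Control p))) where

      transition : Maybe (Control p) → Vec Symbol (suc extra) →
                   Bool ⊎ (Fin (size enc) × Vec Act (suc extra))
      transition nothing  hs = inj₁ (verdict (Vec.map element hs))
      transition (just s) hs = inj₂ (Product.map₁ (to enc) (δ′ p s hs))

      machine : TuringMachine
      machine = record
        { State        = Fin (size enc)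
        ; state-finite = size enc , ↔-refl
        ; Work         = Fin (size encA)
        ; work-finite  = size encA , ↔-refl
        ; extraTapes   = extra
        ; start        = to enc (just (entry p))
        ; δ            = λ q hs → transition (from enc q) hs
        }

      run-halt : ∀ ts n → run machine (suc n) (to enc nothing , ts) ≡
                          just (verdict (Vec.map element (heads ts)))
      run-halt ts n rewrite inv enc nothing = refl

      run-step : ∀ s ts {s′ as} n → δ′ p s (heads ts) ≡ (s′ , as) →
                 run machine (suc n) (to enc (just s) , ts) ≡
                 run machine n (to enc s′ , zipWith act ts as)
      run-step s ts n eqn rewrite inv enc (just s) | eqn = refl

      run-exits : ∀ {s ts ts′ m} → Exits p s ts ts′ m → ∀ n →
                  run machine (m + suc n) (to enc (just s) , ts) ≡
                  just (verdict (Vec.map element (heads ts′)))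
      run-exits {s} {ts} (exit eqn)   n = trans (run-step s ts (suc n) eqn) (run-halt _ n)
      run-exits {s} {ts} (more {n = m} eqn e) n = trans (run-step s ts (m + suc n) eqn) (run-exits e n)

      RepS-initial : ∀ w → RepS (List.map inj₁ w ∷ Vec.replicate extra [])
                           (fromList (List.map bit w) ∷ Vec.replicate extra (fromList []))
      RepS-initial w = start-rep w , go extra
        where
        start-rep : ∀ w → RepT input (List.map inj₁ w) (fromList (List.map bit w))
        start-rep []          = refl , refl
        start-rep (b ∷ [])    = refl , refl , refl
        start-rep (b ∷ c ∷ w) = refl , start-rep (c ∷ w)
        go : ∀ n → Pointwise (RepT other) (Vec.replicate n []) (Vec.replicate n (fromList []))
        go zero    = []
        go (suc n) = (refl , refl) ∷ go n

      -- One step beyond the time of the program is spent on emitting the verdict.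
      machine-run : ∀ w {s n} → Run p (List.map inj₁ w ∷ Vec.replicate extra []) s n → ∀ N → suc n ≤ N →
                    run machine N (initial machine w) ≡ just (verdict (tops s))
      machine-run w {s} {n} e N n<N
        with ts , m , m≤n , e′ , r ← simulate e _ (RepS-initial w)
        = subst₂ (λ N v → run machine N (initial machine w) ≡ just (verdict v))
                 (trans (+-suc m (N ∸ suc m)) (m+[n∸m]≡n (≤-trans (s≤s m≤n) n<N)))
                 (RepS-tops s ts r)
                 (run-exits e′ (N ∸ suc m))
        where open import Data.Nat.Base using (_∸_)

-- Locality of the relations definable in the order of the integers.

module Locality where

  open import Defs
  open import Data.Fin.Base using (fromℕ<)
  open import Data.Fin.Properties using (any?; toℕ-fromℕ<)
  open import Data.Integer.Base as ℤ using (ℤ; +_; -[1+_]; -_; _-_; _≤_; _<_; ∣_∣; 0ℤ; 1ℤ; +≤+; -≤+; -≤-)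
  open import Data.Integer.Tactic.RingSolver using (solve-∀)
  import Data.Nat.Base as ℕ
  open import Data.Unit.Base using (⊤; tt)
  import Data.Vec.Base as Vec
  open import Level using (0ℓ)
  open import Relation.Nullary using (map′; _×-dec_; _⊎-dec_; ¬?)
  open import Relation.Nullary.Decidable using (decidable-stable)
  open import Relation.Unary using (Pred)

  -- Linear inequalities are proved by writing the difference of the two sides as a sum of known
  -- nonnegative differences; the identity is left to the ring solver.
  lin₁ : ∀ {a b x y} → x ≤ y → b - a ≡ y - x → a ≤ b
  lin₁ {a} {b} x≤y e = ℤ.0≤i-j⇒j≤i (subst (0ℤ ≤_) (sym e) (ℤ.i≤j⇒0≤j-i x≤y))

  lin₂ : ∀ {a b x y u v} → x ≤ y → u ≤ v → b - a ≡ (y - x) ℤ.+ (v - u) → a ≤ b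
  lin₂ x≤y u≤v e = ℤ.0≤i-j⇒j≤i (subst (0ℤ ≤_) (sym e)
    (ℤ.+-mono-≤ (ℤ.i≤j⇒0≤j-i x≤y) (ℤ.i≤j⇒0≤j-i u≤v)))

  lin₃ : ∀ {a b x y u v p q} → x ≤ y → u ≤ v → p ≤ q →
         b - a ≡ (y - x) ℤ.+ (v - u) ℤ.+ (q - p) → a ≤ b
  lin₃ x≤y u≤v p≤q e = ℤ.0≤i-j⇒j≤i (subst (0ℤ ≤_) (sym e)
    (ℤ.+-mono-≤ (ℤ.+-mono-≤ (ℤ.i≤j⇒0≤j-i x≤y) (ℤ.i≤j⇒0≤j-i u≤v)) (ℤ.i≤j⇒0≤j-i p≤q)))

  ∣∣≤⇒≤ : ∀ {K} z → ∣ z ∣ ℕ.≤ K → z ≤ + K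
  ∣∣≤⇒≤ (+ n)    le = +≤+ le
  ∣∣≤⇒≤ -[1+ n ] le = -≤+

  ∣∣≤⇒≥ : ∀ {K} z → ∣ z ∣ ℕ.≤ K → - + K ≤ z
  ∣∣≤⇒≥ z le = ℤ.neg-cancel-≤ (subst (- z ≤_) (sym (ℤ.neg-involutive (+ _)))
                 (∣∣≤⇒≤ (- z) (subst (ℕ._≤ _) (sym (ℤ.∣-i∣≡∣i∣ z)) le)))

  far : ∀ {K} z → ¬ (∣ z ∣ ℕ.≤ K) → + suc K ≤ z ⊎ z ≤ - + suc K
  far (+ n)    nle = inj₁ (+≤+ (ℕ.≰⇒> nle))
  far -[1+ n ] nle = inj₂ (-≤- (ℕ.≤-pred (ℕ.≰⇒> nle)))

  -- Agreement of two differences at resolution `K`: exact in between, while from `K` upwards and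
  -- from `- K` downwards only the side is retained.
  data Sim (K : ℕ) (a b : ℤ) : Set where
    same : a ≡ b → Sim K a b
    up   : + K ≤ a → + K ≤ b → Sim K a b
    dn   : a ≤ - + K → b ≤ - + K → Sim K a b

  Close : ℕ → ∀ {n} → (Fin n → ℤ) → (Fin n → ℤ) → Set
  Close K s t = ∀ i j → Sim K (s i - s j) (t i - t j)

  Sim-sym : ∀ {K a b} → Sim K a b → Sim K b a
  Sim-sym (same p) = same (sym p)
  Sim-sym (up p q) = up q p
  Sim-sym (dn p q) = dn q p

  Sim-mono : ∀ {K L a b} → L ℕ.≤ K → Sim K a b → Sim L a b
  Sim-mono le (same p) = same p
  Sim-mono le (up p q) = up (ℤ.≤-trans (+≤+ le) p) (ℤ.≤-trans (+≤+ le) q)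
  Sim-mono le (dn p q) = dn (ℤ.≤-trans p (ℤ.neg-mono-≤ (+≤+ le))) (ℤ.≤-trans q (ℤ.neg-mono-≤ (+≤+ le)))

  Sim-neg : ∀ {K a b} → Sim K a b → Sim K (- a) (- b)
  Sim-neg (same p) = same (cong -_ p)
  Sim-neg (up p q) = dn (ℤ.neg-mono-≤ p) (ℤ.neg-mono-≤ q)
  Sim-neg {K} (dn p q) = up (subst (_≤ _) (ℤ.neg-involutive (+ K)) (ℤ.neg-mono-≤ p))
                            (subst (_≤ _) (ℤ.neg-involutive (+ K)) (ℤ.neg-mono-≤ q))

  -- A value of at least `B + K` is still at least `K` after a shift by at most `B`, so the
  -- resolution drops by the size of the shift.
  Sim-shift : ∀ {B K a b} c → ∣ c ∣ ℕ.≤ B → Sim (B ℕ.+ K) a b → Sim K (c ℤ.+ a) (c ℤ.+ b)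
  Sim-shift c le (same p) = same (cong (ℤ._+_ c) p)
  Sim-shift {B} {K} c le (up p q) = up (go p) (go q)
    where
    eqn : ∀ b k c a → (c ℤ.+ a) - k ≡ (c - - b) ℤ.+ (a - (b ℤ.+ k))
    eqn = solve-∀
    go : ∀ {a} → + (B ℕ.+ K) ≤ a → + K ≤ c ℤ.+ a
    go {a} p = lin₂ (∣∣≤⇒≥ c le) p (eqn (+ B) (+ K) c a)
  Sim-shift {B} {K} c le (dn p q) = dn (go p) (go q)
    where
    eqn : ∀ b k c a → - k - (c ℤ.+ a) ≡ (b - c) ℤ.+ (- (b ℤ.+ k) - a)
    eqn = solve-∀
    go : ∀ {a} → a ≤ - + (B ℕ.+ K) → c ℤ.+ a ≤ - + K
    go {a} p = lin₂ (∣∣≤⇒≤ c le) p (eqn (+ B) (+ K) c a)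

  Sim-≤0 : ∀ {K a b} → Sim (suc K) a b → a ≤ 0ℤ → b ≤ 0ℤ
  Sim-≤0 (same refl) le = le
  Sim-≤0 (up p q) le = contradiction (ℤ.≤-trans p le) (λ { (+≤+ ()) })
  Sim-≤0 (dn p q) le = ℤ.≤-trans q -≤+

  Sim-dn : ∀ {K a b} → Sim (suc K) a b → a ≤ - + suc K → b ≤ - + suc K
  Sim-dn (same refl) le = le
  Sim-dn (up p q) le = contradiction (ℤ.≤-trans p le) (λ ())
  Sim-dn (dn p q) le = q

  Close-sym : ∀ {K n} (s t : Fin n → ℤ) → Close K s t → Close K t s
  Close-sym s t c i j = Sim-sym (c i j)

  Close-mono : ∀ {K L n} (s t : Fin n → ℤ) → L ℕ.≤ K → Close K s t → Close L s t
  Close-mono s t le c i j = Sim-mono le (c i j)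

  Close-≗ : ∀ {K n} {s t : Fin n → ℤ} → (∀ i → s i ≡ t i) → Close K s t
  Close-≗ e i j = same (cong₂ _-_ (e i) (e j))

  argmax : ∀ {n} (f : Fin n → ℤ) {Q : Fin n → Set} → (∀ i → Dec (Q i)) →
           (∀ i → ¬ Q i) ⊎ ∃[ i ] Q i × (∀ j → Q j → f j ≤ f i)
  argmax {zero}  f Q? = inj₁ (λ ())
  argmax {suc n} f Q? with argmax (f ∘ suc) (Q? ∘ suc) | Q? zero
  ... | inj₁ none | no ¬q = inj₁ λ { zero → ¬q ; (suc i) → none i }
  ... | inj₁ none | yes q = inj₂ (zero , q , λ { zero _ → ℤ.≤-refl ; (suc i) p → contradiction p (none i) })
  ... | inj₂ (i , p , m) | no ¬q = inj₂ (suc i , p , λ { zero q → contradiction q ¬q ; (suc j) → m j })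
  ... | inj₂ (i , p , m) | yes q with ℤ.≤-total (f zero) (f (suc i))
  ...   | inj₁ le = inj₂ (suc i , p , λ { zero _ → le ; (suc j) → m j })
  ...   | inj₂ ge = inj₂ (zero , q , λ { zero _ → ℤ.≤-refl ; (suc j) r → ℤ.≤-trans (m j r) ge })

  -- Records where `extend` finds its witness, so that an existential statement can be decided by a
  -- finite search. The value zero serves the case without parameters.
  Near : ℕ → ∀ {n} → (Fin n → ℤ) → ℤ → Set
  Near K {n} t y = y ≡ 0ℤ ⊎ Σ (Fin n × Fin (suc K)) λ (i , m) →
    y ≡ t i ℤ.+ + toℕ m ⊎ y ≡ t i ℤ.+ - + toℕ m

  near : ∀ {K n} (t : Fin n → ℤ) i c → ∣ c ∣ ℕ.≤ K → Near K t (t i ℤ.+ c)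
  near {K} t i c le = inj₂ ((i , fromℕ< (ℕ.s≤s le)) , go c refl)
    where
    m≡ : toℕ (fromℕ< (ℕ.s≤s le)) ≡ ∣ c ∣
    m≡ = toℕ-fromℕ< (ℕ.s≤s le)
    go : ∀ e → e ≡ c → t i ℤ.+ e ≡ t i ℤ.+ + toℕ (fromℕ< (ℕ.s≤s le)) ⊎ t i ℤ.+ e ≡ t i ℤ.+ - + toℕ (fromℕ< (ℕ.s≤s le))
    go (+ n)    refl = inj₁ (cong (λ z → t i ℤ.+ + z) (sym m≡))
    go -[1+ n ] refl = inj₂ (cong (λ z → t i ℤ.+ - + z) (sym m≡))

  -- The forth step of a back-and-forth argument; a quantifier costs half of the resolution.
  extend : ∀ {K n} (s t : Fin n → ℤ) → Close (suc (K ℕ.+ K)) s t → ∀ x →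
           ∃[ y ] Near K t y × (∀ j → Sim K (x - s j) (y - t j))
  extend {K} {n} s t c x with any? (λ i → ∣ x - s i ∣ ℕ.≤? K)
  ... | yes (i , le) = t i ℤ.+ (x - s i) , near t i (x - s i) le , λ j →
    subst₂ (Sim K) (e₁ x (s i) (s j)) (e₂ x (s i) (t i) (t j))
      (Sim-shift (x - s i) le (Sim-mono (ℕ.n≤1+n _) (c i j)))
    where
    e₁ : ∀ x a b → (x - a) ℤ.+ (a - b) ≡ x - b
    e₁ = solve-∀
    e₂ : ∀ x a u v → (x - a) ℤ.+ (u - v) ≡ (u ℤ.+ (x - a)) - v
    e₂ = solve-∀
  ... | no none with argmax s {λ i → + suc K ≤ x - s i} (λ i → _ ℤ.≤? _)
  -- `s i` is the largest entry more than `K` below `x`. Entries above `x` are more than `K` above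
  -- it, hence more than `2K + 1` above `s i`; their images are at least `2K + 1` above `t i`, which
  -- leaves room for a point `K` above `t i`.
  ...   | inj₂ (i , q , m) = t i ℤ.+ + K , near t i (+ K) ℕ.≤-refl , go
    where
    e₁ : ∀ k u v → (u ℤ.+ k) - v - k ≡ 0ℤ - (v - u)
    e₁ = solve-∀
    e₂ : ∀ x k a b → - (1ℤ ℤ.+ (k ℤ.+ k)) - (a - b) ≡ ((x - a) - (1ℤ ℤ.+ k)) ℤ.+ (- (1ℤ ℤ.+ k) - (x - b)) ℤ.+ (1ℤ - 0ℤ)
    e₂ = solve-∀
    e₃ : ∀ k u v → - k - ((u ℤ.+ k) - v) ≡ (- (1ℤ ℤ.+ (k ℤ.+ k)) - (u - v)) ℤ.+ (1ℤ - 0ℤ)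
    e₃ = solve-∀
    0≤1 : 0ℤ ≤ 1ℤ
    0≤1 = +≤+ ℕ.z≤n
    weak : ∀ {z} → + suc K ≤ z → + K ≤ z
    weak = ℤ.≤-trans (+≤+ (ℕ.n≤1+n K))
    weak′ : ∀ {z} → z ≤ - + suc K → z ≤ - + K
    weak′ p = ℤ.≤-trans p (ℤ.neg-mono-≤ (+≤+ (ℕ.n≤1+n K)))
    go : ∀ j → Sim K (x - s j) ((t i ℤ.+ + K) - t j)
    go j with + suc K ℤ.≤? x - s j
    ... | yes q′ = up (weak q′) (lin₁ (Sim-≤0 (c j i) (ℤ.i≤j⇒i-j≤0 (m j q′))) (e₁ (+ K) (t i) (t j)))
    ... | no ¬q′ with far (x - s j) (λ le → none (j , le))
    ...   | inj₁ q′ = contradiction q′ ¬q′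
    ...   | inj₂ q′ = dn (weak′ q′) (lin₂ (Sim-dn (c i j) (lin₃ q q′ 0≤1 (e₂ x (+ K) (s i) (s j)))) 0≤1 (e₃ (+ K) (t i) (t j)))
  ...   | inj₁ above with argmax (-_ ∘ s) {λ _ → ⊤} (λ _ → yes tt)
  ...     | inj₁ empty = 0ℤ , inj₁ refl , λ j → contradiction tt (empty j)
  -- All entries lie far above `x`; `- s` is largest at the least of them, and the image is put `K`
  -- below its counterpart.
  ...     | inj₂ (i , _ , m) = t i ℤ.+ - + K , near t i (- + K) (ℕ.≤-reflexive (ℤ.∣-i∣≡∣i∣ (+ K))) , go
    where
    e₁ : ∀ k u v → - k - ((u ℤ.+ - k) - v) ≡ 0ℤ - (u - v)
    e₁ = solve-∀
    go : ∀ j → Sim K (x - s j) ((t i ℤ.+ - + K) - t j)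
    go j with far (x - s j) (λ le → none (j , le))
    ... | inj₁ q = contradiction q (above j)
    ... | inj₂ q = dn (ℤ.≤-trans q (ℤ.neg-mono-≤ (+≤+ (ℕ.n≤1+n K))))
                      (lin₁ (Sim-≤0 (c i j) (ℤ.i≤j⇒i-j≤0 (ℤ.neg-cancel-≤ (m j tt)))) (e₁ (+ K) (t i) (t j)))

  Close-∷ : ∀ {K n x y} (s t : Vec ℤ n) → Close K (lookup s) (lookup t) →
            (∀ j → Sim K (x - lookup s j) (y - lookup t j)) → Close K (lookup (x ∷ s)) (lookup (y ∷ t))
  Close-∷ {x = x} {y} s t c e zero    zero    = same (trans (ℤ.+-inverseʳ x) (sym (ℤ.+-inverseʳ y)))
  Close-∷ s t c e zero    (suc j) = e j
  Close-∷ {K} {x = x} {y} s t c e (suc i) zero =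
    subst₂ (Sim K) (flip x (lookup s i)) (flip y (lookup t i)) (Sim-neg (e i))
    where
    flip : ∀ a b → - (a - b) ≡ b - a
    flip = solve-∀
  Close-∷ s t c e (suc i) (suc j) = c i j

  -- Invariance under indistinguishability is what first-order definability in (ℤ;<) is used for.
  record Local {n} (P : Pred (Vec ℤ n) 0ℓ) : Set where
    field
      radius : ℕ
      stable   : ∀ s t → Close radius (lookup s) (lookup t) → P s → P t
      dec    : ∀ s → Dec (P s)

  open Local public

  module _ {n} {P : Pred (Vec ℤ n) 0ℓ} where

    Local-¬ : Local P → Local (λ s → ¬ P s)
    Local-¬ p = record
      { radius = radius p
      ; stable   = λ s t c ¬ps pt → ¬ps (stable p t s (Close-sym (lookup s) (lookup t) c) pt)
      ; dec    = λ s → ¬? (dec p s)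
      }

    Local-⇔ : {Q : Pred (Vec ℤ n) 0ℓ} → (∀ s → P s ⇔ Q s) → Local P → Local Q
    Local-⇔ e p = record
      { radius = radius p
      ; stable   = λ s t c → Equivalence.to (e t) ∘ stable p s t c ∘ Equivalence.from (e s)
      ; dec    = λ s → map′ (Equivalence.to (e s)) (Equivalence.from (e s)) (dec p s)
      }

  module _ {n} {P Q : Pred (Vec ℤ n) 0ℓ} (p : Local P) (q : Local Q) where

    private
      K = radius p ℕ.⊔ radius q
      stableˡ : ∀ s t → Close K (lookup s) (lookup t) → P s → P t
      stableˡ s t c = stable p s t (Close-mono (lookup s) (lookup t) (ℕ.m≤m⊔n (radius p) (radius q)) c)
      stableʳ : ∀ s t → Close K (lookup s) (lookup t) → Q s → Q t
      stableʳ s t c = stable q s t (Close-mono (lookup s) (lookup t) (ℕ.m≤n⊔m (radius p) (radius q)) c)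

    Local-× : Local (λ s → P s × Q s)
    Local-× = record
      { radius = K
      ; stable   = λ s t c (ps , qs) → stableˡ s t c ps , stableʳ s t c qs
      ; dec    = λ s → dec p s ×-dec dec q s
      }

    Local-⊎ : Local (λ s → P s ⊎ Q s)
    Local-⊎ = record
      { radius = K
      ; stable   = λ { s t c (inj₁ ps) → inj₁ (stableˡ s t c ps) ; s t c (inj₂ qs) → inj₂ (stableʳ s t c qs) }
      ; dec    = λ s → dec p s ⊎-dec dec q s
      }

  module _ {n} {P : Pred (Vec ℤ (suc n)) 0ℓ} where

    -- For the decision, `extend` is applied to `s` against itself: it moves any witness to one that
    -- is `Near` the entries of `s` without changing the truth of `P`.
    Local-∃ : Local P → Local (λ s → ∃[ x ] P (x ∷ s))
    Local-∃ p = record { radius = suc (K ℕ.+ K) ; stable = stable′ ; dec = dec′ }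
      where
      K = radius p
      weaken : ∀ {s t : Vec ℤ n} → Close (suc (K ℕ.+ K)) (lookup s) (lookup t) → Close K (lookup s) (lookup t)
      weaken {s} {t} = Close-mono (lookup s) (lookup t) (ℕ.m≤n⇒m≤1+n (ℕ.m≤m+n K K))
      stable′ : ∀ s t → Close (suc (K ℕ.+ K)) (lookup s) (lookup t) → ∃[ x ] P (x ∷ s) → ∃[ x ] P (x ∷ t)
      stable′ s t c (x , px) with y , _ , e ← extend (lookup s) (lookup t) c x =
        y , stable p (x ∷ s) (y ∷ t) (Close-∷ s t (weaken {s} {t} c) e) px
      dec′ : ∀ s → Dec (∃[ x ] P (x ∷ s))
      dec′ s = map′ to from (dec p (0ℤ ∷ s) ⊎-dec any? λ i → any? λ m → dec p _ ⊎-dec dec p _)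
        where
        Search : Set
        Search = P (0ℤ ∷ s) ⊎ ∃[ i ] ∃[ m ] (P ((lookup s i ℤ.+ + toℕ {suc K} m) ∷ s) ⊎ P ((lookup s i ℤ.+ - + toℕ {suc K} m) ∷ s))
        to : Search → ∃[ x ] P (x ∷ s)
        to (inj₁ p)                = _ , p
        to (inj₂ (_ , _ , inj₁ p)) = _ , p
        to (inj₂ (_ , _ , inj₂ p)) = _ , p
        from : ∃[ x ] P (x ∷ s) → Search
        from (x , px) with extend (lookup s) (lookup s) (λ i j → same refl) x
        ... | y , nr , e with stable p (x ∷ s) (y ∷ s) (Close-∷ s s (λ i j → same refl) e) px | nr
        ...   | py | inj₁ refl = inj₁ py
        ...   | py | inj₂ ((i , m) , inj₁ refl) = inj₂ (i , m , inj₁ py)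
        ...   | py | inj₂ ((i , m) , inj₂ refl) = inj₂ (i , m , inj₂ py)

  -- The universal quantifier is treated as a negated existential one, which is constructively sound
  -- because `P` is decidable.
  Local-∀ : ∀ {n} {P : Pred (Vec ℤ (suc n)) 0ℓ} → Local P → Local (λ s → ∀ x → P (x ∷ s))
  Local-∀ p = Local-⇔ (λ s → mk⇔ (λ f x → decidable-stable (dec p (x ∷ s)) (λ ¬p → f (x , ¬p)))
                                 (λ f (x , ¬p) → ¬p (f x)))
                      (Local-¬ (Local-∃ (Local-¬ p)))

  Local-< : ∀ {n} (i j : Fin n) → Local (λ s → lookup s i < lookup s j)
  Local-< i j = record { radius = 1 ; stable = λ s t c → go (c i j) ; dec = λ s → _ ℤ.<? _ }
    where
    e₁ : ∀ a b → (b - (1ℤ ℤ.+ a)) ≡ - 1ℤ - (a - b)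
    e₁ = solve-∀
    go : ∀ {a b u v} → Sim 1 (a - b) (u - v) → a < b → u < v
    go {a} {b} {u} {v} s lt = ℤ.suc[i]≤j⇒i<j (lin₁ (Sim-dn s
      (lin₁ (ℤ.i<j⇒suc[i]≤j lt) (sym (e₁ a b)))) (e₁ u v))

  Local-≡ : ∀ {n} (i j : Fin n) → Local (λ s → lookup s i ≡ lookup s j)
  Local-≡ i j = record { radius = 1 ; stable = λ s t c → go (c i j) ; dec = λ s → _ ℤ.≟ _ }
    where
    go : ∀ {a b u v} → Sim 1 (a - b) (u - v) → a ≡ b → u ≡ v
    go {a} (same p) refl = ℤ.i-j≡0⇒i≡j _ _ (trans (sym p) (ℤ.+-inverseʳ a))
    go {a} (up p q) refl = contradiction (subst (1ℤ ≤_) (ℤ.+-inverseʳ a) p) (λ { (+≤+ ()) })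
    go {a} (dn p q) refl = contradiction (subst (_≤ - 1ℤ) (ℤ.+-inverseʳ a) p) (λ ())

  Holds-local : ∀ {n} (φ : Formula orderSig n) → Local (λ s → Holds ℤ-order s φ)
  Holds-local (atom (rel zero (i ∷ j ∷ []))) = Local-< i j
  Holds-local (atom (eq i j)) = Local-≡ i j
  Holds-local (not φ)   = Local-¬ (Holds-local φ)
  Holds-local (and φ ψ) = Local-× (Holds-local φ) (Holds-local ψ)
  Holds-local (or φ ψ)  = Local-⊎ (Holds-local φ) (Holds-local ψ)
  Holds-local (ex φ)    = Local-∃ (Holds-local φ)
  Holds-local (all φ)   = Local-∀ (Holds-local φ)

-- Lowering coordinates in a relation closed under the modular minimum.

module Tameness where

  open import Defs
  open Locality
  open import Data.Fin.Properties using (any?)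
  open import Data.Integer.Base as ℤ using (ℤ; +_; -_; _-_; _≤_; ∣_∣; 0ℤ; 1ℤ; +≤+; _⊓_)
  open import Data.Integer.Divisibility.Signed using (∣m∣n⇒∣m+n; ∣n⇒∣m*n)
  open import Data.Integer.Tactic.RingSolver using (solve-∀)
  open import Data.List.Base using (allFin)
  import Data.Nat.Base as ℕ
  open import Relation.Nullary using (does)

  -- All that later arguments use of a relation: what remains of definability, together with the
  -- polymorphism.
  record Tame (d : ℕ) {k : ℕ} (R : (Fin k → ℤ) → Set) : Set where
    field
      range   : ℕ
      rigid   : ∀ f g → Close range f g → R f → R g
      decide  : ∀ f → Dec (R f)
      closed  : ∀ f g → R f → R g → R (λ i → min[ d ] (f i) (g i))

  open Tame public

  bounded : ∀ {k} (u : Fin k → ℤ) → ∃[ B ] ∀ i → ∣ u i ∣ ℕ.≤ B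
  bounded {zero}  u = 0 , λ ()
  bounded {suc k} u with B , le ← bounded (u ∘ suc) =
    ∣ u zero ∣ ℕ.⊔ B , λ { zero → ℕ.m≤m⊔n _ B ; (suc i) → ℕ.≤-trans (le i) (ℕ.m≤n⊔m ∣ u zero ∣ B) }

  spread : ∀ {k} (u : Fin k → ℤ) → ∃[ B ] ∀ i j → ∣ u i - u j ∣ ℕ.≤ B
  spread u with B , le ← bounded u =
    B ℕ.+ B , λ i j → ℕ.≤-trans (ℤ.∣i-j∣≤∣i∣+∣j∣ (u i) (u j)) (ℕ.+-mono-≤ (le i) (le j))

  d∣dQ : ∀ d Q → + d ∣ + (d ℕ.* Q)
  d∣dQ d Q = divides (+ Q) (trans (cong +_ (ℕ.*-comm d Q)) (ℤ.pos-* Q d))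

  Q≤dQ : ∀ d .{{_ : ℕ.NonZero d}} Q → Q ℕ.≤ d ℕ.* Q
  Q≤dQ d Q = ℕ.m≤n*m Q d

  -- Certificates for the value of `min[ d ] x y`. In the last case the first argument wins whether
  -- or not the two are congruent.
  data Lowest (d : ℕ) (x y h : ℤ) : Set where
    snd : + d ∣ x - y → y ≤ x → h ≡ y → Lowest d x y h
    fst : ¬ (+ d ∣ x - y) → h ≡ x → Lowest d x y h
    fst≤ : x ≤ y → h ≡ x → Lowest d x y h

  lowest : ∀ {d} x y h → Lowest d x y h → min[ d ] x y ≡ h
  lowest {d} x y h l = go (+ d ∣? (x - y)) l
    where
    go : ∀ (p? : Dec (+ d ∣ x - y)) → Lowest d x y h → (if does p? then x ⊓ y else x) ≡ h
    go (yes _) (snd _ le e) = trans (ℤ.i≥j⇒i⊓j≡j le) (sym e)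
    go (yes p) (fst ¬p _)   = contradiction p ¬p
    go (yes _) (fst≤ le e)  = trans (ℤ.i≤j⇒i⊓j≡i le) (sym e)
    go (no ¬p) (snd p _ _)  = contradiction p ¬p
    go (no _)  (fst _ e)    = sym e
    go (no _)  (fst≤ _ e)   = sym e

  -- A copy of _∣?_ whose boolean does not unfold, so that it can be abstracted over.
  _∣ᵇ_ : ∀ d x → Dec (+ d ∣ x)
  d ∣ᵇ x with + d ∣? x
  ... | yes p = yes p
  ... | no ¬p = no ¬p

  -- The sets of coordinates that can be lowered by every sufficiently large amount form a Boolean
  -- algebra, so it suffices to separate the coordinates inside from those outside one by one.
  module Sink {d : ℕ} .{{_ : ℕ.NonZero d}} {k} {R : (Fin k → ℤ) → Set} (T : Tame d R) where

    R-≗ : ∀ {f g} → (∀ i → f i ≡ g i) → R f → R g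
    R-≗ {f} {g} e = rigid T f g (Close-≗ e)

    R-translate : ∀ f c → R f → R (λ i → f i - c)
    R-translate f c = rigid T f _ (λ i j → same (eqn (f i) (f j) c))
      where
      eqn : ∀ x y c → x - y ≡ (x - c) - (y - c)
      eqn = solve-∀

    meet : ∀ {f g} h → R f → R g → (∀ i → Lowest d (f i) (g i) (h i)) → R h
    meet {f} {g} h rf rg l = R-≗ (λ i → lowest (f i) (g i) (h i) (l i)) (closed T f g rf rg)

    module _ (u : Fin k → ℤ) where

      gap : ℕ
      gap = proj₁ (spread u) ℕ.+ range T

      -- Levels at least `gap` apart remain beyond `range T` even after the spread of `u` is taken
      -- off, so `R` sees only their order. The amounts may therefore be replaced, in particular by
      -- ones of another residue modulo `d`.
      relevel : {L : Set} (π : Fin k → L) (v w : L → ℤ) →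
                (∀ p q → Sim gap (v p - v q) (w p - w q)) →
                R (λ i → u i - v (π i)) → R (λ i → u i - w (π i))
      relevel π v w s = rigid T _ _ λ i j →
        subst₂ (Sim (range T)) (eqn (u i) (u j) (v (π i)) (v (π j))) (eqn (u i) (u j) (w (π i)) (w (π j)))
          (Sim-shift (u i - u j) (proj₂ (spread u) i j) (Sim-neg (s (π i) (π j))))
        where
        eqn : ∀ x y a b → (x - y) ℤ.+ - (a - b) ≡ (x - a) - (y - b)
        eqn = solve-∀

      level : ℕ → Bool → ℤ
      level M b = if b then + M else 0ℤ

      Sim-level : ∀ {M N} → gap ℕ.≤ M → gap ℕ.≤ N → ∀ p q →
                  Sim gap (level M p - level M q) (level N p - level N q)
      Sim-level {M} {N} leM leN false false = same refl
      Sim-level {M} {N} leM leN false true  = dn (go leM) (go leN)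
        where
        go : ∀ {M} → gap ℕ.≤ M → 0ℤ - + M ≤ - + gap
        go {M} le = subst (_≤ - + gap) (sym (ℤ.+-identityˡ (- + M))) (ℤ.neg-mono-≤ (+≤+ le))
      Sim-level {M} {N} leM leN true  false = up (go leM) (go leN)
        where
        go : ∀ {M} → gap ℕ.≤ M → + gap ≤ + M - 0ℤ
        go {M} le = subst (+ gap ≤_) (sym (ℤ.+-identityʳ (+ M))) (+≤+ le)
      Sim-level {M} {N} leM leN true  true  = same (trans (ℤ.+-inverseʳ (+ M)) (sym (ℤ.+-inverseʳ (+ N))))

    module _ (a : Fin k → ℤ) (Ra : R a) where

      sink : (Fin k → Bool) → ℕ → Fin k → ℤ
      sink C M i = a i - level a M (C i)

      Sinks : (Fin k → Bool) → Set
      Sinks C = ∀ M → gap a ℕ.≤ M → R (sink C M)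

      -- One large amount is as good as all: the two levels of `C` are at least `gap` apart for
      -- either amount.
      sinks : ∀ C M → gap a ℕ.≤ M → R (sink C M) → Sinks C
      sinks C M le r N le′ = relevel a C (level a M) (level a N) (Sim-level a le le′) r

      Sinks-≗ : ∀ {C D} → (∀ i → C i ≡ D i) → Sinks C → Sinks D
      Sinks-≗ e s M le = R-≗ (λ i → cong (λ b → a i - level a M b) (e i)) (s M le)

      Sinks-none : Sinks (λ _ → false)
      Sinks-none M le = R-translate a 0ℤ Ra

      Sinks-all : Sinks (λ _ → true)
      Sinks-all M le = R-translate a (+ M) Ra

      module _ (d∤1 : ¬ (+ d ∣ 1ℤ)) where

        private
          Δ = gap a

          d∤1+ : ∀ {x y} → + d ∣ x → y ≡ 1ℤ ℤ.+ x → ¬ (+ d ∣ y)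
          d∤1+ {x} {y} p e q = d∤1 (subst (+ d ∣_) (eqn x) (∣m∣n⇒∣m+n (subst (+ d ∣_) e q) (∣m⇒∣-m p)))
            where
            eqn : ∀ x → 1ℤ ℤ.+ x ℤ.+ - x ≡ 1ℤ
            eqn = solve-∀

        -- Take the modular minimum of `x` and `a - N` with `N = 1 + d Q` large. On `C` the two are
        -- congruent and the lower one, `a - N`, wins; off `C` they differ by `N`, which `d` does
        -- not divide, so `x = a` is kept.
        lift : ∀ C x → R x → (∀ i → C i ≡ false → x i ≡ a i) →
               (∀ i → C i ≡ true → + d ∣ x i - (a i - 1ℤ)) → Sinks C
        lift C x Rx off on = sinks C (suc (d ℕ.* Q)) Δ≤
          (meet _ Rx (R-translate a (+ suc (d ℕ.* Q)) Ra) λ i → go i (C i) refl)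
          where
          X = proj₁ (bounded (λ i → a i - x i))
          Q = Δ ℕ.+ X
          Q≤N : Q ℕ.≤ suc (d ℕ.* Q)
          Q≤N = ℕ.m≤n⇒m≤1+n (Q≤dQ d Q)
          Δ≤ : Δ ℕ.≤ suc (d ℕ.* Q)
          Δ≤ = ℕ.≤-trans (ℕ.m≤m+n Δ X) Q≤N
          e₁ : ∀ x a n → x - (a - (1ℤ ℤ.+ n)) ≡ (x - (a - 1ℤ)) ℤ.+ n
          e₁ = solve-∀
          e₂ : ∀ x a n → x - (a - n) ≡ n - (a - x)
          e₂ = solve-∀
          e₃ : ∀ a n → a - (a - n) ≡ n
          e₃ = solve-∀
          go : ∀ i c → C i ≡ c → Lowest d (x i) (a i - + suc (d ℕ.* Q)) (a i - level a (suc (d ℕ.* Q)) c)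
          go i true e = snd
            (subst (+ d ∣_) (sym (e₁ (x i) (a i) _)) (∣m∣n⇒∣m+n (on i e) (d∣dQ d Q)))
            (lin₁ (∣∣≤⇒≤ (a i - x i) (ℕ.≤-trans (proj₂ (bounded (λ i → a i - x i)) i) (ℕ.≤-trans (ℕ.m≤n+m X Δ) Q≤N)))
                  (e₂ (x i) (a i) _))
            refl
          go i false e = fst
            (d∤1+ (d∣dQ d Q) (trans (cong (λ z → z - (a i - + suc (d ℕ.* Q))) (off i e)) (e₃ (a i) _)))
            (trans (ℤ.+-identityʳ (a i)) (sym (off i e)))

        -- Lower `C` by `M`, which is 1 modulo `d`, and combine with `a - c` where `d` divides `c`.
        -- On `C` the two are not congruent and `a - M` stays; elsewhere `a - c` wins. As `c`
        -- exceeds `M` by at least the gap, the levels can be changed to 0 on `C` and `N` outside.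
        Sinks-not : ∀ {C} → Sinks C → Sinks (Bool.not ∘ C)
        Sinks-not {C} s N Δ≤N = R-≗ (λ i → cong (λ z → a i - z) (unfold (C i)))
          (relevel a C v w sim (meet _ (s M Δ≤M) (R-translate a (+ c) Ra) λ i → go i (C i)))
          where
          M = suc (d ℕ.* Δ)
          Δ≤M : Δ ℕ.≤ M
          Δ≤M = ℕ.m≤n⇒m≤1+n (Q≤dQ d Δ)
          c = d ℕ.* (M ℕ.+ Δ)
          v w : Bool → ℤ
          v b = if b then + M else + c
          w b = if b then 0ℤ else + N
          unfold : ∀ b → w b ≡ level a N (Bool.not b)
          unfold true  = refl
          unfold false = refl
          M+Δ≤c : + M ℤ.+ + Δ ≤ + c
          M+Δ≤c = +≤+ (Q≤dQ d (M ℕ.+ Δ))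
          e₁ : ∀ m Δ c → - Δ - (m - c) ≡ c - (m ℤ.+ Δ)
          e₁ = solve-∀
          e₂ : ∀ m Δ c → (c - m) - Δ ≡ c - (m ℤ.+ Δ)
          e₂ = solve-∀
          e₃ : ∀ Δ n → - Δ - (0ℤ - n) ≡ n - Δ
          e₃ = solve-∀
          e₄ : ∀ Δ n → (n - 0ℤ) - Δ ≡ n - Δ
          e₄ = solve-∀
          sim : ∀ p q → Sim Δ (v p - v q) (w p - w q)
          sim true  true  = same (trans (ℤ.+-inverseʳ (+ M)) (sym (ℤ.+-inverseʳ 0ℤ)))
          sim false false = same (trans (ℤ.+-inverseʳ (+ c)) (sym (ℤ.+-inverseʳ (+ N))))
          sim true  false = dn (lin₁ M+Δ≤c (e₁ (+ M) (+ Δ) (+ c))) (lin₁ (+≤+ Δ≤N) (e₃ (+ Δ) (+ N)))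
          sim false true  = up (lin₁ M+Δ≤c (e₂ (+ M) (+ Δ) (+ c))) (lin₁ (+≤+ Δ≤N) (e₄ (+ Δ) (+ N)))
          e₅ : ∀ a m c → (a - m) - (a - c) ≡ c - m
          e₅ = solve-∀
          e₆ : ∀ c n → n ≡ 1ℤ ℤ.+ (c - (c - n) - 1ℤ)
          e₆ = solve-∀
          e₇ : ∀ a c → (a - 0ℤ) - (a - c) ≡ c
          e₇ = solve-∀
          e₈ : ∀ a c → (a - 0ℤ) - (a - c) ≡ c - 0ℤ
          e₈ = solve-∀
          e₉ : ∀ m c → - (c - (1ℤ ℤ.+ m)) ≡ 1ℤ ℤ.+ (m - c)
          e₉ = solve-∀
          go : ∀ i b → Lowest d (a i - level a M b) (a i - + c) (a i - v b)
          go i true  = fst (λ p → d∤1+ (∣m∣n⇒∣m+n (d∣dQ d Δ) (∣m⇒∣-m (d∣dQ d (M ℕ.+ Δ))))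
                                       (trans (cong -_ (e₅ (a i) (+ M) (+ c))) (e₉ (+ (d ℕ.* Δ)) (+ c)))
                                       (∣m⇒∣-m p)) refl
          go i false = snd (subst (+ d ∣_) (sym (e₇ (a i) (+ c))) (d∣dQ d (M ℕ.+ Δ)))
                           (lin₁ (+≤+ {n = c} ℕ.z≤n) (e₈ (a i) (+ c))) refl

        -- With `M` congruent to 1 and `N` to 0 modulo `d`, combining the two lowered tuples gives
        -- `a - M` on `C`, `a - N` on the rest of `D`, and `a` elsewhere. Changing `N` to `N + 1`
        -- makes the tuple congruent to `a - 1` on the whole union, which is what `lift` asks for.
        Sinks-∨ : ∀ {C D} → Sinks C → Sinks D → Sinks (λ i → C i ∨ D i)
        Sinks-∨ {C} {D} s t = lift (λ i → C i ∨ D i) _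
          (relevel a π v w sim (meet _ (s M Δ≤M) (t N Δ≤N) λ i → go i (C i) (D i)))
          (λ i e → off i (C i) (D i) e) (λ i e → on i (C i) (D i) e)
          where
          data L : Set where
            lo mid hi : L
          kind : Bool → Bool → L
          kind true  _     = mid
          kind false true  = lo
          kind false false = hi
          π : Fin k → L
          π i = kind (C i) (D i)
          M = suc (d ℕ.* Δ)
          Δ≤M : Δ ℕ.≤ M
          Δ≤M = ℕ.m≤n⇒m≤1+n (Q≤dQ d Δ)
          N = d ℕ.* (M ℕ.+ Δ)
          M+Δ≤N : M ℕ.+ Δ ℕ.≤ N
          M+Δ≤N = Q≤dQ d (M ℕ.+ Δ)
          Δ≤N : Δ ℕ.≤ N
          Δ≤N = ℕ.≤-trans (ℕ.m≤n+m Δ M) M+Δ≤N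
          height : ℕ → L → ℕ
          height n lo  = n
          height n mid = M
          height n hi  = 0
          v w : L → ℤ
          v l = + height N l
          w l = + height (suc N) l
          e₁ : ∀ x y Δ → (x - y) - Δ ≡ x - (y ℤ.+ Δ)
          e₁ = solve-∀
          e₂ : ∀ x y Δ → - Δ - (x - y) ≡ y - (x ℤ.+ Δ)
          e₂ = solve-∀
          higher : ∀ x y x′ y′ → y ℕ.+ Δ ℕ.≤ x → y′ ℕ.+ Δ ℕ.≤ x′ → Sim Δ (+ x - + y) (+ x′ - + y′)
          higher x y x′ y′ p q = up (lin₁ (+≤+ p) (e₁ (+ x) (+ y) (+ Δ))) (lin₁ (+≤+ q) (e₁ (+ x′) (+ y′) (+ Δ)))
          lower : ∀ x y x′ y′ → x ℕ.+ Δ ℕ.≤ y → x′ ℕ.+ Δ ℕ.≤ y′ → Sim Δ (+ x - + y) (+ x′ - + y′)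
          lower x y x′ y′ p q = dn (lin₁ (+≤+ p) (e₂ (+ x) (+ y) (+ Δ))) (lin₁ (+≤+ q) (e₂ (+ x′) (+ y′) (+ Δ)))
          equal : ∀ x y → Sim Δ (x - x) (y - y)
          equal x y = same (trans (ℤ.+-inverseʳ x) (sym (ℤ.+-inverseʳ y)))
          sim : ∀ p q → Sim Δ (v p - v q) (w p - w q)
          sim lo  lo  = equal (v lo) (w lo)
          sim lo  mid = higher N M (suc N) M M+Δ≤N (ℕ.m≤n⇒m≤1+n M+Δ≤N)
          sim lo  hi  = higher N 0 (suc N) 0 Δ≤N (ℕ.m≤n⇒m≤1+n Δ≤N)
          sim mid lo  = lower M N M (suc N) M+Δ≤N (ℕ.m≤n⇒m≤1+n M+Δ≤N)
          sim mid mid = equal (v mid) (w mid)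
          sim mid hi  = higher M 0 M 0 Δ≤M Δ≤M
          sim hi  lo  = lower 0 N 0 (suc N) Δ≤N (ℕ.m≤n⇒m≤1+n Δ≤N)
          sim hi  mid = lower 0 M 0 M Δ≤M Δ≤M
          sim hi  hi  = equal (v hi) (w hi)
          e₃ : ∀ a m n → - ((a - (1ℤ ℤ.+ m)) - (a - n)) ≡ 1ℤ ℤ.+ (m - n)
          e₃ = solve-∀
          e₄ : ∀ a n → (a - 0ℤ) - (a - n) ≡ n
          e₄ = solve-∀
          e₅ : ∀ a n → (a - 0ℤ) - (a - n) ≡ n - 0ℤ
          e₅ = solve-∀
          d∣level : ∀ y → + d ∣ level a N y
          d∣level true  = d∣dQ d (M ℕ.+ Δ)
          d∣level false = divides 0ℤ refl
          go : ∀ i x y → Lowest d (a i - level a M x) (a i - level a N y) (a i - v (kind x y))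
          go i true  y     = fst (λ p → d∤1+ (∣m∣n⇒∣m+n (d∣dQ d Δ) (∣m⇒∣-m (d∣level y)))
                                             (e₃ (a i) (+ (d ℕ.* Δ)) (level a N y)) (∣m⇒∣-m p)) refl
          go i false true  = snd (subst (+ d ∣_) (sym (e₄ (a i) (+ N))) (d∣dQ d (M ℕ.+ Δ)))
                                 (lin₁ (+≤+ {n = N} ℕ.z≤n) (e₅ (a i) (+ N))) refl
          go i false false = fst≤ ℤ.≤-refl refl
          off : ∀ i x y → x ∨ y ≡ false → a i - w (kind x y) ≡ a i
          off i false false e = ℤ.+-identityʳ (a i)
          e₆ : ∀ a m → (a - (1ℤ ℤ.+ m)) - (a - 1ℤ) ≡ - m
          e₆ = solve-∀
          on : ∀ i x y → x ∨ y ≡ true → + d ∣ (a i - w (kind x y)) - (a i - 1ℤ)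
          on i true  y    e = subst (+ d ∣_) (sym (e₆ (a i) (+ (d ℕ.* Δ)))) (∣m⇒∣-m (d∣dQ d Δ))
          on i false true e = subst (+ d ∣_) (sym (e₆ (a i) (+ N))) (∣m⇒∣-m (d∣dQ d (M ℕ.+ Δ)))

        Sinks-∧ : ∀ {C D} → Sinks C → Sinks D → Sinks (λ i → C i ∧ D i)
        Sinks-∧ {C} {D} s t = Sinks-≗ (λ i → deMorgan (C i) (D i)) (Sinks-not (Sinks-∨ (Sinks-not s) (Sinks-not t)))
          where
          deMorgan : ∀ x y → Bool.not (Bool.not x ∨ Bool.not y) ≡ x ∧ y
          deMorgan false y     = refl
          deMorgan true  false = refl
          deMorgan true  true  = refl

        -- The modular minimum of `a` and `b - c`, with `d` dividing `c`, is `b - c` where `a` and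
        -- `b` agree modulo `d` and `a` elsewhere. Replacing `c` by `c + 1` yields the residue of
        -- `a - 1` on the agreement set, as needed by `lift`.
        separate : ∀ b → R b → Sinks (λ i → does (d ∣ᵇ (a i - b i)))
        separate b Rb = lift C _
          (relevel u C (level u c) (level u (suc c)) (Sim-level u Δ≤c (ℕ.m≤n⇒m≤1+n Δ≤c))
            (meet _ Ra (R-translate b (+ c) Rb) go))
          off on
          where
          C : Fin k → Bool
          C i = does (d ∣ᵇ (a i - b i))
          u : Fin k → ℤ
          u i = if C i then b i else a i
          X = proj₁ (bounded (λ i → b i - a i))
          Q = gap u ℕ.+ X
          c = d ℕ.* Q
          Δ≤c : gap u ℕ.≤ c
          Δ≤c = ℕ.≤-trans (ℕ.m≤m+n (gap u) X) (Q≤dQ d Q)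
          X≤c : X ℕ.≤ c
          X≤c = ℕ.≤-trans (ℕ.m≤n+m X (gap u)) (Q≤dQ d Q)
          e₁ : ∀ a b c → a - (b - c) ≡ (a - b) ℤ.+ c
          e₁ = solve-∀
          e₂ : ∀ a b c → a - (b - c) ≡ c - (b - a)
          e₂ = solve-∀
          e₃ : ∀ a b c → a - b ≡ (a - (b - c)) ℤ.+ - c
          e₃ = solve-∀
          go : ∀ i → Lowest d (a i) (b i - + c) (u i - level u c (C i))
          go i with d ∣ᵇ (a i - b i)
          ... | yes p = snd (subst (+ d ∣_) (sym (e₁ (a i) (b i) (+ c))) (∣m∣n⇒∣m+n p (d∣dQ d Q)))
                            (lin₁ (∣∣≤⇒≤ (b i - a i) (ℕ.≤-trans (proj₂ (bounded (λ i → b i - a i)) i) X≤c)) (e₂ (a i) (b i) (+ c)))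
                            refl
          ... | no ¬p = fst (λ p → ¬p (subst (+ d ∣_) (sym (e₃ (a i) (b i) (+ c))) (∣m∣n⇒∣m+n p (∣m⇒∣-m (d∣dQ d Q)))))
                            (ℤ.+-identityʳ (a i))
          off : ∀ i → C i ≡ false → u i - level u (suc c) (C i) ≡ a i
          off i e with d ∣ᵇ (a i - b i)
          off i () | yes p
          off i e | no ¬p = ℤ.+-identityʳ (a i)
          e₄ : ∀ a b c → (b - (1ℤ ℤ.+ c)) - (a - 1ℤ) ≡ - (a - b) ℤ.+ - c
          e₄ = solve-∀
          on : ∀ i → C i ≡ true → + d ∣ (u i - level u (suc c) (C i)) - (a i - 1ℤ)
          on i e with d ∣ᵇ (a i - b i)
          on i e | yes p = subst (+ d ∣_) (sym (e₄ (a i) (b i) (+ c))) (∣m∣n⇒∣m+n (∣m⇒∣-m p) (∣m⇒∣-m (d∣dQ d Q)))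
          on i () | no ¬p

      module _ (U : Fin k → Bool)
               (sep : ∀ i j → U i ≡ false → U j ≡ true → ∃[ b ] R b × + d ∣ a i - b i × ¬ (+ d ∣ a j - b j)) where

        private
          -- The union, over the members of `U` among `js`, of complements of agreement sets; each
          -- of them contains its `j` and misses `i`.
          cover : ¬ (+ d ∣ 1ℤ) → ∀ i → U i ≡ false → (js : List (Fin k)) →
                  ∃[ C ] Sinks C × C i ≡ false × (∀ j → U j ≡ true → j ∈ js → C j ≡ true)
          cover d∤1 i ei [] = (λ _ → false) , Sinks-none , refl , λ j _ ()
          cover d∤1 i ei (j ∷ js) with C , s , ci , cs ← cover d∤1 i ei js with U j in ej
          ... | false = C , s , ci , λ { j′ e (here refl) → contradiction (trans (sym ej) e) (λ ()) ; j′ e (there m) → cs j′ e m }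
          ... | true with b , Rb , bi , bj ← sep i j ei ej =
            (λ l → C l ∨ Bool.not (does (d ∣ᵇ (a l - b l)))) , Sinks-∨ d∤1 s (Sinks-not d∤1 (separate d∤1 b Rb)) ,
            at-i , λ { j′ e (here refl) → at-j ; j′ e (there m) → cong (_∨ _) (cs j′ e m) }
            where
            at-i : C i ∨ Bool.not (does (d ∣ᵇ (a i - b i))) ≡ false
            at-i rewrite ci with d ∣ᵇ (a i - b i)
            ... | yes _ = refl
            ... | no ¬p = contradiction bi ¬p
            at-j : C j ∨ Bool.not (does (d ∣ᵇ (a j - b j))) ≡ true
            at-j with d ∣ᵇ (a j - b j)
            ... | yes p = contradiction p bj
            ... | no _  = Bool.∨-zeroʳ (C j)

          -- The intersection, over the points outside `U`, of the sets from `cover`: each contains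
          -- `U` and misses one such point.
          carve : ¬ (+ d ∣ 1ℤ) → (is : List (Fin k)) →
                  ∃[ C ] Sinks C × (∀ j → U j ≡ true → C j ≡ true) × (∀ i → U i ≡ false → i ∈ is → C i ≡ false)
          carve d∤1 [] = (λ _ → true) , Sinks-all , (λ _ _ → refl) , λ i _ ()
          carve d∤1 (i ∷ is) with C , s , sup , c ← carve d∤1 is with U i in ei
          ... | true  = C , s , sup , λ { i′ e (here refl) → contradiction (trans (sym e) ei) (λ ()) ; i′ e (there m) → c i′ e m }
          ... | false with D , t , di , dj ← cover d∤1 i ei (allFin k) =
            (λ l → C l ∧ D l) , Sinks-∧ d∤1 s t , (λ j e → cong₂ _∧_ (sup j e) (dj j e (∈-allFin j))) ,
            λ { i′ e (here refl) → trans (cong (C i ∧_) di) (Bool.∧-zeroʳ (C i))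
              ; i′ e (there m)   → cong (_∧ D i′) (c i′ e m) }

          exact : ¬ (+ d ∣ 1ℤ) → Sinks U
          exact d∤1 with C , s , sup , c ← carve d∤1 (allFin k) = Sinks-≗ eqn s
            where
            eqn : ∀ l → C l ≡ U l
            eqn l with U l in el
            ... | true  = sup l el
            ... | false = c l el (∈-allFin l)

        -- If `U` or its complement is empty, a translation suffices. Otherwise a separating tuple
        -- exists, and two of its integers being incongruent shows that `d` does not divide 1; so
        -- `d = 1` needs no argument of its own.
        Sinks-separated : Sinks U
        Sinks-separated with any? (λ i → U i Bool.≟ false) | any? (λ j → U j Bool.≟ true)
        ... | no all∈ | _ = Sinks-≗ (λ i → sym (Bool.¬-not (λ e → all∈ (i , e)))) Sinks-all
        ... | yes _ | no all∉ = Sinks-≗ (λ i → sym (Bool.¬-not (λ e → all∉ (i , e)))) Sinks-none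
        ... | yes (i , ei) | yes (j , ej) with b , _ , _ , bj ← sep i j ei ej =
          exact (λ p → bj (subst (+ d ∣_) (ℤ.*-identityʳ (a j - b j)) (∣n⇒∣m*n (a j - b j) p)))

-- Bounded heights, and the finite rules attached to a single relation.

module LocalRules where

  open Codes
  open Locality
  open Tameness
  open import Data.Fin.Base using (fromℕ<; _↑ˡ_; _↑ʳ_)
  import Data.Fin.Base as Fin
  open import Data.Fin.Properties using (any?; toℕ-fromℕ<; toℕ-injective; toℕ<n)
  open import Data.Integer.Base as ℤ using (ℤ; +_; -[1+_]; -_; _-_; _≤_; ∣_∣; 0ℤ; 1ℤ; +≤+; -≤-; _⊓_)
  open import Data.Integer.Divisibility.Signed using (∣⇒∣ᵤ)
  import Data.Integer.DivMod as ℤ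
  open import Data.Integer.Tactic.RingSolver using (solve-∀)
  open import Data.List.Base using (allFin)
  import Data.Maybe.Properties as Maybe
  open import Data.Nat.Base as ℕ using (_∸_)
  import Data.Nat.Divisibility as ℕ
  open import Data.Vec.Base as Vec using (_++_)
  open import Data.Vec.Properties using (lookup-++ˡ; lookup-++ʳ)
  import Data.Vec.Properties as Vec
  open import Level using (0ℓ)
  open import Relation.Nullary using (map′; _×-dec_; ¬?)
  open import Relation.Nullary.Decidable using (decidable-stable)
  open import Relation.Unary using (Pred)

  ∑ : ∀ {n} → (Fin n → ℕ) → ℕ
  ∑ {zero}  f = 0
  ∑ {suc n} f = f zero ℕ.+ ∑ (f ∘ suc)

  ∑-mono : ∀ {n} {f g : Fin n → ℕ} → (∀ i → f i ℕ.≤ g i) → ∑ f ℕ.≤ ∑ g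
  ∑-mono {zero}  le = ℕ.z≤n
  ∑-mono {suc n} le = ℕ.+-mono-≤ (le zero) (∑-mono (le ∘ suc))

  ∑-strict : ∀ {n} {f g : Fin n → ℕ} → (∀ i → f i ℕ.≤ g i) → ∀ j → f j ℕ.< g j → ∑ f ℕ.< ∑ g
  ∑-strict le zero    lt = ℕ.+-mono-<-≤ lt (∑-mono (le ∘ suc))
  ∑-strict le (suc j) lt = ℕ.+-mono-≤-< (le zero) (∑-strict (le ∘ suc) j lt)

  ∑-≤ : ∀ {n} (f : Fin n → ℕ) {K} → (∀ i → f i ℕ.≤ K) → ∑ f ℕ.≤ n ℕ.* K
  ∑-≤ {zero}  f le = ℕ.z≤n
  ∑-≤ {suc n} f le = ℕ.+-mono-≤ (le zero) (∑-≤ (f ∘ suc) (le ∘ suc))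

  -- Each value is replaced by the number of integers below it that lie less than K above some value.
  module Compress {n} (K : ℕ) (s : Fin n → ℕ) where

    Covers : ℕ → Fin n → Set
    Covers p j = s j ℕ.≤ p × p ℕ.< s j ℕ.+ K

    covered? : ∀ p → Dec (∃ (Covers p))
    covered? p = any? (λ j → s j ℕ.≤? p ×-dec p ℕ.<? s j ℕ.+ K)

    count : ℕ → ℕ
    count zero = 0
    count (suc p) with covered? p
    ... | yes _ = suc (count p)
    ... | no _  = count p

    count-step : ∀ p → count p ℕ.≤ count (suc p)
    count-step p with covered? p
    ... | yes _ = ℕ.n≤1+n _
    ... | no _  = ℕ.≤-refl

    count-+ : ∀ p t → count p ℕ.≤ count (t ℕ.+ p)
    count-+ p zero    = ℕ.≤-refl
    count-+ p (suc t) = ℕ.≤-trans (count-+ p t) (count-step (t ℕ.+ p))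

    -- The `K` integers from `s j` on are all covered, so gaps of at most `K` survive unchanged and
    -- larger gaps keep at least `K`.
    count-covered : ∀ j t → t ℕ.≤ K → count (t ℕ.+ s j) ≡ t ℕ.+ count (s j)
    count-covered j zero    le = refl
    count-covered j (suc t) le with covered? (t ℕ.+ s j)
    ... | yes _ = cong suc (count-covered j t (ℕ.<⇒≤ le))
    ... | no ¬c = contradiction (j , ℕ.m≤n+m (s j) t , subst (ℕ._≤ s j ℕ.+ K) (ℕ.+-comm (s j) (suc t)) (ℕ.+-monoʳ-≤ (s j) le)) ¬c

    share : ℕ → Fin n → ℕ
    share p j = K ℕ.⊓ (p ∸ s j)

    -- Every covered integer is charged to an entry that covers it, and `share p j` is the number of
    -- integers below `p` that `j` covers, at most `K`.
    count-≤-shares : ∀ p → count p ℕ.≤ ∑ (share p)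
    count-≤-shares zero = ℕ.z≤n
    count-≤-shares (suc p) with covered? p
    ... | no _ = ℕ.≤-trans (count-≤-shares p) (∑-mono λ j → ℕ.⊓-monoʳ-≤ K (ℕ.∸-monoˡ-≤ (s j) (ℕ.n≤1+n p)))
    ... | yes (j , sj≤p , p<) = ℕ.≤-trans (ℕ.s≤s (count-≤-shares p))
      (∑-strict (λ j → ℕ.⊓-monoʳ-≤ K (ℕ.∸-monoˡ-≤ (s j) (ℕ.n≤1+n p))) j strict)
      where
      below : suc p ∸ s j ℕ.≤ K
      below = ℕ.m≤n+o⇒m∸n≤o (suc p) (s j) p<
      strict : share p j ℕ.< share (suc p) j
      strict rewrite ℕ.m≥n⇒m⊓n≡n below | ℕ.+-∸-assoc 1 sj≤p = ℕ.s≤s (ℕ.m⊓n≤n K (p ∸ s j))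

    count-≤ : ∀ p → count p ℕ.≤ n ℕ.* K
    count-≤ p = ℕ.≤-trans (count-≤-shares p) (∑-≤ (share p) (λ j → ℕ.m⊓n≤m K (p ∸ s j)))

    private
      diff : ∀ t x → + x - + (t ℕ.+ x) ≡ - + t
      diff t x = eqn (+ t) (+ x)
        where
        eqn : ∀ t x → x - (t ℤ.+ x) ≡ - t
        eqn = solve-∀

      apart : ∀ {x y} t → t ℕ.+ x ℕ.≤ y → + x - + y ≤ - + t
      apart {x} {y} t le = lin₁ (+≤+ le) (eqn (+ x) (+ y) (+ t))
        where
        eqn : ∀ x y t → - t - (x - y) ≡ y - (t ℤ.+ x)
        eqn = solve-∀

      below : ∀ i j t → s j ≡ t ℕ.+ s i → Sim K (+ s i - + s j) (+ count (s i) - + count (s j))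
      below i j t e with ℕ.≤-total t K
      ... | inj₁ le = same (trans (cong (λ z → + s i - + z) e) (trans (diff t (s i))
                        (sym (trans (cong (λ z → + count (s i) - + z) (trans (cong count e) (count-covered i t le)))
                                    (diff t (count (s i)))))))
      ... | inj₂ ge = dn (apart K (ℕ.≤-trans (ℕ.+-monoˡ-≤ (s i) ge) (ℕ.≤-reflexive (sym e)))) (apart K (begin
        K ℕ.+ count (s i)                ≡⟨ sym (count-covered i K ℕ.≤-refl) ⟩
        count (K ℕ.+ s i)                ≤⟨ count-+ (K ℕ.+ s i) (t ∸ K) ⟩
        count (t ∸ K ℕ.+ (K ℕ.+ s i))    ≡⟨ cong count (trans (sym (ℕ.+-assoc (t ∸ K) K (s i)))
                                              (trans (cong (ℕ._+ s i) (ℕ.m∸n+n≡m ge)) (sym e))) ⟩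
        count (s j)                      ∎))
        where open ℕ.≤-Reasoning

    count-close : Close K (+_ ∘ s) (+_ ∘ count ∘ s)
    count-close i j with ℕ.≤-total (s i) (s j)
    ... | inj₁ le = below i j (s j ∸ s i) (sym (ℕ.m∸n+n≡m le))
    ... | inj₂ ge = subst₂ (Sim K) (flip (+ s j) (+ s i)) (flip (+ count (s j)) (+ count (s i))) (Sim-neg (below j i (s i ∸ s j) (sym (ℕ.m∸n+n≡m ge))))
      where
      flip : ∀ x y → - (x - y) ≡ y - x
      flip = solve-∀

  Sim-trans-same : ∀ {K a b c} → a ≡ b → Sim K b c → Sim K a c
  Sim-trans-same refl s = s

  abstract
    compress : ∀ {n} K (y : Fin n → ℤ) → ∃[ h ] (∀ i → h i ℕ.≤ n ℕ.* K) × Close K y (+_ ∘ h)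
    compress {n} K y = count ∘ s , (λ i → count-≤ (s i)) , λ i j → Sim-trans-same (eqn i j) (count-close i j)
      where
      B : ℕ
      B = proj₁ (bounded y)
      s : Fin n → ℕ
      s i = ∣ y i ℤ.+ + B ∣
      open Compress K s
      0≤ : ∀ i → 0ℤ ≤ y i ℤ.+ + B
      0≤ i = lin₁ (∣∣≤⇒≥ (y i) (proj₂ (bounded y) i)) (e₁ (y i) (+ B))
        where
        e₁ : ∀ y b → (y ℤ.+ b) - 0ℤ ≡ y - - b
        e₁ = solve-∀
      eqn : ∀ i j → y i - y j ≡ + s i - + s j
      eqn i j = trans (e₁ (y i) (y j) (+ B)) (sym (cong₂ _-_ (ℤ.0≤i⇒+∣i∣≡i (0≤ i)) (ℤ.0≤i⇒+∣i∣≡i (0≤ j))))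
        where
        e₁ : ∀ x y b → x - y ≡ (x ℤ.+ b) - (y ℤ.+ b)
        e₁ = solve-∀

  pos : ℤ → ℕ
  pos (+ n)    = n
  pos -[1+ n ] = 0

  pos-∸ : ∀ a b → pos (+ a - + b) ≡ a ∸ b
  pos-∸ a b rewrite ℤ.m-n≡m⊖n a b with ℕ.≤-total b a
  ... | inj₁ le rewrite ℤ.⊖-≥ le = refl
  ... | inj₂ ge rewrite ℤ.⊖-≤ ge | ℕ.m≤n⇒m∸n≡0 ge = neg (b ∸ a)
    where
    neg : ∀ n → pos (- + n) ≡ 0
    neg zero    = refl
    neg (suc n) = refl

  clamp : ∀ K → ℕ → Fin (suc K)
  clamp K n = fromℕ< (ℕ.s≤s (ℕ.m⊓n≤n n K))

  toℕ-clamp : ∀ K n → toℕ (clamp K n) ≡ n ℕ.⊓ K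
  toℕ-clamp K n = toℕ-fromℕ< (ℕ.s≤s (ℕ.m⊓n≤n n K))

  bump : ∀ {K} → Fin (suc K) → Fin (suc K)
  bump {K} x = clamp K (suc (toℕ x))

  bump-clamp : ∀ K n → bump (clamp K n) ≡ clamp K (suc n)
  bump-clamp K n = toℕ-injective (trans (toℕ-clamp K (suc (toℕ (clamp K n))))
    (trans (cong (λ z → suc z ℕ.⊓ K) (toℕ-clamp K n)) (trans (go n K) (sym (toℕ-clamp K (suc n))))))
    where
    go : ∀ n K → suc (n ℕ.⊓ K) ℕ.⊓ K ≡ suc n ℕ.⊓ K
    go n       zero    = refl
    go zero    (suc K) = refl
    go (suc n) (suc K) = cong suc (go n K)

  Matrix : ℕ → ℕ → Set
  Matrix K k = Vec (Vec (Fin (suc K)) k) k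

  -- The subtraction is truncated, so the sign of a difference shows only from the entries (i, j)
  -- and (j, i) together. At resolution 0 it would not show at all, hence the successors in the
  -- lemmas below.
  matrix : ∀ K {k} → (Fin k → ℕ) → Matrix K k
  matrix K y = tabulate λ i → tabulate λ j → clamp K (y i ∸ y j)

  entry : ∀ {A : Set} {k} → Vec (Vec A k) k → Fin k → Fin k → A
  entry m i j = lookup (lookup m i) j

  entry-tabulate : ∀ {A : Set} {k} (f : Fin k → Fin k → A) i j → entry (tabulate λ i → tabulate (f i)) i j ≡ f i j
  entry-tabulate f i j = trans (cong (λ r → lookup r j) (lookup∘tabulate (λ i → tabulate (f i)) i)) (lookup∘tabulate (f i) j)

  private
    ⊓≡⇒ : ∀ K {m n} → m ℕ.⊓ K ≡ n ℕ.⊓ K → m ≡ n ⊎ (K ℕ.≤ m × K ℕ.≤ n)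
    ⊓≡⇒ zero    e = inj₂ (ℕ.z≤n , ℕ.z≤n)
    ⊓≡⇒ (suc K) {zero}  {zero}  e = inj₁ refl
    ⊓≡⇒ (suc K) {suc m} {suc n} e with ⊓≡⇒ K (ℕ.suc-injective e)
    ... | inj₁ p       = inj₁ (cong suc p)
    ... | inj₂ (p , q) = inj₂ (ℕ.s≤s p , ℕ.s≤s q)

    clamp-≡ : ∀ K {m n} → clamp K m ≡ clamp K n → m ℕ.⊓ K ≡ n ℕ.⊓ K
    clamp-≡ K {m} {n} e = trans (sym (toℕ-clamp K m)) (trans (cong toℕ e) (toℕ-clamp K n))

  matrix-close : ∀ K {k} (y h : Fin k → ℕ) → matrix (suc K) y ≡ matrix (suc K) h → Close (suc K) (+_ ∘ y) (+_ ∘ h)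
  matrix-close K y h e i j = go (+ y i - + y j) (+ h i - + h j) (at i j)
    (subst₂ (λ a b → pos a ℕ.⊓ suc K ≡ pos b ℕ.⊓ suc K) (flip (+ y i) (+ y j)) (flip (+ h i) (+ h j)) (at j i))
    where
    flip : ∀ x y → y - x ≡ - (x - y)
    flip = solve-∀
    at : ∀ i j → pos (+ y i - + y j) ℕ.⊓ suc K ≡ pos (+ h i - + h j) ℕ.⊓ suc K
    at i j rewrite pos-∸ (y i) (y j) | pos-∸ (h i) (h j) =
      clamp-≡ (suc K) (trans (sym (entry-tabulate _ i j)) (trans (cong (λ m → entry m i j) e) (entry-tabulate _ i j)))
    go : ∀ a b → pos a ℕ.⊓ suc K ≡ pos b ℕ.⊓ suc K → pos (- a) ℕ.⊓ suc K ≡ pos (- b) ℕ.⊓ suc K → Sim (suc K) a b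
    go (+ m) (+ n) p q with ⊓≡⇒ (suc K) {m} {n} p
    ... | inj₁ e       = same (cong +_ e)
    ... | inj₂ (u , v) = up (+≤+ u) (+≤+ v)
    go -[1+ m ] -[1+ n ] p q with ⊓≡⇒ (suc K) {suc m} {suc n} q
    ... | inj₁ e       = same (cong (λ z → - + z) e)
    ... | inj₂ (u , v) = dn (ℤ.neg-mono-≤ (+≤+ u)) (ℤ.neg-mono-≤ (+≤+ v))
    go (+ zero)  -[1+ n ] p ()
    go (+ suc m) -[1+ n ] () q
    go -[1+ m ] (+ zero)  p ()
    go -[1+ m ] (+ suc n) () q

  close-matrix : ∀ K {k} (y h : Fin k → ℕ) → Close (suc K) (+_ ∘ y) (+_ ∘ h) → matrix (suc K) y ≡ matrix (suc K) h
  close-matrix K y h c = tabulate-cong λ i → tabulate-cong λ j → toℕ-injective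
    (trans (toℕ-clamp (suc K) _) (trans (at i j) (sym (toℕ-clamp (suc K) _))))
    where
    go : ∀ {a b} → Sim (suc K) a b → pos a ℕ.⊓ suc K ≡ pos b ℕ.⊓ suc K
    go (same refl) = refl
    go (up (+≤+ p) (+≤+ q)) = trans (ℕ.m≥n⇒m⊓n≡n p) (sym (ℕ.m≥n⇒m⊓n≡n q))
    go (dn (-≤- p) (-≤- q)) = refl
    at : ∀ i j → (y i ∸ y j) ℕ.⊓ suc K ≡ (h i ∸ h j) ℕ.⊓ suc K
    at i j rewrite sym (pos-∸ (y i) (y j)) | sym (pos-∸ (h i) (h j)) = go (c i j)

  Local-∃* : ∀ k {m} {P : Pred (Vec ℤ (k ℕ.+ m)) 0ℓ} → Local P → Local (λ s → Σ (Vec ℤ k) λ t → P (t ++ s))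
  Local-∃* zero    p = Local-⇔ (λ s → mk⇔ ([] ,_) (λ { ([] , q) → q })) p
  Local-∃* (suc k) p = Local-⇔ (λ s → mk⇔ (λ (t , x , q) → x ∷ t , q) (λ { (x ∷ t , q) → t , x , q })) (Local-∃* k (Local-∃ p))

  maxOver : {A : Set} → Enc A → (f : A → ℕ) → ∃[ B ] ∀ a → f a ℕ.≤ B
  maxOver e f with B , le ← bounded (λ i → + f (from e i)) = B , λ a → subst (λ a → f a ℕ.≤ B) (inv e a) (le (to e a))

  module _ {d : ℕ} .{{_ : ℕ.NonZero d}} where

    abstract
      residue : ℤ → Fin d
      residue x = fromℕ< (ℤ.n%ℕd<d x d)

      quot : ℤ → ℤ
      quot x = x ℤ./ℕ d

      residue-≡ : ∀ x → x ≡ + toℕ (residue x) ℤ.+ + d ℤ.* quot x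
      residue-≡ x = trans (ℤ.a≡a%ℕn+[a/ℕn]*n x d) (cong₂ (λ a b → + a ℤ.+ b)
        (sym (toℕ-fromℕ< (ℤ.n%ℕd<d x d))) (ℤ.*-comm (x ℤ./ℕ d) (+ d)))

    Fin-≡-mod : ∀ (r r′ : Fin d) → + d ∣ + toℕ r - + toℕ r′ → r ≡ r′
    Fin-≡-mod r r′ p = toℕ-injective (ℤ.+-injective (ℤ.i-j≡0⇒i≡j (+ toℕ r) (+ toℕ r′)
      (ℤ.∣i∣≡0⇒i≡0 (small (∣⇒∣ᵤ p) (ℕ.<-≤-trans (below (toℕ r) (toℕ r′) (toℕ<n r) (toℕ<n r′)) ℕ.≤-refl)))))
      where
      small : ∀ {m} → d ℕ.∣ m → m ℕ.< d → m ≡ 0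
      small {zero}  _ _ = refl
      small {suc m} p lt = contradiction p (ℕ.>⇒∤ lt)
      below : ∀ a b → a ℕ.< d → b ℕ.< d → ∣ + a - + b ∣ ℕ.< d
      below a b a< b< rewrite ℤ.m-n≡m⊖n a b = ℕ.≤-<-trans (ℤ.∣m⊝n∣≤m⊔n a b) (ℕ.⊔-lub a< b<)

    residue-unique : ∀ x (r : Fin d) q → x ≡ + toℕ r ℤ.+ + d ℤ.* q → residue x ≡ r
    residue-unique x r q e = Fin-≡-mod (residue x) r (divides (q - quot x)
      (eqn (+ toℕ (residue x)) (+ toℕ r) (+ d) q (quot x) (trans (sym (residue-≡ x)) e)))
      where
      eqn : ∀ a b d q p → a ℤ.+ d ℤ.* p ≡ b ℤ.+ d ℤ.* q → a - b ≡ (q - p) ℤ.* d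
      eqn a b d q p h = trans (e₁ a b d p) (trans (cong (λ z → z - b - d ℤ.* p) h) (e₂ b d q p))
        where
        e₁ : ∀ a b d p → a - b ≡ (a ℤ.+ d ℤ.* p) - b - d ℤ.* p
        e₁ = solve-∀
        e₂ : ∀ b d q p → (b ℤ.+ d ℤ.* q) - b - d ℤ.* p ≡ (q - p) ℤ.* d
        e₂ = solve-∀

    residue-cong : ∀ x y → + d ∣ x - y → residue x ≡ residue y
    residue-cong x y (divides q e) = residue-unique x (residue y) (q ℤ.+ quot y)
      (trans (e₁ x y) (trans (cong₂ ℤ._+_ e (residue-≡ y)) (e₂ q (+ d) (+ toℕ (residue y)) (quot y))))
      where
      e₁ : ∀ x y → x ≡ (x - y) ℤ.+ y
      e₁ = solve-∀
      e₂ : ∀ q d r p → q ℤ.* d ℤ.+ (r ℤ.+ d ℤ.* p) ≡ r ℤ.+ d ℤ.* (q ℤ.+ p)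
      e₂ = solve-∀

    residue-∣ : ∀ x y → residue x ≡ residue y → + d ∣ x - y
    residue-∣ x y e = divides (quot x - quot y)
      (trans (cong₂ _-_ (residue-≡ x) (trans (residue-≡ y) (cong (λ r → + toℕ r ℤ.+ + d ℤ.* (quot y)) (sym e))))
             (e₁ (+ toℕ (residue x)) (+ d) (quot x) (quot y)))
      where
      e₁ : ∀ r d p q → (r ℤ.+ d ℤ.* p) - (r ℤ.+ d ℤ.* q) ≡ (p - q) ℤ.* d
      e₁ = solve-∀

    scaled : ∀ {k} → (Fin k → Fin d) → (Fin k → ℤ) → Fin k → ℤ
    scaled ρ y i = + toℕ (ρ i) ℤ.+ + d ℤ.* y i

    scaled-≡ : ∀ {k} (ρ : Fin k → Fin d) i {x y : ℤ} → x ≡ y → + toℕ (ρ i) ℤ.+ + d ℤ.* x ≡ + toℕ (ρ i) ℤ.+ + d ℤ.* y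
    scaled-≡ ρ i = cong (λ x → + toℕ (ρ i) ℤ.+ + d ℤ.* x)

    -- Two residues differ by less than `d`, which is less than one unit of height; so one unit of
    -- resolution is lost.
    Close-scaled : ∀ {k K} (ρ : Fin k → Fin d) y z → Close (suc K) y z → Close K (scaled ρ y) (scaled ρ z)
    Close-scaled {K = K} ρ y z c i j = subst₂ (Sim K)
      (regroup (+ toℕ (ρ i)) (+ toℕ (ρ j)) (+ d) (y i) (y j)) (regroup (+ toℕ (ρ i)) (+ toℕ (ρ j)) (+ d) (z i) (z j)) (go (c i j))
      where
      regroup : ∀ a b d x y → (a - b) ℤ.+ d ℤ.* (x - y) ≡ (a ℤ.+ d ℤ.* x) - (b ℤ.+ d ℤ.* y)
      regroup = solve-∀
      a = + toℕ (ρ i)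
      b = + toℕ (ρ j)
      small : ∀ (r r′ : Fin d) → + toℕ r ≤ + d ℤ.+ + toℕ r′
      small r r′ = +≤+ (ℕ.≤-trans (ℕ.<⇒≤ (toℕ<n r)) (ℕ.m≤m+n d (toℕ r′)))
      K≤dK : + K ≤ + d ℤ.* + K
      K≤dK = subst (+ K ≤_) (ℤ.pos-* d K) (+≤+ (ℕ.m≤n*m K d))
      scale : ∀ {x y} → x ≤ y → + d ℤ.* x ≤ + d ℤ.* y
      scale = ℤ.*-monoˡ-≤-nonNeg (+ d)
      e₁ : ∀ k d a b x → ((a - b) ℤ.+ d ℤ.* x) - k ≡ (d ℤ.* x - d ℤ.* (1ℤ ℤ.+ k)) ℤ.+ ((d ℤ.+ a) - b) ℤ.+ (d ℤ.* k - k)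
      e₁ = solve-∀
      e₂ : ∀ k d a b x → - k - ((a - b) ℤ.+ d ℤ.* x) ≡ (d ℤ.* - (1ℤ ℤ.+ k) - d ℤ.* x) ℤ.+ ((d ℤ.+ b) - a) ℤ.+ (d ℤ.* k - k)
      e₂ = solve-∀
      go : ∀ {u v} → Sim (suc K) u v → Sim K ((a - b) ℤ.+ + d ℤ.* u) ((a - b) ℤ.+ + d ℤ.* v)
      go (same e) = same (cong (λ w → (a - b) ℤ.+ + d ℤ.* w) e)
      go {u} {v} (up p q) = up (lin₃ (scale p) (small (ρ j) (ρ i)) K≤dK (e₁ (+ K) (+ d) a b u))
                               (lin₃ (scale q) (small (ρ j) (ρ i)) K≤dK (e₁ (+ K) (+ d) a b v))
      go {u} {v} (dn p q) = dn (lin₃ (scale p) (small (ρ i) (ρ j)) K≤dK (e₂ (+ K) (+ d) a b u))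
                               (lin₃ (scale q) (small (ρ i) (ρ j)) K≤dK (e₂ (+ K) (+ d) a b v))

  map-just-injective : ∀ {A : Set} {n} (xs ys : Vec A n) → Vec.map just xs ≡ Vec.map just ys → xs ≡ ys
  map-just-injective []       []       e    = refl
  map-just-injective (x ∷ xs) (y ∷ ys) e = cong₂ _∷_ (Maybe.just-injective (Vec.∷-injectiveˡ e)) (map-just-injective xs ys (Vec.∷-injectiveʳ e))

  -- The value nothing stands for giving up, (j , just r) for giving the j-th variable the residue r, and
  -- (j , nothing) for raising its height.
  Action : ℕ → ℕ → Set
  Action d k = Maybe (Fin k × Maybe (Fin d))

  module Rules {d : ℕ} .{{_ : ℕ.NonZero d}} {k} {R : (Fin k → ℤ) → Set} (T : Tame d R) where

    open Sink T

    Marks : Set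
    Marks = Vec (Maybe (Fin d)) k

    R[_] : Vec (Fin d) k → (Fin k → ℤ) → Set
    R[ ρ ] y = R (scaled (lookup ρ) y)

    R[]-close : ∀ ρ y z → Close (suc (range T)) y z → R[ ρ ] y → R[ ρ ] z
    R[]-close ρ y z c = rigid T _ _ (Close-scaled (lookup ρ) y z c)

    -- With the residues fixed, the two values at a coordinate are congruent, and the modular
    -- minimum is the ordinary one.
    R[]-min : ∀ ρ y z → R[ ρ ] y → R[ ρ ] z → R[ ρ ] (λ i → y i ⊓ z i)
    R[]-min ρ y z ry rz = meet _ ry rz go
      where
      e₁ : ∀ r d x y → (r ℤ.+ d ℤ.* x) - (r ℤ.+ d ℤ.* y) ≡ (x - y) ℤ.* d
      e₁ = solve-∀
      mono : ∀ i {x y} → x ≤ y → + toℕ (lookup ρ i) ℤ.+ + d ℤ.* x ≤ + toℕ (lookup ρ i) ℤ.+ + d ℤ.* y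
      mono i le = ℤ.+-monoʳ-≤ (+ toℕ (lookup ρ i)) (ℤ.*-monoˡ-≤-nonNeg (+ d) le)
      go : ∀ i → Lowest d (scaled (lookup ρ) y i) (scaled (lookup ρ) z i) (scaled (lookup ρ) (λ i → y i ⊓ z i) i)
      go i with ℤ.≤-total (y i) (z i)
      ... | inj₁ le = fst≤ (mono i le) (scaled-≡ (lookup ρ) i (ℤ.i≤j⇒i⊓j≡i le))
      ... | inj₂ ge = snd (divides (y i - z i) (e₁ (+ toℕ (lookup ρ i)) (+ d) (y i) (z i))) (mono i ge)
                          (scaled-≡ (lookup ρ) i (ℤ.i≥j⇒i⊓j≡j ge))

    Local-R[] : ∀ ρ {n} (π : Fin k → Fin n) → Local (λ (v : Vec ℤ n) → R[ ρ ] (lookup v ∘ π))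
    Local-R[] ρ π = record
      { radius = suc (range T)
      ; stable = λ s t c → R[]-close ρ _ _ (λ i j → c (π i) (π j))
      ; dec    = λ s → decide T _
      }

    Local-≤ : ∀ {n} (π σ : Fin k → Fin n) → Local (λ (v : Vec ℤ n) → ∀ i → lookup v (π i) ≤ lookup v (σ i))
    Local-≤ π σ = record
      { radius = 1
      ; stable = λ s t c le i → ℤ.≮⇒≥ (stable (Local-¬ (Local-< (σ i) (π i))) s t c (ℤ.≤⇒≯ (le i)))
      ; dec    = λ s → Fin.all? (λ i → _ ℤ.≤? _)
      }

    Possible : Vec (Fin d) k → Set
    Possible ρ = Σ (Vec ℤ k) λ t → R[ ρ ] (lookup t)

    abstract
      -- Existence of a tuple with residues `ρ` is a local property of the empty tuple, and local
      -- properties are decidable.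
      possible? : ∀ ρ → Dec (Possible ρ)
      possible? ρ = map′ (λ (t , r) → t , R-≗ (λ i → scaled-≡ (lookup ρ) i (lookup-++ˡ t [] i)) r)
                         (λ (t , r) → t , R-≗ (λ i → scaled-≡ (lookup ρ) i (sym (lookup-++ˡ t [] i))) r)
                         (dec (Local-∃* k (Local-R[] ρ (_↑ˡ 0))) [])

    -- Its failure says that every solution above `y` exceeds `y` at `i`, which is the licence to
    -- raise `i`.
    Tight : Vec (Fin d) k → Fin k → Vec ℤ k → Set
    Tight ρ i y = Σ (Vec ℤ k) λ t → R[ ρ ] (lookup t) × (∀ j → lookup y j ≤ lookup t j) × lookup y i ≡ lookup t i

    abstract
      Local-Tight : ∀ ρ i → Local (Tight ρ i)
      Local-Tight ρ i = Local-⇔ (λ y → mk⇔ (join y) (split y))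
        (Local-∃* k (Local-× (Local-R[] ρ (_↑ˡ k)) (Local-× (Local-≤ (k ↑ʳ_) (_↑ˡ k)) (Local-≡ (k ↑ʳ i) (i ↑ˡ k)))))
        where
        Tight′ : Vec ℤ k → Set
        Tight′ y = Σ (Vec ℤ k) λ t → R[ ρ ] (λ j → lookup (t ++ y) (j ↑ˡ k)) ×
          (∀ j → lookup (t ++ y) (k ↑ʳ j) ≤ lookup (t ++ y) (j ↑ˡ k)) × lookup (t ++ y) (k ↑ʳ i) ≡ lookup (t ++ y) (i ↑ˡ k)
        join : ∀ y → Tight′ y → Tight ρ i y
        join y (t , r , le , e) =
          t , R-≗ (λ j → scaled-≡ (lookup ρ) j (lookup-++ˡ t y j)) r ,
          (λ j → subst₂ _≤_ (lookup-++ʳ t y j) (lookup-++ˡ t y j) (le j)) ,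
          trans (sym (lookup-++ʳ t y i)) (trans e (lookup-++ˡ t y i))
        split : ∀ y → Tight ρ i y → Tight′ y
        split y (t , r , le , e) =
          t , R-≗ (λ j → scaled-≡ (lookup ρ) j (sym (lookup-++ˡ t y j))) r ,
          (λ j → subst₂ _≤_ (sym (lookup-++ʳ t y j)) (sym (lookup-++ˡ t y j)) (le j)) ,
          trans (lookup-++ʳ t y i) (trans e (sym (lookup-++ˡ t y i)))

    private
      -- A minimum with the witness for `i` brings coordinate `i` down to `y`; coordinates already
      -- there stay, since the witness lies above `y`.
      tighten : ∀ ρ y s → R[ ρ ] s → (∀ j → lookup y j ≤ s j) → (∀ i → Tight ρ i y) → (is : List (Fin k)) →
                ∃[ t ] R[ ρ ] t × (∀ j → lookup y j ≤ t j) × (∀ i → i ∈ is → t i ≡ lookup y i)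
      tighten ρ y s rs y≤s tight [] = s , rs , y≤s , λ i ()
      tighten ρ y s rs y≤s tight (i ∷ is)
        with t , rt , y≤t , e ← tighten ρ y s rs y≤s tight is
        with u , ru , y≤u , e′ ← tight i =
        (λ j → t j ⊓ lookup u j) , R[]-min ρ t (lookup u) rt ru , (λ j → ℤ.⊓-glb (y≤t j) (y≤u j)) ,
        λ { j (here refl) → trans (cong (t j ⊓_) (sym e′)) (ℤ.i≥j⇒i⊓j≡j (y≤t j))
          ; j (there m)   → trans (cong (_⊓ lookup u j) (e j m)) (ℤ.i≤j⇒i⊓j≡i (y≤u j)) }

    -- By closure under minima, a violated tuple that lies below a solution has a coordinate in which
    -- all solutions above it are strictly larger.
    all-tight : ∀ ρ y s → R[ ρ ] s → (∀ j → lookup y j ≤ s j) → (∀ i → Tight ρ i y) → R[ ρ ] (lookup y)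
    all-tight ρ y s rs y≤s tight with t , rt , _ , e ← tighten ρ y s rs y≤s tight (allFin k) =
      R-≗ (λ i → scaled-≡ (lookup ρ) i (e i (∈-allFin i))) rt

    Escape : Fin k → Fin d → Fin k → Fin d → Set
    Escape i r j e = Σ (Vec (Fin d) k) λ ρ → Possible ρ × lookup ρ i ≡ r × ¬ lookup ρ j ≡ e

    abstract
      escape? : ∀ i r j e → Dec (Escape i r j e)
      escape? i r j e = Enc-any? (Enc-Vec Enc-Fin k) λ ρ → possible? ρ ×-dec (lookup ρ i Fin.≟ r ×-dec ¬? (lookup ρ j Fin.≟ e))

    -- An implication from a single marked coordinate to a single unmarked one. The absence of such
    -- implications supplies exactly the pairwise separation required by `Sinks-separated`.
    Forces : Marks → (Fin k × Fin d) × (Fin k × Fin d) → Set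
    Forces ms ((i , r) , (j , e)) = lookup ms i ≡ just r × lookup ms j ≡ nothing × ¬ Escape i r j e

    abstract
      forces? : ∀ ms → Dec (∃ (Forces ms))
      forces? ms = Enc-any? (Enc-× (Enc-× Enc-Fin Enc-Fin) (Enc-× Enc-Fin Enc-Fin)) λ ((i , r) , (j , e)) →
        Maybe.≡-dec Fin._≟_ _ _ ×-dec (Maybe.≡-dec Fin._≟_ _ _ ×-dec ¬? (escape? i r j e))

    unmarked? : (ms : Marks) → Dec (∃[ j ] lookup ms j ≡ nothing)
    unmarked? ms = any? λ j → Maybe.≡-dec Fin._≟_ (lookup ms j) nothing

    ruleForce : Marks → Maybe (Action d k)
    ruleForce ms with forces? ms
    ... | yes ((_ , (j , e)) , _) = just (just (j , just e))
    ... | no _ = nothing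

    ruleGuess : Marks → Maybe (Action d k)
    ruleGuess ms with unmarked? ms
    -- Any residue would do: the unmarked variables can be lowered by every large amount, so by one
    -- of each residue.
    ... | yes (j , _) = just (just (j , just (residue 0ℤ)))
    ... | no _ = nothing

    Fits : Marks → (Fin k → ℤ) → Set
    Fits ms s = ∀ i r → lookup ms i ≡ just r → residue (s i) ≡ r

    residues : (Fin k → ℤ) → Vec (Fin d) k
    residues s = tabulate (residue ∘ s)

    possible-residues : ∀ s → R s → Possible (residues s)
    possible-residues s rs = tabulate (λ i → quot (s i)) , R-≗ (λ i → trans (residue-≡ (s i))
      (cong₂ (λ r q → + toℕ r ℤ.+ + d ℤ.* q) (sym (lookup∘tabulate (residue ∘ s) i)) (sym (lookup∘tabulate (λ i → quot (s i)) i)))) rs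

    forced : ∀ ms s i r j e → Forces ms ((i , r) , (j , e)) → R s → Fits ms s → residue (s j) ≡ e
    forced ms s i r j e (ei , ej , ¬esc) rs fits = decidable-stable (_ Fin.≟ _) λ ≢e →
      ¬esc (residues s , possible-residues s rs , trans (lookup∘tabulate (residue ∘ s) i) (fits i r ei) ,
            λ p → ≢e (trans (sym (lookup∘tabulate (residue ∘ s) j)) p))

    free : Marks → Fin k → Bool
    free ms i = is-nothing (lookup ms i)

    -- If `residue (s j)` could not be escaped from a marked `i`, then `i` would force `j`. So some
    -- tuple of `R` agrees with `s` modulo `d` at `i` and differs at `j`.
    lowerable : ∀ ms s → ¬ ∃ (Forces ms) → (rs : R s) → Fits ms s → Sinks s rs (free ms)
    lowerable ms s ¬f rs fits = Sinks-separated s rs (free ms) sep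
      where
      sep : ∀ i j → free ms i ≡ false → free ms j ≡ true → ∃[ b ] R b × + d ∣ s i - b i × ¬ (+ d ∣ s j - b j)
      sep i j fi fj with lookup ms i in ei | lookup ms j in ej
      sep i j fi fj | just r | nothing
        with decidable-stable (escape? i r j (residue (s j))) (λ ¬esc → ¬f (_ , ei , ej , ¬esc))
      ... | ρ , (t , rt) , ρi , ρj = scaled (lookup ρ) (lookup t) , rt ,
        residue-∣ (s i) (scaled (lookup ρ) (lookup t) i) (trans (fits i r ei) (trans (sym ρi) (sym (res i)))) ,
        λ p → ρj (trans (sym (res j)) (sym (residue-cong (s j) (scaled (lookup ρ) (lookup t) j) p)))
        where
        res : ∀ l → residue (scaled (lookup ρ) (lookup t) l) ≡ lookup ρ l
        res l = residue-unique (scaled (lookup ρ) (lookup t) l) (lookup ρ l) (lookup t l) refl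
      sep i j () fj | nothing | _
      sep i j fi () | just _ | just _

    private
      abstract
        tight-radius : ∃[ B ] ∀ ((ρ , i) : Vec (Fin d) k × Fin k) → radius (Local-Tight ρ i) ℕ.≤ B
        tight-radius = maxOver (Enc-× (Enc-Vec (Enc-Fin {d}) k) (Enc-Fin {k})) (λ (ρ , i) → radius (Local-Tight ρ i))

    -- Chosen above the range of `R` and all radii of `Tight`, so that tuples of heights with equal
    -- matrices receive the same verdict.
    scope : ℕ
    scope = range T ℕ.+ proj₁ tight-radius

    -- In the case `hopeless`, closure under minima shows that no solution with these residues lies
    -- above `y`.
    data Good (ρ : Vec (Fin d) k) (y : Vec ℤ k) : Maybe (Action d k) → Set where
      satisfied : R[ ρ ] (lookup y) → Good ρ y nothing
      raise     : ∀ i → ¬ R[ ρ ] (lookup y) → ¬ Tight ρ i y → Good ρ y (just (just (i , nothing)))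
      hopeless  : ¬ R[ ρ ] (lookup y) → (∀ i → Tight ρ i y) → Good ρ y (just nothing)

    test : ∀ ρ y → ∃ (Good ρ y)
    test ρ y with decide T (scaled (lookup ρ) (lookup y)) | any? (λ i → ¬? (dec (Local-Tight ρ i) y))
    ... | yes r | _           = _ , satisfied r
    ... | no ¬r | yes (i , t) = _ , raise i ¬r t
    ... | no ¬r | no none     = _ , hopeless ¬r (λ i → decidable-stable (dec (Local-Tight ρ i) y) (λ ¬t → none (i , ¬t)))

    Good-close : ∀ ρ y z {a} → Close (suc scope) (lookup y) (lookup z) → Good ρ y a → Good ρ z a
    Good-close ρ y z c = go
      where
      toR : ∀ (y z : Vec ℤ k) → Close (suc scope) (lookup y) (lookup z) → R[ ρ ] (lookup y) → R[ ρ ] (lookup z)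
      toR y z c = R[]-close ρ _ _ (Close-mono (lookup y) (lookup z) (ℕ.s≤s (ℕ.m≤m+n (range T) _)) c)
      toT : ∀ (y z : Vec ℤ k) i → Close (suc scope) (lookup y) (lookup z) → Tight ρ i y → Tight ρ i z
      toT y z i c = stable (Local-Tight ρ i) y z (Close-mono (lookup y) (lookup z)
        (ℕ.m≤n⇒m≤1+n (ℕ.≤-trans (proj₂ tight-radius (ρ , i)) (ℕ.m≤n+m _ (range T)))) c)
      c′ = Close-sym (lookup y) (lookup z) c
      go : ∀ {a} → Good ρ y a → Good ρ z a
      go (satisfied r)   = satisfied (toR y z c r)
      go (raise i ¬r ¬t) = raise i (¬r ∘ toR z y c′) (¬t ∘ toT z y i c′)
      go (hopeless ¬r t) = hopeless (¬r ∘ toR z y c′) (λ i → toT y z i c (t i))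

    -- By `compress` this box realises the matrix of every tuple of heights. A rule that sees only
    -- the matrix can thus recover a representative by finite search and test that one.
    Box : Set
    Box = Vec (Fin (suc (k ℕ.* suc scope))) k

    point : Box → Fin k → ℕ
    point h i = toℕ (lookup h i)

    abstract
      known? : (ms : Marks) → Dec (∃[ ρ ] Vec.map just ρ ≡ ms)
      known? ms = Enc-any? (Enc-Vec Enc-Fin k) λ ρ → Vec.≡-dec (Maybe.≡-dec Fin._≟_) _ _

      realised? : (m : Matrix (suc scope) k) → Dec (∃[ h ] matrix (suc scope) (point h) ≡ m)
      realised? m = Enc-any? (Enc-Vec Enc-Fin k) λ h → Vec.≡-dec (Vec.≡-dec Fin._≟_) _ _

    choose : ∀ {ms m} → Dec (∃[ ρ ] Vec.map just ρ ≡ ms) → Dec (∃[ h ] matrix (suc scope) (point h) ≡ m) → Maybe (Action d k)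
    choose (yes (ρ , _)) (yes (h , _)) = proj₁ (test ρ (tabulate (+_ ∘ point h)))
    -- A default for incomplete marks and for matrices that no heights have; `choose-good` shows
    -- that it does not arise otherwise.
    choose _             _             = nothing

    ruleCorrect : Marks → Matrix (suc scope) k → Maybe (Action d k)
    ruleCorrect ms m = choose (known? ms) (realised? m)

    realised : ∀ (y : Fin k → ℕ) → ∃[ h ] matrix (suc scope) (point h) ≡ matrix (suc scope) y
    realised y with h , h≤ , c ← compress (suc scope) (+_ ∘ y) =
      tabulate (λ i → fromℕ< (ℕ.s≤s (h≤ i))) ,
      trans (tabulate-cong λ i → tabulate-cong λ j → cong₂ (λ a b → clamp (suc scope) (a ∸ b)) (at h h≤ i) (at h h≤ j))
            (sym (close-matrix scope y h c))
      where
      at : ∀ h (h≤ : ∀ i → h i ℕ.≤ k ℕ.* suc scope) i → toℕ (lookup (tabulate (λ i → fromℕ< (ℕ.s≤s (h≤ i)))) i) ≡ h i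
      at h h≤ i = trans (cong toℕ (lookup∘tabulate (λ i → fromℕ< (ℕ.s≤s (h≤ i))) i)) (toℕ-fromℕ< (ℕ.s≤s (h≤ i)))

    choose-good : ∀ ρ (y : Fin k → ℕ) p q →
                  Good ρ (tabulate (+_ ∘ y)) (choose {Vec.map just ρ} {matrix (suc scope) y} p q)
    choose-good ρ y (no none) _         = contradiction (ρ , refl) none
    choose-good ρ y (yes _)   (no none) = contradiction (realised y) none
    choose-good ρ y (yes (ρ′ , e)) (yes (h , e′)) with refl ← map-just-injective ρ′ ρ e =
      Good-close ρ _ _ (λ i j → subst₂ (Sim (suc scope))
          (sym (cong₂ _-_ (lookup∘tabulate (+_ ∘ point h) i) (lookup∘tabulate (+_ ∘ point h) j)))
          (sym (cong₂ _-_ (lookup∘tabulate (+_ ∘ y) i) (lookup∘tabulate (+_ ∘ y) j)))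
          (matrix-close scope (point h) y e′ i j))
        (proj₂ (test ρ (tabulate (+_ ∘ point h))))

    ruleCorrect-good : ∀ ρ (y : Fin k → ℕ) → Good ρ (tabulate (+_ ∘ y)) (ruleCorrect (Vec.map just ρ) (matrix (suc scope) y))
    ruleCorrect-good ρ y = choose-good ρ y (known? (Vec.map just ρ)) (realised? (matrix (suc scope) y))

-- The algorithm on states, its soundness and its termination.

module Descent where

  open Locality
  open Tameness
  open LocalRules
  open import Data.Integer.Base as ℤ using (ℤ; +_; -_; _-_; 0ℤ; +≤+)
  open import Data.Integer.Tactic.RingSolver using (solve-∀)
  open import Data.List.Base using (foldl)
  open import Data.List.Relation.Unary.All as All using (All; []; _∷_)
  open import Data.Nat.Base as ℕ using (_∸_)
  open import Data.Vec.Base as Vec using (_[_]%=_)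
  open import Data.Vec.Properties using (lookup∘updateAt; lookup∘updateAt′)

  data Phase : Set where
    force guess correct : Phase

  module Algorithm {d : ℕ} .{{_ : ℕ.NonZero d}} {m : ℕ} (ar : Fin m → ℕ)
                   (R : ∀ i → (Fin (ar i) → ℤ) → Set) (T : ∀ i → Tame d (R i)) where

    Block : Set
    Block = Maybe (Fin d) × ℕ

    res : Fin m → ℕ
    res i = suc (Rules.scope (T i))

    rule : Phase → ∀ i → Vec (Maybe (Fin d)) (ar i) → Matrix (res i) (ar i) → Maybe (Action d (ar i))
    rule force   i ms _ = Rules.ruleForce (T i) ms
    rule guess   i ms _ = Rules.ruleGuess (T i) ms
    rule correct i ms x = Rules.ruleCorrect (T i) ms x

    modify : Maybe (Fin d) → Block → Block
    modify (just e) (_ , y) = just e , y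
    modify nothing  (r , y) = r , suc y

    radii : ∃[ K ] ∀ i → suc (range (T i)) ℕ.≤ K
    radii with B , le ← bounded (λ i → + suc (range (T i))) = B , le

    module _ {n : ℕ} where

      State : Set
      State = Vec Block n

      Constraint : Set
      Constraint = Σ (Fin m) λ i → Vec (Fin n) (ar i)

      mark : State → Fin n → Maybe (Fin d)
      mark σ v = proj₁ (lookup σ v)

      height : State → Fin n → ℕ
      height σ v = proj₂ (lookup σ v)

      react : Phase → State → (c : Constraint) → Maybe (Action d (ar (proj₁ c)))
      react ph σ (i , xs) = rule ph i (Vec.map (mark σ) xs) (matrix (res i) (height σ ∘ lookup xs))

      perform : ∀ {k} → Vec (Fin n) k → Maybe (Action d k) → State → State
      perform xs (just (just (j , u))) σ = σ [ lookup xs j ]%= modify u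
      -- Giving up leaves the state alone while `visit` sets the flag; the state is then stuck, and
      -- every later iteration sets the flag again.
      perform xs _                     σ = σ

      -- Once set, the flag blocks all later visits of the iteration. So at most one rule fires per
      -- iteration, and the order of the phases is a priority among the rules.
      visit : Phase → State × Bool → Constraint → State × Bool
      visit ph (σ , f) c =
        let r = if f then nothing else react ph σ c in perform (proj₂ c) r σ , f ∨ is-just r

      sweep : Phase → List Constraint → State × Bool → State × Bool
      sweep ph cs s = foldl (visit ph) s cs

      iter : List Constraint → State → State × Bool
      iter cs σ = sweep correct cs (sweep guess cs (sweep force cs (σ , false)))

      loop : List Constraint → ℕ → State × Bool → State × Bool
      loop cs zero    s       = s
      loop cs (suc t) (σ , f) = loop cs t (iter cs σ)

      sweep-done : ∀ ph cs σ → sweep ph cs (σ , true) ≡ (σ , true)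
      sweep-done ph []       σ = refl
      sweep-done ph (c ∷ cs) σ = sweep-done ph cs σ

      data Outcome (ph : Phase) (cs : List Constraint) (σ : State) : State × Bool → Set where
        quiet : All (λ c → react ph σ c ≡ nothing) cs → Outcome ph cs σ (σ , false)
        fired : (c : Constraint) → ∀ a → c ∈ cs → react ph σ c ≡ just a → Outcome ph cs σ (perform (proj₂ c) (just a) σ , true)

      outcome : ∀ ph cs σ → Outcome ph cs σ (sweep ph cs (σ , false))
      outcome ph [] σ = quiet []
      outcome ph (c ∷ cs) σ with react ph σ c in e
      ... | just a rewrite sweep-done ph cs (perform (proj₂ c) (just a) σ) = fired c a (here refl) e
      ... | nothing with sweep ph cs (σ , false) | outcome ph cs σ
      ...   | _ | quiet q         = quiet (e ∷ q)
      ...   | _ | fired c a c∈ e′ = fired c a (there c∈) e′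

      data Iteration (cs : List Constraint) (σ : State) : State × Bool → Set where
        still : All (λ c → react guess σ c ≡ nothing) cs → All (λ c → react correct σ c ≡ nothing) cs →
                Iteration cs σ (σ , false)
        by-force   : ∀ (c : Constraint) a → c ∈ cs → react force σ c ≡ just a → Iteration cs σ (perform (proj₂ c) (just a) σ , true)
        by-guess   : All (λ c → react force σ c ≡ nothing) cs →
                     ∀ (c : Constraint) a → c ∈ cs → react guess σ c ≡ just a → Iteration cs σ (perform (proj₂ c) (just a) σ , true)
        by-correct : All (λ c → react guess σ c ≡ nothing) cs →
                     ∀ (c : Constraint) a → c ∈ cs → react correct σ c ≡ just a → Iteration cs σ (perform (proj₂ c) (just a) σ , true)

      iteration : ∀ cs σ → Iteration cs σ (iter cs σ)
      iteration cs σ with sweep force cs (σ , false) | outcome force cs σ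
      ... | _ | fired c a c∈ e
        rewrite sweep-done guess cs (perform (proj₂ c) (just a) σ) | sweep-done correct cs (perform (proj₂ c) (just a) σ) =
        by-force c a c∈ e
      ... | _ | quiet q with sweep guess cs (σ , false) | outcome guess cs σ
      ...   | _ | fired c a c∈ e
        rewrite sweep-done correct cs (perform (proj₂ c) (just a) σ) = by-guess q c a c∈ e
      ...   | _ | quiet q′ with sweep correct cs (σ , false) | outcome correct cs σ
      ...     | _ | fired c a c∈ e = by-correct q′ c a c∈ e
      ...     | _ | quiet q″ = still q′ q″

      iter-still : ∀ cs σ {τ} → iter cs σ ≡ (τ , false) → τ ≡ σ
      iter-still cs σ e with iter cs σ | iteration cs σ
      iter-still cs σ refl | _ | still _ _ = refl

      loop-still : ∀ cs t σ f → iter cs σ ≡ (σ , false) → loop cs (suc t) (σ , f) ≡ (σ , false)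
      loop-still cs zero    σ f e = e
      loop-still cs (suc t) σ f e rewrite e = loop-still cs t σ false e

      Solution : List Constraint → (Fin n → ℤ) → Set
      Solution cs z = All (λ (i , xs) → R i (z ∘ lookup xs)) cs

      Marked : List Constraint → State → Set
      Marked cs σ = All (λ (i , xs) → ∀ j → ∃[ r ] mark σ (lookup xs j) ≡ just r) cs

      marked : ∀ cs σ → All (λ c → react guess σ c ≡ nothing) cs → Marked cs σ
      marked cs σ = All.map λ {c} → go c
        where
        go : ∀ ((i , xs) : Constraint) → react guess σ (i , xs) ≡ nothing → ∀ j → ∃[ r ] mark σ (lookup xs j) ≡ just r
        go (i , xs) e j with Rules.unmarked? (T i) (Vec.map (mark σ) xs)
        go (i , xs) () j | yes _
        ... | no all with mark σ (lookup xs j) in ej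
        ...   | just r  = r , refl
        ...   | nothing = contradiction (j , trans (lookup-map j (mark σ) xs) ej) all

      Agrees : State → (Fin n → Fin d) → Set
      Agrees σ ρ = ∀ v r → mark σ v ≡ just r → ρ v ≡ r

      map-marks : ∀ σ ρ {k} (xs : Vec (Fin n) k) → Agrees σ ρ → (∀ j → ∃[ r ] mark σ (lookup xs j) ≡ just r) →
                  Vec.map (mark σ) xs ≡ Vec.map just (Vec.map ρ xs)
      map-marks σ ρ []       ag mk = refl
      map-marks σ ρ (x ∷ xs) ag mk with r , e ← mk zero =
        cong₂ _∷_ (trans e (cong just (sym (ag x r e)))) (map-marks σ ρ xs ag (mk ∘ suc))

      value : (Fin n → Fin d) → (Fin n → ℕ) → Fin n → ℤ
      value ρ h = scaled ρ (+_ ∘ h)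

      tuple-≗ : ∀ (ρ : Fin n → Fin d) (y : Fin n → ℤ) {k} (xs : Vec (Fin n) k) j →
                scaled (lookup (Vec.map ρ xs)) (y ∘ lookup xs) j ≡ scaled ρ y (lookup xs j)
      tuple-≗ ρ y xs j = cong (λ r → + toℕ r ℤ.+ + d ℤ.* y (lookup xs j)) (lookup-map j ρ xs)

      scaled-tabulate : ∀ {k} (ρ : Fin k → Fin d) (y : Fin k → ℤ) j → scaled ρ (lookup (tabulate y)) j ≡ scaled ρ y j
      scaled-tabulate ρ y j = cong (λ x → + toℕ (ρ j) ℤ.+ + d ℤ.* x) (lookup∘tabulate y j)

      good : ∀ σ ρ ((i , xs) : Constraint) → Agrees σ ρ → (∀ j → ∃[ r ] mark σ (lookup xs j) ≡ just r) →
             Rules.Good (T i) (Vec.map ρ xs) (tabulate (+_ ∘ height σ ∘ lookup xs)) (react correct σ (i , xs))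
      good σ ρ (i , xs) ag mk rewrite map-marks σ ρ xs ag mk = Rules.ruleCorrect-good (T i) (Vec.map ρ xs) (height σ ∘ lookup xs)

      -- A silent `guess` means that all variables in constraints are marked, and a silent `correct`
      -- that the current heights satisfy every constraint. How the state was reached does not
      -- enter.
      sound : ∀ cs σ {τ} → iter cs σ ≡ (τ , false) → ∃ (Solution cs)
      sound cs σ e with iter cs σ | iteration cs σ
      sound cs σ refl | _ | still g c = value ρ (height σ) , go cs (marked cs σ g) c
        where
        ρ : Fin n → Fin d
        -- The default concerns only variables that occur in no constraint.
        ρ v = fromMaybe (residue 0ℤ) (mark σ v)
        ag : Agrees σ ρ
        ag v r e rewrite e = refl
        go : ∀ cs → Marked cs σ → All (λ c → react correct σ c ≡ nothing) cs → Solution cs (value ρ (height σ))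
        go []       []       []       = []
        go ((i , xs) ∷ cs) (mk ∷ mks) (e ∷ es) with react correct σ (i , xs) | good σ ρ (i , xs) ag mk
        go ((i , xs) ∷ cs) (mk ∷ mks) (e ∷ es) | nothing | Rules.satisfied r =
          Sink.R-≗ (T i) (λ j → trans (scaled-tabulate (lookup (Vec.map ρ xs)) (+_ ∘ height σ ∘ lookup xs) j)
                                      (tuple-≗ ρ (+_ ∘ height σ) xs j)) r ∷ go cs mks es

      bound : ℕ
      bound = n ℕ.* proj₁ radii

      -- The number of changes a variable may still undergo: one mark, and raises up to `bound`.
      weight : Block → ℕ
      weight (r , y) = (if is-nothing r then 1 else 0) ℕ.+ (bound ∸ y)

      potential : State → ℕ
      potential σ = ∑ (weight ∘ lookup σ)

      potential-< : ∀ σ x u → weight (modify u (lookup σ x)) ℕ.< weight (lookup σ x) →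
                    potential (σ [ x ]%= modify u) ℕ.< potential σ
      potential-< σ x u lt = ∑-strict le x (subst (λ b → weight b ℕ.< weight (lookup σ x)) (sym (lookup∘updateAt x σ)) lt)
        where
        le : ∀ v → weight (lookup (σ [ x ]%= modify u) v) ℕ.≤ weight (lookup σ v)
        le v with v Fin.≟ x
        ... | yes refl rewrite lookup∘updateAt x {modify u} σ = ℕ.<⇒≤ lt
        ... | no v≢x   rewrite lookup∘updateAt′ v x {modify u} v≢x σ = ℕ.≤-refl

      -- While residues are being determined all heights are zero; afterwards some solution lies above
      -- the heights.
      data Invariant (cs : List Constraint) (σ : State) : Set where
        early : (∀ v → height σ v ≡ 0) → ∀ z → Solution cs z → Agrees σ (residue ∘ z) → Invariant cs σ
        late  : Marked cs σ → ∀ ρ h → Agrees σ ρ → (∀ v → height σ v ℕ.≤ h v) → (∀ v → h v ℕ.≤ bound) →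
                Solution cs (value ρ h) → Invariant cs σ

      -- Once all residues are known, the quotients of the solution are compressed, at a resolution
      -- fine enough for every relation. Any result lies above the heights, which are still zero.
      settle : ∀ cs σ → Marked cs σ → Invariant cs σ →
               ∃[ ρ ] ∃[ h ] Agrees σ ρ × (∀ v → height σ v ℕ.≤ h v) × (∀ v → h v ℕ.≤ bound) × Solution cs (value ρ h)
      settle cs σ mk (late _ ρ h ag y≤ h≤ sol) = ρ , h , ag , y≤ , h≤ , sol
      settle cs σ mk (early y≡0 z sol ag) with h , h≤ , cl ← compress (proj₁ radii) (quot {d} ∘ z) =
        residue ∘ z , h , ag , (λ v → ℕ.≤-trans (ℕ.≤-reflexive (y≡0 v)) ℕ.z≤n) , h≤ , All.map (λ {c} → go c h cl) sol
        where
        go : ∀ ((i , xs) : Constraint) h → Close (proj₁ radii) (quot {d} ∘ z) (+_ ∘ h) →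
             R i (z ∘ lookup xs) → R i (value (residue ∘ z) h ∘ lookup xs)
        go (i , xs) h cl r = Sink.R-≗ (T i) (tuple-≗ (residue ∘ z) (+_ ∘ h) xs)
          (Rules.R[]-close (T i) (Vec.map (residue ∘ z) xs) (quot {d} ∘ z ∘ lookup xs) (+_ ∘ h ∘ lookup xs)
            (λ j l → Sim-mono (proj₂ radii i) (cl (lookup xs j) (lookup xs l))) r′)
          where
          r′ : Rules.R[_] (T i) (Vec.map (residue ∘ z) xs) (quot {d} ∘ z ∘ lookup xs)
          r′ = Sink.R-≗ (T i) (λ j → trans (residue-≡ (z (lookup xs j))) (sym (tuple-≗ (residue ∘ z) (quot {d} ∘ z) xs j))) r

      mark-update : ∀ σ x e v → mark (σ [ x ]%= modify (just e)) v ≡ mark σ v ⊎ (v ≡ x × mark (σ [ x ]%= modify (just e)) v ≡ just e)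
      mark-update σ x e v with v Fin.≟ x
      ... | yes refl rewrite lookup∘updateAt x {modify (just e)} σ = inj₂ (refl , refl)
      ... | no v≢x   rewrite lookup∘updateAt′ v x {modify (just e)} v≢x σ = inj₁ refl

      height-mark : ∀ σ x e v → height (σ [ x ]%= modify (just e)) v ≡ height σ v
      height-mark σ x e v with v Fin.≟ x
      ... | yes refl rewrite lookup∘updateAt x {modify (just e)} σ = refl
      ... | no v≢x   rewrite lookup∘updateAt′ v x {modify (just e)} v≢x σ = refl

      mark-raise : ∀ σ x v → mark (σ [ x ]%= modify nothing) v ≡ mark σ v
      mark-raise σ x v with v Fin.≟ x
      ... | yes refl rewrite lookup∘updateAt x {modify nothing} σ = refl
      ... | no v≢x   rewrite lookup∘updateAt′ v x {modify nothing} v≢x σ = refl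

      Progress : List Constraint → State → State → Set
      Progress cs σ τ = Invariant cs τ × potential τ ℕ.< potential σ

      set-mark : ∀ cs σ x e z → (∀ v → height σ v ≡ 0) → Solution cs z → Agrees σ (residue ∘ z) →
                 mark σ x ≡ nothing → residue (z x) ≡ e → Progress cs σ (σ [ x ]%= modify (just e))
      set-mark cs σ x e z y≡0 sol ag un ex =
        early (λ v → trans (height-mark σ x e v) (y≡0 v)) z sol ag′ ,
        potential-< σ x (just e) (lighter (lookup σ x) un)
        where
        ag′ : Agrees (σ [ x ]%= modify (just e)) (residue ∘ z)
        ag′ v r p with mark-update σ x e v
        ... | inj₁ q          = ag v r (trans (sym q) p)
        ... | inj₂ (refl , q) with refl ← trans (sym q) p = ex
        lighter : ∀ b → proj₁ b ≡ nothing → weight (modify (just e) b) ℕ.< weight b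
        lighter (nothing , y) refl = ℕ.≤-refl

      step-force : ∀ cs σ c a → Invariant cs σ → c ∈ cs → react force σ c ≡ just a →
                   Progress cs σ (perform (proj₂ c) (just a) σ)
      step-force cs σ (i , xs) a inv c∈ e with Rules.forces? (T i) (Vec.map (mark σ) xs)
      step-force cs σ (i , xs) a inv c∈ () | no _
      step-force cs σ (i , xs) .(just (j , just e)) inv c∈ refl | yes (((l , r) , (j , e)) , f) = go inv
        where
        fj : mark σ (lookup xs j) ≡ nothing
        fj = trans (sym (lookup-map j (mark σ) xs)) (proj₁ (proj₂ f))
        go : Invariant cs σ → Progress cs σ (σ [ lookup xs j ]%= modify (just e))
        go (late mk _ _ _ _ _ _) with _ , p ← All.lookup mk c∈ j = contradiction (trans (sym p) fj) (λ ())
        go (early y≡0 z sol ag) = set-mark cs σ (lookup xs j) e z y≡0 sol ag fj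
          (Rules.forced (T i) (Vec.map (mark σ) xs) (z ∘ lookup xs) l r j e f (All.lookup sol c∈)
            (λ j r p → ag (lookup xs j) r (trans (sym (lookup-map j (mark σ) xs)) p)))

      unforced : ∀ σ ((i , xs) : Constraint) → react force σ (i , xs) ≡ nothing → ¬ ∃ (Rules.Forces (T i) (Vec.map (mark σ) xs))
      unforced σ (i , xs) e f with Rules.forces? (T i) (Vec.map (mark σ) xs)
      unforced σ (i , xs) e  f | no ¬f = ¬f f
      unforced σ (i , xs) () f | yes _

      -- The guess may contradict the given solution, which is replaced by one in which all unmarked
      -- variables are lowered by the same amount; marked variables keep their values.
      step-guess : ∀ cs σ c a → Invariant cs σ → All (λ c → react force σ c ≡ nothing) cs → c ∈ cs →
                   react guess σ c ≡ just a → Progress cs σ (perform (proj₂ c) (just a) σ)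
      step-guess cs σ (i , xs) a inv q c∈ e with Rules.unmarked? (T i) (Vec.map (mark σ) xs)
      step-guess cs σ (i , xs) a inv q c∈ () | no _
      step-guess cs σ (i , xs) .(just (j , just (residue 0ℤ))) inv q c∈ refl | yes (j , un) = go inv
        where
        x = lookup xs j
        fj : mark σ x ≡ nothing
        fj = trans (sym (lookup-map j (mark σ) xs)) un
        go : Invariant cs σ → Progress cs σ (σ [ x ]%= modify (just (residue 0ℤ)))
        go (late mk _ _ _ _ _ _) with _ , p ← All.lookup mk c∈ j = contradiction (trans (sym p) fj) (λ ())
        go (early y≡0 z sol ag) = set-mark cs σ x (residue 0ℤ) z′ y≡0 sol′ ag′ fj zx
          where
          -- The thresholds of the constraints are combined by maxima, so that one amount is
          -- admissible for all of them.
          low : ∀ cs → Solution cs z → All (λ c → react force σ c ≡ nothing) cs →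
                ∃[ B ] ∀ M → B ℕ.≤ M → Solution cs (λ v → z v - (if is-nothing (mark σ v) then + M else 0ℤ))
          low [] [] [] = 0 , λ _ _ → []
          low ((i , xs) ∷ cs) (r ∷ rs) (e ∷ es) with B , f ← low cs rs es = B ℕ.⊔ proj₁ g , λ M le →
            proj₂ g M (ℕ.≤-trans (ℕ.m≤n⊔m B _) le) ∷ f M (ℕ.≤-trans (ℕ.m≤m⊔n B _) le)
            where
            g : ∃[ B ] ∀ M → B ℕ.≤ M → R i (λ j → z (lookup xs j) - (if is-nothing (mark σ (lookup xs j)) then + M else 0ℤ))
            g = _ , λ M le → Sink.R-≗ (T i)
                  (λ j → cong (λ o → z (lookup xs j) - (if is-nothing o then + M else 0ℤ)) (lookup-map j (mark σ) xs))
                  (Rules.lowerable (T i) (Vec.map (mark σ) xs) (z ∘ lookup xs) (unforced σ (i , xs) e) r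
                    (λ j r p → ag (lookup xs j) r (trans (sym (lookup-map j (mark σ) xs)) p)) M le)
          B = proj₁ (low cs sol q)
          -- Congruent to `z x` modulo `d`, so that the new value of `x` has residue 0, and at least
          -- `B` because `d` is positive.
          M = toℕ (residue {d} (z x)) ℕ.+ d ℕ.* B
          z′ : Fin n → ℤ
          z′ v = z v - (if is-nothing (mark σ v) then + M else 0ℤ)
          sol′ : Solution cs z′
          sol′ = proj₂ (low cs sol q) M (ℕ.≤-trans (Q≤dQ d B) (ℕ.m≤n+m _ _))
          ag′ : Agrees σ (residue ∘ z′)
          ag′ v r p rewrite p = trans (cong residue (ℤ.+-identityʳ (z v))) (ag v r p)
          eqn : ∀ r d q b → (r ℤ.+ d ℤ.* q) - (r ℤ.+ d ℤ.* b) - 0ℤ ≡ (q - b) ℤ.* d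
          eqn = solve-∀
          zx : residue (z′ x) ≡ residue 0ℤ
          zx rewrite fj = residue-cong (z x - + M) 0ℤ (divides (quot {d} (z x) - + B)
            (trans (cong₂ (λ a b → a - b - 0ℤ) (residue-≡ {d} (z x)) (cong (ℤ._+_ (+ toℕ (residue {d} (z x)))) (ℤ.pos-* d B)))
                   (eqn (+ toℕ (residue {d} (z x))) (+ d) (quot {d} (z x)) (+ B))))

      step-correct : ∀ cs σ c a → Invariant cs σ → Marked cs σ → c ∈ cs →
                     react correct σ c ≡ just a → Progress cs σ (perform (proj₂ c) (just a) σ)
      step-correct cs σ c@(i , xs) a inv mk c∈ e with ρ , h , ag , y≤h , h≤ , sol ← settle cs σ mk inv =
        go a (subst (Rules.Good (T i) (Vec.map ρ xs) (tabulate (+_ ∘ height σ ∘ lookup xs))) e (good σ ρ c ag (All.lookup mk c∈)))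
        where
        go : ∀ a → Rules.Good (T i) (Vec.map ρ xs) (tabulate (+_ ∘ height σ ∘ lookup xs)) (just a) →
             Progress cs σ (perform xs (just a) σ)
        s : Fin (ar i) → ℤ
        s = +_ ∘ h ∘ lookup xs
        rs : Rules.R[_] (T i) (Vec.map ρ xs) s
        rs = Sink.R-≗ (T i) (λ j → sym (tuple-≗ ρ (+_ ∘ h) xs j)) (All.lookup sol c∈)
        below : ∀ j → lookup (tabulate (+_ ∘ height σ ∘ lookup xs)) j ℤ.≤ s j
        below j = subst (ℤ._≤ s j) (sym (lookup∘tabulate (+_ ∘ height σ ∘ lookup xs) j)) (+≤+ (y≤h (lookup xs j)))
        go .nothing (Rules.hopeless ¬r tight) =
          contradiction (Rules.all-tight (T i) (Vec.map ρ xs) (tabulate (+_ ∘ height σ ∘ lookup xs)) s rs below tight) ¬r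
        go .(just (j , nothing)) (Rules.raise j ¬r ¬t) =
          late (All.map (λ f j → proj₁ (f j) , trans (mark-raise σ x _) (proj₂ (f j))) mk) ρ h
               (λ v r p → ag v r (trans (sym (mark-raise σ x v)) p)) y≤h′ h≤ sol ,
          potential-< σ x nothing (lighter (lookup σ x) (ℕ.≤-trans y<h (h≤ x)))
          where
          x = lookup xs j
          y<h : height σ x ℕ.< h x
          -- If the heights were equal at `x`, the solution `h` itself would witness tightness at
          -- `j`.
          y<h = ℕ.≤∧≢⇒< (y≤h x) λ eq → ¬t (tabulate s ,
            Sink.R-≗ (T i) (λ l → sym (scaled-tabulate (lookup (Vec.map ρ xs)) s l)) rs ,
            (λ l → subst (ℤ._≤_ _) (sym (lookup∘tabulate s l)) (below l)) ,
            trans (lookup∘tabulate (+_ ∘ height σ ∘ lookup xs) j) (trans (cong +_ eq) (sym (lookup∘tabulate s j))))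
          y≤h′ : ∀ v → height (σ [ x ]%= modify nothing) v ℕ.≤ h v
          y≤h′ v with v Fin.≟ x
          ... | yes refl rewrite lookup∘updateAt x {modify nothing} σ = y<h
          ... | no v≢x   rewrite lookup∘updateAt′ v x {modify nothing} v≢x σ = y≤h v
          lighter : ∀ b → proj₂ b ℕ.< bound → weight (modify nothing b) ℕ.< weight b
          lighter (r , y) lt = ℕ.+-monoʳ-< (if is-nothing r then 1 else 0) (ℕ.∸-monoʳ-< {bound} ℕ.≤-refl lt)

      progress : ∀ cs σ → Invariant cs σ → ∀ {τ f} → iter cs σ ≡ (τ , f) → f ≡ false ⊎ (f ≡ true × Progress cs σ τ)
      progress cs σ inv e with iter cs σ | iteration cs σ
      progress cs σ inv refl | _ | still _ _              = inj₁ refl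
      progress cs σ inv refl | _ | by-force c a c∈ e      = inj₂ (refl , step-force cs σ c a inv c∈ e)
      progress cs σ inv refl | _ | by-guess q c a c∈ e    = inj₂ (refl , step-guess cs σ c a inv q c∈ e)
      progress cs σ inv refl | _ | by-correct q c a c∈ e  = inj₂ (refl , step-correct cs σ c a inv (marked cs σ q) c∈ e)

      -- The potential falls with every iteration that fires, so a quiet one is reached in time; the
      -- state is then unchanged and all remaining iterations are quiet too.
      complete : ∀ cs t σ f → Invariant cs σ → potential σ ℕ.< t → proj₂ (loop cs t (σ , f)) ≡ false
      complete cs (suc t) σ f inv lt with iter cs σ in e
      ... | τ , f′ with progress cs σ inv e
      ...   | inj₂ (refl , inv′ , lt′) = complete cs t τ true inv′ (ℕ.<-≤-trans lt′ (ℕ.≤-pred lt))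
      ...   | inj₁ refl with refl ← iter-still cs σ e with t
      ...     | zero   = refl
      ...     | suc t′ = cong proj₂ (loop-still cs t′ σ false e)

      loop-sound : ∀ cs t σ f → proj₂ (loop cs (suc t) (σ , f)) ≡ false → ∃ (Solution cs)
      loop-sound cs zero σ f e with iter cs σ in eq
      loop-sound cs zero σ f refl | _ = sound cs σ eq
      loop-sound cs (suc t) σ f e = loop-sound cs t (proj₁ (iter cs σ)) (proj₂ (iter cs σ)) e

      blank : State
      blank = Vec.replicate n (nothing , 0)

      correctness : ∀ cs t f → n ℕ.* suc bound ℕ.≤ t →
                    (proj₂ (loop cs (suc t) (blank , f)) ≡ false → ∃ (Solution cs)) ×
                    (∃ (Solution cs) → proj₂ (loop cs (suc t) (blank , f)) ≡ false)
      correctness cs t f le = loop-sound cs t blank f , λ (z , sol) →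
        complete cs (suc t) blank f
          (early (λ v → cong proj₂ (lookup-replicate v (nothing , 0))) z sol
            (λ v r e → contradiction (trans (sym e) (cong proj₁ (lookup-replicate v (nothing , 0)))) λ ()))
          -- Initially every variable is unmarked at height zero and has weight `suc bound`.
          (ℕ.s≤s (ℕ.≤-trans (∑-≤ (weight ∘ lookup blank)
            (λ v → ℕ.≤-reflexive (cong weight (lookup-replicate v (nothing , 0))))) le))

-- Computing clamped differences with finite memory.

module ColumnCounting where

  open Codes
  open StackMachines
  open LocalRules
  open Descent
  open import Data.Fin.Patterns
  open import Data.List.Base using (foldl; length; allFin)
  open import Data.Nat.Base using (_+_; _∸_; _≤_; s≤s; pred; _⊔_; _<ᵇ_)
  open import Data.Nat.Properties hiding (_≟_)
  open import Data.Vec.Base as Vec using (_[_]≔_)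
  open import Data.Vec.Properties using (lookup∘update; lookup∘update′)

  ≤-by : ∀ {a b} r → b ≡ a + r → a ≤ b
  ≤-by {a} r refl = m≤m+n a r

  data Sym (d w v : ℕ) : Set where
    tick : Sym d w v
    sep  : Maybe (Fin d) → Sym d w v
    col  : Fin w → Sym d w v
    reg  : Fin v → Sym d w v

  Enc-Sym : ∀ {d w v} → Enc (Sym d w v)
  Enc-Sym {d} {w} {v} = Enc-retract f g gf (Enc-⊎ (Enc-Maybe (Enc-Maybe Enc-Fin)) (Enc-⊎ Enc-Fin Enc-Fin))
    where
    f : Sym d w v → Maybe (Maybe (Fin d)) ⊎ (Fin w ⊎ Fin v)
    f tick    = inj₁ nothing
    f (sep x) = inj₁ (just x)
    f (col x) = inj₂ (inj₁ x)
    f (reg x) = inj₂ (inj₂ x)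
    g : Maybe (Maybe (Fin d)) ⊎ (Fin w ⊎ Fin v) → Sym d w v
    g (inj₁ nothing)  = tick
    g (inj₁ (just x)) = sep x
    g (inj₂ (inj₁ x)) = col x
    g (inj₂ (inj₂ x)) = reg x
    gf : ∀ x → g (f x) ≡ x
    gf tick    = refl
    gf (sep x) = refl
    gf (col x) = refl
    gf (reg x) = refl

  -- The heights of the variables of a constraint are written on a single stack, as a list of
  -- columns; the l-th column tells which heights exceed l.
  module Columns {k : ℕ} where

    Column : Set
    Column = Vec Bool k

    raise-track : Fin k → ℕ → List Column → List Column
    raise-track j zero    cs       = cs
    raise-track j (suc y) []       = (Vec.replicate k false [ j ]≔ true) ∷ raise-track j y []
    raise-track j (suc y) (c ∷ cs) = (c [ j ]≔ true) ∷ raise-track j y cs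

    raise-track-length : ∀ j y cs → length (raise-track j y cs) ≤ y + length cs
    raise-track-length j zero    cs       = ≤-refl
    raise-track-length j (suc y) []       = s≤s (raise-track-length j y [])
    raise-track-length j (suc y) (c ∷ cs) = s≤s (≤-trans (raise-track-length j y cs) (+-monoʳ-≤ y (n≤1+n _)))

    Cols : List Column → (Fin k → ℕ) → Set
    Cols []       η = ∀ i → η i ≡ 0
    Cols (c ∷ cs) η = (∀ i → lookup c i ≡ (0 <ᵇ η i)) × Cols cs (pred ∘ η)

    Cols-≗ : ∀ cs {η θ} → (∀ i → η i ≡ θ i) → Cols cs η → Cols cs θ
    Cols-≗ []       e c       i = trans (sym (e i)) (c i)
    Cols-≗ (_ ∷ cs) e (c , r) = (λ i → trans (c i) (cong (0 <ᵇ_) (e i))) , Cols-≗ cs (cong pred ∘ e) r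

    Cols-raise : ∀ j y cs η θ → Cols cs η → θ j ≡ η j ⊔ y → (∀ i → i ≢ j → θ i ≡ η i) → Cols (raise-track j y cs) θ
    Cols-raise j zero cs η θ c ej en = Cols-≗ cs eqn c
      where
      eqn : ∀ i → η i ≡ θ i
      eqn i with i Fin.≟ j
      ... | yes refl = sym (trans ej (⊔-identityʳ _))
      ... | no i≢j   = sym (en i i≢j)
    Cols-raise j (suc y) [] η θ c ej en = top , Cols-raise j y [] η (pred ∘ θ) c
        (trans (cong pred ej) (trans (cong (λ z → pred (z ⊔ suc y)) (c j)) (cong (_⊔ y) (sym (c j)))))
        (λ i i≢j → trans (cong pred (trans (en i i≢j) (c i))) (sym (c i)))
      where
      top : ∀ i → lookup (Vec.replicate k false [ j ]≔ true) i ≡ (0 <ᵇ θ i)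
      top i with i Fin.≟ j
      ... | yes refl rewrite ej | c j = lookup∘update j (Vec.replicate k false) true
      ... | no i≢j   rewrite en i i≢j | c i = trans (lookup∘update′ i≢j (Vec.replicate k false) true) (lookup-replicate i false)
    Cols-raise j (suc y) (c ∷ cs) η θ (h , r) ej en = top , Cols-raise j y cs (pred ∘ η) (pred ∘ θ) r
        (trans (cong pred ej) (pred-⊔ (η j) y)) (λ i i≢j → cong pred (en i i≢j))
      where
      pred-⊔ : ∀ a b → pred (a ⊔ suc b) ≡ pred a ⊔ b
      pred-⊔ zero    b = refl
      pred-⊔ (suc a) b = refl
      pos-⊔ : ∀ a b → (0 <ᵇ a ⊔ suc b) ≡ true
      pos-⊔ zero    b = refl
      pos-⊔ (suc a) b = refl
      top : ∀ i → lookup (c [ j ]≔ true) i ≡ (0 <ᵇ θ i)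
      top i with i Fin.≟ j
      ... | yes refl rewrite ej = trans (lookup∘update j c true) (sym (pos-⊔ (η j) y))
      ... | no i≢j   rewrite en i i≢j = trans (lookup∘update′ i≢j c true) (h i)

    collect : (Fin k → ℕ) → List Column → List (Fin k) → List Column
    collect g = foldl (λ cs j → raise-track j (g j) cs)

    -- Invariant of the fold: each coordinate is recorded already, or is still zero and due to come.
    Cols-collect : ∀ g js cs η → Cols cs η → (∀ i → η i ≡ g i ⊎ (η i ≡ 0 × i ∈ js)) → Cols (collect g cs js) g
    Cols-collect g [] cs η c h = Cols-≗ cs (λ i → go (h i)) c
      where
      go : ∀ {i} → η i ≡ g i ⊎ (η i ≡ 0 × i ∈ []) → η i ≡ g i
      go (inj₁ e) = e
    Cols-collect g (j ∷ js) cs η c h = Cols-collect g js _ θ (Cols-raise j (g j) cs η θ c at-j off-j) h′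
      where
      θ : Fin k → ℕ
      θ i with i Fin.≟ j
      ... | yes _ = g j
      ... | no _  = η i
      at-j : θ j ≡ η j ⊔ g j
      at-j with j Fin.≟ j | h j
      ... | no ¬p | _ = contradiction refl ¬p
      ... | yes _ | inj₁ e       = sym (trans (cong (_⊔ g j) e) (⊔-idem (g j)))
      ... | yes _ | inj₂ (e , _) = sym (cong (_⊔ g j) e)
      off-j : ∀ i → i ≢ j → θ i ≡ η i
      off-j i i≢j with i Fin.≟ j
      ... | yes p = contradiction p i≢j
      ... | no _  = refl
      h′ : ∀ i → θ i ≡ g i ⊎ (θ i ≡ 0 × i ∈ js)
      h′ i with i Fin.≟ j | h i
      ... | yes refl | _                    = inj₁ refl
      ... | no i≢j   | inj₁ e               = inj₁ e
      ... | no i≢j   | inj₂ (e , here p)    = contradiction p i≢j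
      ... | no i≢j   | inj₂ (e , there i∈)  = inj₂ (e , i∈)

    module _ {K : ℕ} where

      count : Matrix K k → Column → Matrix K k
      count m c = tabulate λ i → tabulate λ j →
        if lookup c i ∧ Bool.not (lookup c j) then bump (entry m i j) else entry m i j

      -- The columns that contain `i` but not `j` are those between the heights `η j` and `η i`, so
      -- their number is the truncated difference. A saturating counter per entry suffices, since
      -- `bump` commutes with `clamp`.
      count-all : ∀ cs η m (t : Fin k → Fin k → ℕ) → Cols cs η → (∀ i j → entry m i j ≡ clamp K (t i j)) →
                  ∀ i j → entry (foldl count m cs) i j ≡ clamp K (t i j + (η i ∸ η j))
      count-all [] η m t c e i j rewrite c i | 0∸n≡0 (η j) | +-identityʳ (t i j) = e i j
      count-all (c ∷ cs) η m t (h , r) e i j =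
        trans (count-all cs (pred ∘ η) (count m c) u r e′ i j) (cong (clamp K) (total i j))
        where
        u : Fin k → Fin k → ℕ
        u i j = if (0 <ᵇ η i) ∧ Bool.not (0 <ᵇ η j) then suc (t i j) else t i j
        e′ : ∀ i j → entry (count m c) i j ≡ clamp K (u i j)
        e′ i j rewrite entry-tabulate (λ i j → if lookup c i ∧ Bool.not (lookup c j) then bump (entry m i j) else entry m i j) i j
                     | h i | h j | e i j with (0 <ᵇ η i) ∧ Bool.not (0 <ᵇ η j)
        ... | true  = bump-clamp K (t i j)
        ... | false = refl
        total : ∀ i j → u i j + (pred (η i) ∸ pred (η j)) ≡ t i j + (η i ∸ η j)
        total i j with η i | η j
        ... | zero  | b     = cong (t i j +_) (trans (0∸n≡0 (pred b)) (sym (0∸n≡0 b)))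
        ... | suc a | zero  = sym (+-suc (t i j) a)
        ... | suc a | suc b = refl

      matrix-ext : ∀ {A : Set} (m m′ : Vec (Vec A k) k) → (∀ i j → entry m i j ≡ entry m′ i j) → m ≡ m′
      matrix-ext m m′ e = trans (sym (tabulate∘lookup m)) (trans (tabulate-cong row) (tabulate∘lookup m′))
        where
        row : ∀ i → lookup m i ≡ lookup m′ i
        row i = trans (sym (tabulate∘lookup (lookup m i))) (trans (tabulate-cong (e i)) (tabulate∘lookup (lookup m′ i)))

      count-matrix : ∀ cs η → Cols cs η → foldl count (Vec.replicate k (Vec.replicate k zero)) cs ≡ matrix K η
      count-matrix cs η c = matrix-ext _ _ λ i j → trans
        (count-all cs η (Vec.replicate k (Vec.replicate k zero)) (λ _ _ → 0) c (λ i j →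
          trans (trans (cong (λ r → lookup r j) (lookup-replicate i (Vec.replicate k zero))) (lookup-replicate j zero))
                (Fin.toℕ-injective (sym (toℕ-clamp K 0)))) i j)
        (sym (entry-tabulate (λ i j → clamp K (η i ∸ η j)) i j))

    record-all : ∀ {A : Set} → (Fin k → A) → Vec A k → List (Fin k) → Vec A k
    record-all f = foldl (λ v j → v [ j ]≔ f j)

    lookup-record-all : ∀ {A : Set} (f : Fin k → A) js v i → lookup v i ≡ f i ⊎ i ∈ js → lookup (record-all f v js) i ≡ f i
    lookup-record-all f []       v i (inj₁ e) = e
    lookup-record-all f (j ∷ js) v i h = lookup-record-all f js (v [ j ]≔ f j) i (step i h)
      where
      step : ∀ i → lookup v i ≡ f i ⊎ i ∈ j ∷ js → lookup (v [ j ]≔ f j) i ≡ f i ⊎ i ∈ js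
      step i h with i Fin.≟ j | h
      ... | yes refl | _                 = inj₁ (lookup∘update j v (f j))
      ... | no i≢j   | inj₁ e            = inj₁ (trans (lookup∘update′ i≢j v (f j)) e)
      ... | no i≢j   | inj₂ (here p)     = contradiction p i≢j
      ... | no i≢j   | inj₂ (there i∈)   = inj₂ i∈

    record-all-map : ∀ {A B : Set} (f : A → B) (xs : Vec A k) v → record-all (f ∘ lookup xs) v (allFin k) ≡ Vec.map f xs
    record-all-map f xs v = trans (sym (tabulate∘lookup _)) (trans (tabulate-cong λ i →
      trans (lookup-record-all (f ∘ lookup xs) (allFin k) v i (inj₂ (∈-allFin i))) (sym (lookup-map i f xs))) (tabulate∘lookup _))

-- Stack programs for reading and changing the blocks of one constraint.

module Programs where

  open Codes
  open StackMachines
  open Tameness using (Tame)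
  open LocalRules
  open Descent
  open ColumnCounting
  open import Data.Fin.Patterns
  open import Data.Integer.Base using (ℤ)
  open import Data.List.Base using (foldl; foldr; length; _ʳ++_; map)
  open import Data.Nat.Base using (_+_; _*_; _≤_; z≤n; s≤s; NonZero)
  open import Data.Nat.Properties hiding (_≟_)
  open import Data.Nat.Tactic.RingSolver using (solve-∀)
  open import Data.Vec.Base as Vec using (_[_]≔_; _[_]%=_)

  module Program {d : ℕ} .{{_ : NonZero d}} {m : ℕ} (ar : Fin m → ℕ)
                 (R : ∀ i → (Fin (ar i) → ℤ) → Set) (T : ∀ i → Tame d (R i)) where

    open Algorithm ar R T

    -- The whole working memory for one constraint (marks, matrix, pending action) is finite and is
    -- held in a single stack symbol.
    Reg : Fin m → Set
    Reg i = Vec (Maybe (Fin d)) (ar i) × Matrix (res i) (ar i) × Maybe (Action d (ar i))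

    emptyReg : ∀ i → Reg i
    emptyReg i = Vec.replicate _ nothing , Vec.replicate _ (Vec.replicate _ zero) , nothing

    abstract
      cols : Joint (λ i → Vec Bool (ar i))
      cols = joint (λ i → Enc-Vec Enc-Bool (ar i)) (λ i → Vec.replicate (ar i) false)

      regs : Joint Reg
      regs = joint (λ i → Enc-× (Enc-Vec (Enc-Maybe Enc-Fin) (ar i))
                         (Enc-× (Enc-Vec (Enc-Vec Enc-Fin (ar i)) (ar i))
                                (Enc-Maybe (Enc-Maybe (Enc-× Enc-Fin (Enc-Maybe Enc-Fin)))))) emptyReg

    open StackMachine (Sym d (width cols) (width regs)) Enc-Sym 10 public

    -- The stacks: unread and read input; the table of blocks, to the right and to the left of the
    -- current position; two stacks for the columns; the register of the current constraint; the flag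
    -- telling that a rule has fired; and three clocks.
    st : (I J D E C C′ G F P Q Q′ : List Elem) → Store
    st I J D E C C′ G F P Q Q′ = I ∷ J ∷ D ∷ E ∷ C ∷ C′ ∷ G ∷ F ∷ P ∷ Q ∷ Q′ ∷ []

    pattern one   = inj₁ true
    pattern nul   = inj₁ false
    pattern tk    = inj₂ tick
    pattern sp x  = inj₂ (sep x)

    reps : Elem → ℕ → List Elem → List Elem
    reps a zero    xs = xs
    reps a (suc n) xs = a ∷ reps a n xs

    reps-∷ : ∀ a n xs → reps a n (a ∷ xs) ≡ a ∷ reps a n xs
    reps-∷ a zero    xs = refl
    reps-∷ a (suc n) xs = cong (a ∷_) (reps-∷ a n xs)

    reps-ʳ++ : ∀ a n xs ys → reps a n xs ʳ++ ys ≡ xs ʳ++ reps a n ys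
    reps-ʳ++ a zero    xs ys = refl
    reps-ʳ++ a (suc n) xs ys = trans (reps-ʳ++ a n xs (a ∷ ys)) (cong (xs ʳ++_) (reps-∷ a n ys))

    length-reps : ∀ a n xs → length (reps a n xs) ≡ n + length xs
    length-reps a zero    xs = refl
    length-reps a (suc n) xs = cong suc (length-reps a n xs)

    -- The height is in unary before the symbol carrying the mark, so this symbol also ends the
    -- block: passing a block means skipping ticks and moving one symbol.
    blk : Block → List Elem → List Elem
    blk (r , y) xs = reps tk y (sp r ∷ xs)

    table : ∀ {n} → Vec Block n → List Elem
    table []      = []
    table (b ∷ σ) = blk b (table σ)

    size′ : ∀ {n} → Vec Block n → ℕ
    size′ σ = length (table σ)

    n≤size : ∀ {n} (σ : Vec Block n) → n ≤ size′ σ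
    n≤size []            = z≤n
    n≤size ((r , y) ∷ σ) rewrite length-reps tk y (sp r ∷ table σ) = ≤-trans (s≤s (n≤size σ)) (m≤n+m _ y)

    size-modify : ∀ {n} (σ : Vec Block n) x u → size′ (σ [ x ]%= modify u) ≤ suc (size′ σ)
    size-modify ((r , y) ∷ σ) zero (just e)
      rewrite length-reps tk y (sp (just e) ∷ table σ) | length-reps tk y (sp r ∷ table σ) = n≤1+n _
    size-modify ((r , y) ∷ σ) zero nothing = ≤-refl
    size-modify ((r , y) ∷ σ) (suc x) u
      rewrite length-reps tk y (sp r ∷ table (σ [ x ]%= modify u)) | length-reps tk y (sp r ∷ table σ) | sym (+-suc y (suc (size′ σ))) =
      +-monoʳ-≤ y (s≤s (size-modify σ x u))

    left-of : ∀ {n} → Vec Block n → Fin n → List Elem → List Elem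
    left-of (b ∷ σ)       zero    e = e
    left-of ((r , y) ∷ σ) (suc x) e = left-of σ x (sp r ∷ reps tk y e)

    right-of : ∀ {n} → Vec Block n → Fin n → List Elem
    right-of (b ∷ σ) zero    = table σ
    right-of (b ∷ σ) (suc x) = right-of σ x

    join-update : ∀ {n} (σ : Vec Block n) x e f →
                  left-of σ x e ʳ++ blk (f (lookup σ x)) (right-of σ x) ≡ e ʳ++ table (σ [ x ]%= f)
    join-update (b ∷ σ)       zero    e f = refl
    join-update ((r , y) ∷ σ) (suc x) e f = trans (join-update σ x (sp r ∷ reps tk y e) f) (reps-ʳ++ tk y e _)

    join-table : ∀ {n} (σ : Vec Block n) x e → left-of σ x e ʳ++ blk (lookup σ x) (right-of σ x) ≡ e ʳ++ table σ
    join-table (b ∷ σ)       zero    e = refl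
    join-table ((r , y) ∷ σ) (suc x) e = trans (join-table σ x (sp r ∷ reps tk y e)) (reps-ʳ++ tk y e _)

    nop : Prog
    nop = prim (λ _ → Vec.replicate 11 keep)

    mv : Fin 11 → Fin 11 → Prog
    mv a b = prim (λ ts → maybe′ (λ x → (Vec.replicate 11 keep [ a ]≔ remove) [ b ]≔ push x) (Vec.replicate 11 keep) (lookup ts a))

    top : Fin 11 → (Elem → Bool) → Tops → Bool
    top a p ts = maybe′ p false (lookup ts a)

    isOne isTick some : Elem → Bool
    isOne one = true
    isOne _   = false
    isTick tk = true
    isTick _  = false
    some _ = true

    drain : Fin 11 → Fin 11 → Prog
    drain a b = while (top a some) (mv a b)

    _▸_ : ∀ {p s s′ s″ c} → Run p s s′ c → s′ ≡ s″ → Run p s s″ c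
    r ▸ refl = r

    infixl 2 _▸_

    primTo : ∀ {f s s′} → Vec.zipWith apply (f (tops s)) s ≡ s′ → Run (prim f) s s′ 2
    primTo refl = prim

    drain-E : ∀ E {S} → length E ≤ S → ∀ {I J D C C′ G F P Q Q′} →
              Run (drain 3F 2F) (st I J D E C C′ G F P Q Q′) (st I J (E ʳ++ D) [] C C′ G F P Q Q′) (S * 3 + 1)
    drain-E E le = within (+-monoˡ-≤ 1 (*-monoˡ-≤ 3 le)) (go E)
      where
      go : ∀ E {I J D C C′ G F P Q Q′} →
           Run (drain 3F 2F) (st I J D E C C′ G F P Q Q′) (st I J (E ʳ++ D) [] C C′ G F P Q Q′) (length E * 3 + 1)
      go []      = stop refl
      go (x ∷ E) = again refl prim (go E)

    drain-J : ∀ J {I D E C C′ G F P Q Q′} → Run (drain 1F 0F) (st I J D E C C′ G F P Q Q′) (st (J ʳ++ I) [] D E C C′ G F P Q Q′) (length J * 3 + 1)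
    drain-J []      = stop refl
    drain-J (x ∷ J) = again refl prim (drain-J J)

    drain-C′ : ∀ C′ {I J D E C G F P Q Q′} → Run (drain 5F 4F) (st I J D E C C′ G F P Q Q′) (st I J D E (C′ ʳ++ C) [] G F P Q Q′) (length C′ * 3 + 1)
    drain-C′ []       = stop refl
    drain-C′ (x ∷ C′) = again refl prim (drain-C′ C′)

    skip : Prog
    skip = while (top 2F isTick) (mv 2F 3F)

    -- Each stroke of the unary name on the input passes one block of the table.
    seek : Prog
    seek = while (top 0F isOne) (mv 0F 1F ⨾ skip ⨾ mv 2F 3F) ⨾ mv 0F 1F

    skip-run : ∀ y {I J r D E C C′ G F P Q Q′} →
               Run skip (st I J (reps tk y (sp r ∷ D)) E C C′ G F P Q Q′) (st I J (sp r ∷ D) (reps tk y E) C C′ G F P Q Q′) (y * 3 + 1)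
    skip-run zero    = stop refl
    skip-run (suc y) {I} {J} {r} {D} {E} {C} {C′} {G} {F} {P} {Q} {Q′} = again refl prim
      (skip-run y ▸ cong (λ E′ → st I J (sp r ∷ D) E′ C C′ G F P Q Q′) (reps-∷ tk y E))

    name : ℕ → List Elem → List Elem
    name x I = reps one x (nul ∷ I)

    -- The names eman, seman and edoc are the reversals of name, names and code, as found on the stack of
    -- read input.
    eman : ℕ → List Elem → List Elem
    eman x J = nul ∷ reps one x J

    seek-cost : ℕ → ℕ
    seek-cost S = (S * 6 + 1) + 2

    seek-run : ∀ {n} (σ : Vec Block n) x {S} → size′ σ ≤ S → ∀ {I J E C C′ G F P Q Q′} →
               Run seek (st (name (toℕ x) I) J (table σ) E C C′ G F P Q Q′)
                        (st I (eman (toℕ x) J) (blk (lookup σ x) (right-of σ x)) (left-of σ x E) C C′ G F P Q Q′) (seek-cost S)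
    seek-run σ x le = within (+-monoˡ-≤ 1 (*-monoˡ-≤ 6 le)) (go σ x) ⨾ prim
      where
      -- Passing a block of `y + 1` symbols takes `3y + 6` steps, hence at most 6 per symbol.
      cost : ∀ y s → (y + suc s) * 6 + 1 ≡ suc (2 + ((y * 3 + 1) + 2)) + (s * 6 + 1) + y * 3
      cost = solve-∀
      go : ∀ {n} (σ : Vec Block n) x {I J E C C′ G F P Q Q′} →
           Run (while (top 0F isOne) (mv 0F 1F ⨾ skip ⨾ mv 2F 3F)) (st (name (toℕ x) I) J (table σ) E C C′ G F P Q Q′)
               (st (nul ∷ I) (reps one (toℕ x) J) (blk (lookup σ x) (right-of σ x)) (left-of σ x E) C C′ G F P Q Q′) (size′ σ * 6 + 1)
      go (b ∷ σ) zero = within (m≤n+m 1 _) (stop refl)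
      go ((r , y) ∷ σ) (suc x) {I} {J} {E} {C} {C′} {G} {F} {P} {Q} {Q′} rewrite length-reps tk y (sp r ∷ table σ) =
        within (≤-by (y * 3) (cost y (size′ σ)))
          (again refl (prim ⨾ skip-run y ⨾ prim)
            (go σ x ▸ cong (λ J′ → st (nul ∷ I) J′ (blk (lookup σ x) (right-of σ x)) (left-of σ x (sp r ∷ reps tk y E)) C C′ G F P Q Q′)
                           (reps-∷ one (toℕ x) J)))

    read-cost write-cost : ℕ → ℕ
    read-cost S  = seek-cost S + ((S * 3 + 1) + (2 + ((S * 3 + 1) + (S * 3 + 1))))
    write-cost S = seek-cost S + ((S * 3 + 1) + (2 + (S * 3 + 1)))

    module _ (i : Fin m) where

      open Columns {ar i}

      colE : Column → Elem
      colE c = inj₂ (col (pack cols i c))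

      colOf : Maybe Elem → Column
      colOf (just (inj₂ (col w))) = unpack cols i w
      colOf _                     = Vec.replicate (ar i) false

      regE : Reg i → Elem
      regE r = inj₂ (reg (pack regs i r))

      regOf : Maybe Elem → Reg i
      regOf (just (inj₂ (reg w))) = unpack regs i w
      regOf _                     = emptyReg i

      markOf : Maybe Elem → Maybe (Fin d)
      markOf (just (sp r)) = r
      markOf _             = nothing

      copy-step : Fin (ar i) → Tops → Vec Op 11
      copy-step j ts = keep ∷ keep ∷ remove ∷ push tk ∷ remove ∷ push (colE (colOf (lookup ts 4F) [ j ]≔ true)) ∷
                       keep ∷ keep ∷ keep ∷ keep ∷ keep ∷ []

      copy : Fin (ar i) → Prog
      copy j = while (top 2F isTick) (prim (copy-step j))

      -- How the columns end up divided between the two stacks depends on which of the heights is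
      -- larger; only their rejoined list matters, together with the size of the part to be drained
      -- back.
      copy-run : ∀ j y cs {I J r D E V G F P Q Q′} → ∃[ U ] ∃[ W ]
                 Run (copy j) (st I J (reps tk y (sp r ∷ D)) E (map colE cs) V G F P Q Q′)
                              (st I J (sp r ∷ D) (reps tk y E) U W G F P Q Q′) (y * 3 + 1) ×
                 W ʳ++ U ≡ V ʳ++ map colE (raise-track j y cs) × length W ≡ y + length V
      copy-run j zero cs = _ , _ , stop refl , refl , refl
      copy-run j (suc y) [] {I} {J} {r} {D} {E} {V} {G} {F} {P} {Q} {Q′}
        with U , W , run , eq , len ← copy-run j y [] {I} {J} {r} {D} {tk ∷ E} {colE (Vec.replicate (ar i) false [ j ]≔ true) ∷ V} {G} {F} {P} {Q} {Q′} =
        U , W , again refl prim (run ▸ cong (λ E′ → st I J (sp r ∷ D) E′ U W G F P Q Q′) (reps-∷ tk y E)) ,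
        eq , trans len (+-suc y (length V))
      copy-run j (suc y) (c ∷ cs) {I} {J} {r} {D} {E} {V} {G} {F} {P} {Q} {Q′}
        with U , W , run , eq , len ← copy-run j y cs {I} {J} {r} {D} {tk ∷ E} {colE (c [ j ]≔ true) ∷ V} {G} {F} {P} {Q} {Q′} =
        U , W , again refl (primTo (cong (λ z → st I J (reps tk y (sp r ∷ D)) (tk ∷ E) (map colE cs) (colE (z [ j ]≔ true) ∷ V) G F P Q Q′) (unpack-pack cols i c)))
                  (run ▸ cong (λ E′ → st I J (sp r ∷ D) E′ U W G F P Q Q′) (reps-∷ tk y E)) ,
        eq , trans len (+-suc y (length V))

      onReg : (Tops → Reg i → Reg i) → Prog
      onReg f = prim λ ts → keep ∷ keep ∷ keep ∷ keep ∷ keep ∷ keep ∷ put (regE (f ts (regOf (lookup ts 6F)))) ∷ keep ∷ keep ∷ keep ∷ keep ∷ []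

      store-mark : Fin (ar i) → Tops → Reg i → Reg i
      store-mark j ts (ms , x) = ms [ j ]≔ markOf (lookup ts 2F) , x

      read-name : Fin (ar i) → Prog
      read-name j = seek ⨾ copy j ⨾ onReg (store-mark j) ⨾ drain 3F 2F ⨾ drain 5F 4F

      read : List (Fin (ar i)) → Prog
      read []       = nop
      read (j ∷ js) = read-name j ⨾ read js

      module _ {n : ℕ} (xs : Vec (Fin n) (ar i)) where

        names : List (Fin (ar i)) → List Elem → List Elem
        names js I = foldr (λ j → name (toℕ (lookup xs j))) I js

        seman : List (Fin (ar i)) → List Elem → List Elem
        seman js J = foldl (λ J j → eman (toℕ (lookup xs j)) J) J js

        module _ (σ : Vec Block n) {S} (σ≤S : size′ σ ≤ S) where

          left-size : ∀ x → length (reps tk (height σ x) (left-of σ x [])) ≤ S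
          left-size x = ≤-trans (≤-trans (m≤m+n _ _) (≤-reflexive (trans
            (sym (List.length-ʳ++ (reps tk (height σ x) (left-of σ x [])) {sp (mark σ x) ∷ right-of σ x}))
            (cong length (trans (reps-ʳ++ tk (height σ x) (left-of σ x []) _) (join-table σ x [])))))) σ≤S

          height-size : ∀ x → height σ x ≤ S
          height-size x = ≤-trans (≤-trans (m≤m+n _ _) (≤-reflexive (sym (length-reps tk (height σ x) (left-of σ x []))))) (left-size x)

          read-name-run : ∀ j cs ms x {I J F P Q Q′} → let v = lookup xs j in
            Run (read-name j) (st (name (toℕ v) I) J (table σ) [] (map colE cs) [] (regE (ms , x) ∷ []) F P Q Q′)
                (st I (eman (toℕ v) J) (table σ) [] (map colE (raise-track j (height σ v) cs)) [] (regE (ms [ j ]≔ mark σ v , x) ∷ []) F P Q Q′)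
                (read-cost S)
          read-name-run j cs ms x {I} {J} {F} {P} {Q} {Q′}
            with U , W , run , eq , len ← copy-run j (height σ (lookup xs j)) cs
                   {I} {eman (toℕ (lookup xs j)) J} {mark σ (lookup xs j)} {right-of σ (lookup xs j)} {left-of σ (lookup xs j) []} {[]} {regE (ms , x) ∷ []} {F} {P} {Q} {Q′} =
            seek-run σ v σ≤S ⨾
            within (+-monoˡ-≤ 1 (*-monoˡ-≤ 3 (height-size v))) run ⨾
            primTo (cong (λ z → st I (eman (toℕ v) J) (sp (mark σ v) ∷ right-of σ v) (reps tk (height σ v) (left-of σ v [])) U W
                                   (regE (proj₁ z [ j ]≔ mark σ v , proj₂ z) ∷ []) F P Q Q′) (unpack-pack regs i (ms , x))) ⨾
            (drain-E (reps tk (height σ v) (left-of σ v [])) (left-size v) ▸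
              cong (λ D → st I (eman (toℕ v) J) D [] U W (regE (ms [ j ]≔ mark σ v , x) ∷ []) F P Q Q′)
                   (trans (reps-ʳ++ tk (height σ v) (left-of σ v []) _) (join-table σ v []))) ⨾
            within (+-monoˡ-≤ 1 (*-monoˡ-≤ 3 (≤-trans (≤-reflexive (trans len (+-identityʳ _))) (height-size v))))
              (drain-C′ W ▸ cong (λ C → st I (eman (toℕ v) J) (table σ) [] C [] (regE (ms [ j ]≔ mark σ v , x) ∷ []) F P Q Q′) eq)
            where v = lookup xs j

          read-run : ∀ js cs ms x {I J F P Q Q′} →
            Run (read js) (st (names js I) J (table σ) [] (map colE cs) [] (regE (ms , x) ∷ []) F P Q Q′)
                (st I (seman js J) (table σ) [] (map colE (collect (height σ ∘ lookup xs) cs js)) [] (regE (record-all (mark σ ∘ lookup xs) ms js , x) ∷ []) F P Q Q′)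
                (length js * read-cost S + 2)
          read-run []       cs ms x = prim
          read-run (j ∷ js) cs ms x = within (≤-reflexive (sym (+-assoc (read-cost S) _ 2)))
            (read-name-run j cs ms x ⨾ read-run js _ _ x)

          collect-length : ∀ js cs → length (collect (height σ ∘ lookup xs) cs js) ≤ length js * S + length cs
          collect-length []       cs = ≤-refl
          collect-length (j ∷ js) cs = ≤-trans (collect-length js _)
            (≤-trans (+-monoʳ-≤ (length js * S) (≤-trans (raise-track-length j (height σ (lookup xs j)) cs) (+-monoˡ-≤ (length cs) (height-size (lookup xs j)))))
                     (≤-reflexive (eqn (length js) S (length cs))))
            where
            eqn : ∀ l S c → l * S + (S + c) ≡ (S + l * S) + c
            eqn = solve-∀

      count-step : Tops → Vec Op 11
      count-step ts = keep ∷ keep ∷ keep ∷ keep ∷ remove ∷ keep ∷ put (regE (f (regOf (lookup ts 6F)))) ∷ keep ∷ keep ∷ keep ∷ keep ∷ []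
        where
        f : Reg i → Reg i
        f (ms , x , r) = ms , count x (colOf (lookup ts 4F)) , r

      counting : Prog
      counting = while (top 4F some) (prim count-step)

      counting-run : ∀ cs ms x r {I J D E C′ F P Q Q′} →
        Run counting (st I J D E (map colE cs) C′ (regE (ms , x , r) ∷ []) F P Q Q′)
                     (st I J D E [] C′ (regE (ms , foldl count x cs , r) ∷ []) F P Q Q′) (length cs * 3 + 1)
      counting-run [] ms x r = stop refl
      counting-run (c ∷ cs) ms x r {I} {J} {D} {E} {C′} {F} {P} {Q} {Q′} =
        again refl (primTo (cong₂ (λ z w → st I J D E (map colE cs) C′ (regE (proj₁ z , count (proj₁ (proj₂ z)) w , proj₂ (proj₂ z)) ∷ []) F P Q Q′)
                                  (unpack-pack regs i (ms , x , r)) (unpack-pack cols i c)))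
          (counting-run cs ms (count x c) r)

      flagOf : Maybe Elem → Bool
      flagOf (just (inj₁ f)) = f
      flagOf _               = false

      response : Phase → Bool → Reg i → Maybe (Action d (ar i))
      response ph f (ms , x , _) = if f then nothing else rule ph i ms x

      decide : Phase → Prog
      decide ph = prim λ ts → step (flagOf (lookup ts 7F)) (regOf (lookup ts 6F))
        where
        step : Bool → Reg i → Vec Op 11
        step f r = keep ∷ keep ∷ keep ∷ keep ∷ keep ∷ keep ∷ put (regE (proj₁ r , proj₁ (proj₂ r) , response ph f r)) ∷
                   put (inj₁ (f ∨ is-just (response ph f r))) ∷ keep ∷ keep ∷ keep ∷ []

      decide-run : ∀ ph f r {I J D E C C′ P Q Q′} →
        Run (decide ph) (st I J D E C C′ (regE r ∷ []) (inj₁ f ∷ []) P Q Q′)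
            (st I J D E C C′ (regE (proj₁ r , proj₁ (proj₂ r) , response ph f r) ∷ []) (inj₁ (f ∨ is-just (response ph f r)) ∷ []) P Q Q′) 2
      decide-run ph f r {I} {J} {D} {E} {C} {C′} {P} {Q} {Q′} =
        primTo (cong (λ r → st I J D E C C′ (regE (proj₁ r , proj₁ (proj₂ r) , response ph f r) ∷ [])
                              (inj₁ (f ∨ is-just (response ph f r)) ∷ []) P Q Q′) (unpack-pack regs i r))

      -- The first move takes the closing `nul` of the name; the loop then stops at the closing
      -- `nul` of the preceding word.
      back-name : Prog
      back-name = mv 1F 0F ⨾ while (top 1F isOne) (mv 1F 0F)

      back : List (Fin (ar i)) → Prog
      back []       = nop
      back (j ∷ js) = back js ⨾ back-name

      back-name-run : ∀ x {I J D E C C′ G F P Q Q′} →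
        Run back-name (st I (eman x (nul ∷ J)) D E C C′ G F P Q Q′) (st (name x I) (nul ∷ J) D E C C′ G F P Q Q′) (2 + (x * 3 + 1))
      back-name-run x = prim ⨾ go x
        where
        go : ∀ x {I J D E C C′ G F P Q Q′} →
             Run (while (top 1F isOne) (mv 1F 0F)) (st I (reps one x (nul ∷ J)) D E C C′ G F P Q Q′) (st (reps one x I) (nul ∷ J) D E C C′ G F P Q Q′) (x * 3 + 1)
        go zero = stop refl
        go (suc x) {I} {J} {D} {E} {C} {C′} {G} {F} {P} {Q} {Q′} =
          again refl prim (go x ▸ cong (λ I′ → st I′ (nul ∷ J) D E C C′ G F P Q Q′) (reps-∷ one x I))

      back-run : ∀ {n} (xs : Vec (Fin n) (ar i)) {S} → n ≤ S → ∀ js {I J D E C C′ G F P Q Q′} →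
        Run (back js) (st I (seman xs js (nul ∷ J)) D E C C′ G F P Q Q′) (st (names xs js I) (nul ∷ J) D E C C′ G F P Q Q′)
            (length js * (2 + (S * 3 + 1)) + 2)
      back-run xs n≤S [] = prim
      back-run xs {S} n≤S (j ∷ js) = within (≤-reflexive (eqn (length js * (2 + (S * 3 + 1))) (2 + (S * 3 + 1))))
        (back-run xs n≤S js ⨾ within (+-monoʳ-≤ 2 (+-monoˡ-≤ 1 (*-monoˡ-≤ 3 (≤-trans (<⇒≤ (Fin.toℕ<n (lookup xs j))) n≤S)))) (back-name-run (toℕ (lookup xs j))))
        where
        eqn : ∀ a b → (a + 2) + b ≡ (b + a) + 2
        eqn = solve-∀

      -- `perform` as the write pass carries it out: the action waits in the register until its
      -- position comes up and is then cleared.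
      strike : ∀ {n} → Maybe (Action d (ar i)) → Fin (ar i) → Fin n → Vec Block n → Vec Block n × Maybe (Action d (ar i))
      strike (just (just (j′ , u))) j x σ with j′ Fin.≟ j
      ... | yes _ = σ [ x ]%= modify u , nothing
      ... | no _  = σ , just (just (j′ , u))
      strike r j x σ = σ , r

      write-step : Maybe (Action d (ar i)) → Fin (ar i) → Reg i → Vec Op 11
      write-step (just (just (j′ , u))) j (ms , x , _) with j′ Fin.≟ j
      ... | no _  = Vec.replicate 11 keep
      ... | yes _ = ops u
        where
        ops : Maybe (Fin d) → Vec Op 11
        ops (just e) = keep ∷ keep ∷ put (sp (just e)) ∷ keep ∷ keep ∷ keep ∷ put (regE (ms , x , nothing)) ∷ keep ∷ keep ∷ keep ∷ keep ∷ []
        ops nothing  = keep ∷ keep ∷ keep ∷ push tk ∷ keep ∷ keep ∷ put (regE (ms , x , nothing)) ∷ keep ∷ keep ∷ keep ∷ keep ∷ []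
      write-step _ j _ = Vec.replicate 11 keep

      writeP : Fin (ar i) → Prog
      writeP j = prim λ ts → let r = regOf (lookup ts 6F) in write-step (proj₂ (proj₂ r)) j r

      write-name : Fin (ar i) → Prog
      write-name j = seek ⨾ skip ⨾ writeP j ⨾ drain 3F 2F

      write : List (Fin (ar i)) → Prog
      write []       = nop
      write (j ∷ js) = write-name j ⨾ write js

      -- Space reserved for the one tick that an action not yet carried out may add to the table.
      pending : Maybe (Action d (ar i)) → ℕ
      pending (just (just _)) = 1
      pending _               = 0

      strike-size : ∀ {n} r j x (σ : Vec Block n) → size′ (proj₁ (strike r j x σ)) + pending (proj₂ (strike r j x σ)) ≤ size′ σ + pending r
      strike-size (just (just (j′ , u))) j x σ with j′ Fin.≟ j
      ... | yes _ = subst₂ _≤_ (sym (+-identityʳ _)) (+-comm 1 _) (size-modify σ x u)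
      ... | no _  = ≤-refl
      strike-size (just nothing) j x σ = ≤-refl
      strike-size nothing        j x σ = ≤-refl

      write-effect : ∀ {n} (σ : Vec Block n) x j ms y r {I J C C′ F P Q Q′} → ∃[ D ] ∃[ E ]
        Run (writeP j) (st I J (sp (mark σ x) ∷ right-of σ x) (reps tk (height σ x) (left-of σ x [])) C C′ (regE (ms , y , r) ∷ []) F P Q Q′)
                      (st I J D E C C′ (regE (ms , y , proj₂ (strike r j x σ)) ∷ []) F P Q Q′) 2 ×
        E ʳ++ D ≡ table (proj₁ (strike r j x σ))
      write-effect σ x j ms y r {I} {J} {C} {C′} {F} {P} {Q} {Q′} = go r
        where
        D₀ = sp (mark σ x) ∷ right-of σ x
        E₀ = reps tk (height σ x) (left-of σ x [])
        E₀D₀ : E₀ ʳ++ D₀ ≡ table σ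
        E₀D₀ = trans (reps-ʳ++ tk (height σ x) (left-of σ x []) _) (join-table σ x [])
        s : Maybe (Action d (ar i)) → Store
        s r = st I J D₀ E₀ C C′ (regE (ms , y , r) ∷ []) F P Q Q′
        run : ∀ r {s′} → Vec.zipWith apply (write-step r j (ms , y , r)) (s r) ≡ s′ → Run (writeP j) (s r) s′ 2
        run r eqn = primTo (trans (cong (λ z → Vec.zipWith apply (write-step (proj₂ (proj₂ z)) j z) (s r)) (unpack-pack regs i (ms , y , r))) eqn)
        go : ∀ r → ∃[ D ] ∃[ E ]
          Run (writeP j) (s r) (st I J D E C C′ (regE (ms , y , proj₂ (strike r j x σ)) ∷ []) F P Q Q′) 2 × E ʳ++ D ≡ table (proj₁ (strike r j x σ))
        go nothing        = D₀ , E₀ , run nothing refl , E₀D₀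
        go (just nothing) = D₀ , E₀ , run (just nothing) refl , E₀D₀
        go (just (just (j′ , u))) with j′ Fin.≟ j | run (just (just (j′ , u)))
        ... | no _ | run′ = D₀ , E₀ , run′ refl , E₀D₀
        go (just (just (j′ , just e))) | yes _ | run′ =
          sp (just e) ∷ right-of σ x , E₀ , run′ refl ,
          trans (reps-ʳ++ tk (height σ x) (left-of σ x []) _) (join-update σ x [] (modify (just e)))
        go (just (just (j′ , nothing))) | yes _ | run′ =
          D₀ , tk ∷ E₀ , run′ refl ,
          trans (reps-ʳ++ tk (suc (height σ x)) (left-of σ x []) _) (join-update σ x [] (modify nothing))

      module _ {n : ℕ} (xs : Vec (Fin n) (ar i)) where

        strikes : List (Fin (ar i)) → Vec Block n × Maybe (Action d (ar i)) → Vec Block n × Maybe (Action d (ar i))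
        strikes []       p       = p
        strikes (j ∷ js) (σ , r) = strikes js (strike r j (lookup xs j) σ)

        strikes-done : ∀ js r σ → pending r ≡ 0 → strikes js (σ , r) ≡ (σ , r)
        strikes-done []       r σ e = refl
        strikes-done (j ∷ js) nothing        σ e = strikes-done js nothing σ e
        strikes-done (j ∷ js) (just nothing) σ e = strikes-done js (just nothing) σ e

        strikes-perform : ∀ js r σ → (∀ j u → r ≡ just (just (j , u)) → j ∈ js) → proj₁ (strikes js (σ , r)) ≡ perform xs r σ
        strikes-perform js nothing        σ h = cong proj₁ (strikes-done js nothing σ refl)
        strikes-perform js (just nothing) σ h = cong proj₁ (strikes-done js (just nothing) σ refl)
        strikes-perform [] (just (just (j′ , u))) σ h with () ← h j′ u refl
        strikes-perform (j ∷ js) (just (just (j′ , u))) σ h with j′ Fin.≟ j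
        ... | yes refl = cong proj₁ (strikes-done js nothing (σ [ lookup xs j ]%= modify u) refl)
        ... | no j′≢j  = strikes-perform js (just (just (j′ , u))) σ λ { _ _ refl → go (h j′ u refl) }
          where
          go : j′ ∈ j ∷ js → j′ ∈ js
          go (here p)  = contradiction p j′≢j
          go (there p) = p

        write-run : ∀ js σ r {S} → size′ σ + pending r ≤ S → ∀ ms y {I J F P Q Q′} →
          Run (write js) (st (names xs js I) J (table σ) [] [] [] (regE (ms , y , r) ∷ []) F P Q Q′)
              (st I (seman xs js J) (table (proj₁ (strikes js (σ , r)))) [] [] [] (regE (ms , y , proj₂ (strikes js (σ , r))) ∷ []) F P Q Q′)
              (length js * write-cost S + 2)
        write-run [] σ r le ms y = prim
        write-run (j ∷ js) σ r {S} le ms y {I} {J} {F} {P} {Q} {Q′}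
          with D , E , run , eq ← write-effect σ (lookup xs j) j ms y r {names xs js I} {eman (toℕ (lookup xs j)) J} {[]} {[]} {F} {P} {Q} {Q′} =
          within (≤-reflexive (sym (+-assoc (write-cost S) _ 2)))
            ((seek-run σ v σ≤S ⨾
              within (+-monoˡ-≤ 1 (*-monoˡ-≤ 3 (height-size xs σ σ≤S v))) (skip-run (height σ v)) ⨾
              run ⨾
              (drain-E E E≤S ▸ cong (λ D → st (names xs js I) (eman (toℕ v) J) D [] [] [] (regE (ms , y , proj₂ (strike r j v σ)) ∷ []) F P Q Q′) eq)) ⨾
             write-run js (proj₁ (strike r j v σ)) (proj₂ (strike r j v σ)) σ′≤S ms y)
          where
          v = lookup xs j
          σ≤S : size′ σ ≤ S
          σ≤S = ≤-trans (m≤m+n _ _) le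
          σ′≤S : size′ (proj₁ (strike r j v σ)) + pending (proj₂ (strike r j v σ)) ≤ S
          σ′≤S = ≤-trans (strike-size r j v σ) le
          E≤S : length E ≤ S
          E≤S = ≤-trans (m≤m+n _ (length D)) (≤-trans (≤-reflexive (trans (sym (List.length-ʳ++ E)) (cong length eq)))
                  (≤-trans (m≤m+n _ _) σ′≤S))

-- The main loop, its clocks and its running time.

module Decision where

  open import Defs using (run; initial; TuringMachine)
  open Codes
  open StackMachines
  open Tameness using (Tame; bounded)
  open LocalRules
  open Descent
  open ColumnCounting
  open Programs
  open import Data.Fin.Patterns
  open import Data.Integer.Base using (ℤ; +_)
  open import Data.List.Base using (foldl; foldr; length; _ʳ++_; _++_; allFin; map)
  open import Data.Nat.Base using (_+_; _*_; _≤_; z≤n; s≤s; NonZero)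
  open import Data.Nat.Properties
  open import Data.Vec.Base as Vec using (_[_]≔_)

  module Decider {d : ℕ} .{{_ : NonZero d}} {m : ℕ} (ar : Fin m → ℕ)
                 (R : ∀ i → (Fin (ar i) → ℤ) → Set) (T : ∀ i → Tame d (R i)) where

    open Algorithm ar R T
    open Program ar R T

    arity-bound : ∃[ a ] ∀ i → ar i ≤ a
    arity-bound with a , le ← bounded (λ i → + ar i) = a , le

    a : ℕ
    a = proj₁ arity-bound

    -- As only one rule fires per iteration, the table grows by at most one symbol, and only while
    -- the flag is unset.
    room : Bool → ℕ
    room f = if f then 0 else 1

    -- The names are needed twice, to read the blocks and to change one of them; hence the rewinding
    -- by `back` in between.
    handle : Phase → Fin m → Prog
    handle ph i = prim (λ _ → Vec.replicate 11 keep [ 6F ]≔ push (regE i (emptyReg i))) ⨾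
      read i (allFin (ar i)) ⨾ counting i ⨾ decide i ph ⨾ back i (allFin (ar i)) ⨾ write i (allFin (ar i)) ⨾
      prim (λ _ → Vec.replicate 11 keep [ 6F ]≔ remove)

    handle-cost : ℕ → ℕ
    handle-cost S = 2 + ((a * read-cost S + 2) + ((a * S * 3 + 1) + (2 + ((a * (2 + (S * 3 + 1)) + 2) + ((a * write-cost S + 2) + 2)))))

    module _ {n : ℕ} where

      visit-size : ∀ ph σ f (c : Constraint {n}) →
        size′ (proj₁ (visit ph (σ , f) c)) + room (proj₂ (visit ph (σ , f) c)) ≤ size′ σ + room f
      visit-size ph σ true  c = ≤-refl
      visit-size ph σ false c with react ph σ c
      ... | nothing = ≤-refl
      ... | just nothing = +-monoʳ-≤ (size′ σ) z≤n
      ... | just (just (j , u)) = subst₂ _≤_ (sym (+-identityʳ _)) (+-comm 1 _) (size-modify σ (lookup (proj₂ c) j) u)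

      sweep-size : ∀ ph cs s → size′ (proj₁ (sweep {n} ph cs s)) + room (proj₂ (sweep ph cs s)) ≤ size′ (proj₁ s) + room (proj₂ s)
      sweep-size ph []       s       = ≤-refl
      sweep-size ph (c ∷ cs) (σ , f) = ≤-trans (sweep-size ph cs (visit ph (σ , f) c)) (visit-size ph σ f c)

      iter-size : ∀ cs (σ : State {n}) → size′ (proj₁ (iter cs σ)) ≤ suc (size′ σ)
      iter-size cs σ = ≤-trans (m≤m+n _ _) (≤-trans (sweep-size correct cs _) (≤-trans (sweep-size guess cs _)
        (≤-trans (sweep-size force cs (σ , false)) (≤-reflexive (+-comm _ 1)))))

      handle-run : ∀ ph i (xs : Vec (Fin n) (ar i)) σ f {S} → size′ σ + room f ≤ S → ∀ {I J P Q Q′} →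
        Run (handle ph i) (st (names i xs (allFin (ar i)) I) (inj₁ false ∷ J) (table σ) [] [] [] [] (inj₁ f ∷ []) P Q Q′)
            (st I (seman i xs (allFin (ar i)) (inj₁ false ∷ J)) (table (proj₁ (visit ph (σ , f) (i , xs)))) [] [] [] [] (inj₁ (proj₂ (visit ph (σ , f) (i , xs))) ∷ []) P Q Q′)
            (handle-cost S)
      handle-run ph i xs σ f {S} le {I} {J} {P} {Q} {Q′} =
        prim ⨾
        within (+-monoˡ-≤ 2 (*-monoˡ-≤ (read-cost S) len))
          (read-run i xs σ σ≤S (allFin (ar i)) [] ms₀ (m₀ , nothing) ▸
            cong (λ ms → st I J₁ (table σ) [] (map (colE i) cs) [] (regE i (ms , m₀ , nothing) ∷ []) (inj₁ f ∷ []) P Q Q′)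
                 (Columns.record-all-map (mark σ) xs ms₀)) ⨾
        within (+-monoˡ-≤ 1 (*-monoˡ-≤ 3 cs≤))
          (counting-run i cs ms m₀ nothing ▸
            cong (λ x → st I J₁ (table σ) [] [] [] (regE i (ms , x , nothing) ∷ []) (inj₁ f ∷ []) P Q Q′) (Columns.count-matrix cs η cs-ok)) ⨾
        decide-run i ph f (ms , x , nothing) ⨾
        within (+-monoˡ-≤ 2 (*-monoˡ-≤ (2 + (S * 3 + 1)) len)) (back-run i xs (≤-trans (n≤size σ) σ≤S) (allFin (ar i))) ⨾
        within (+-monoˡ-≤ 2 (*-monoˡ-≤ (write-cost S) len))
          (write-run i xs (allFin (ar i)) σ r (≤-trans (+-monoʳ-≤ (size′ σ) (pending≤ f (rule ph i ms x))) le) ms x ▸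
            cong (λ σ′ → st I J₁ (table σ′) [] [] [] (regE i (ms , x , proj₂ (strikes i xs (allFin (ar i)) (σ , r))) ∷ []) (inj₁ (f ∨ is-just r) ∷ []) P Q Q′)
                 (strikes-perform i xs (allFin (ar i)) r σ (λ j _ _ → ∈-allFin j))) ⨾
        prim
        where
        J₁ = seman i xs (allFin (ar i)) (inj₁ false ∷ J)
        ms₀ = Vec.replicate (ar i) nothing
        m₀ = Vec.replicate (ar i) (Vec.replicate (ar i) zero)
        η = height σ ∘ lookup xs
        cs = Columns.collect η [] (allFin (ar i))
        cs-ok : Columns.Cols cs η
        cs-ok = Columns.Cols-collect η (allFin (ar i)) [] (λ _ → 0) (λ _ → refl) (λ j → inj₂ (refl , ∈-allFin j))
        ms = Vec.map (mark σ) xs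
        x = matrix (res i) η
        r = response i ph f (ms , x , nothing)
        σ≤S : size′ σ ≤ S
        σ≤S = ≤-trans (m≤m+n _ _) le
        len : length (allFin (ar i)) ≤ a
        len = ≤-trans (≤-reflexive (List.length-tabulate id)) (proj₂ arity-bound i)
        cs≤ : length cs ≤ a * S
        cs≤ = ≤-trans (collect-length i xs σ σ≤S (allFin (ar i)) []) (≤-trans (≤-reflexive (+-identityʳ _)) (*-monoˡ-≤ S len))
        pending≤ : ∀ f r → pending i (if f then nothing else r) ≤ room f
        pending≤ true  r               = z≤n
        pending≤ false nothing         = z≤n
        pending≤ false (just nothing)  = z≤n
        pending≤ false (just (just _)) = ≤-refl

    -- The relation symbol is written in unary on the input, and each stroke discards one candidate.
    select : ∀ {p} → (Fin p → Prog) → Prog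
    select {zero}  h = nop
    select {suc p} h = ite (top 0F isOne) (mv 0F 1F ⨾ select (h ∘ suc)) (mv 0F 1F ⨾ h zero)

    select-run : ∀ {p} (h : Fin p → Prog) i {I J D E C C′ G F P Q Q′ s c} →
      Run (h i) (st I (eman (toℕ i) J) D E C C′ G F P Q Q′) s c →
      Run (select h) (st (name (toℕ i) I) J D E C C′ G F P Q Q′) s (p * 3 + c)
    select-run {suc p} h zero {c = c} r = within (s≤s (s≤s (s≤s (m≤n+m c (p * 3))))) (else refl (prim ⨾ r))
    select-run h (suc i) {I} {J} {D} {E} {C} {C′} {G} {F} {P} {Q} {Q′} {s} {c} r = then refl (prim ⨾
      select-run (h ∘ suc) i (subst (λ J′ → Run (h (suc i)) (st I (inj₁ false ∷ J′) D E C C′ G F P Q Q′) s c)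
                                    (sym (reps-∷ (inj₁ true) (toℕ i) J)) r))

    module _ {n : ℕ} where

      code : Constraint {n} → List Elem → List Elem
      code (i , xs) I = name (toℕ i) (names i xs (allFin (ar i)) I)

      edoc : Constraint {n} → List Elem → List Elem
      edoc (i , xs) J = seman i xs (allFin (ar i)) (eman (toℕ i) J)

      codes : List Constraint → List Elem
      codes = foldr code []

      seman-ʳ++ : ∀ i (xs : Vec (Fin n) (ar i)) js J I → seman i xs js J ʳ++ I ≡ J ʳ++ names i xs js I
      seman-ʳ++ i xs []       J I = refl
      seman-ʳ++ i xs (j ∷ js) J I = trans (seman-ʳ++ i xs js _ I) (reps-ʳ++ (inj₁ true) (toℕ (lookup xs j)) J _)

      edoc-ʳ++ : ∀ c J I → edoc c J ʳ++ I ≡ J ʳ++ code c I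
      edoc-ʳ++ (i , xs) J I = trans (seman-ʳ++ i xs (allFin (ar i)) _ I) (reps-ʳ++ (inj₁ true) (toℕ i) J _)

      edocs-ʳ++ : ∀ cs J → foldl (λ J c → edoc c J) J cs ʳ++ [] ≡ J ʳ++ codes cs
      edocs-ʳ++ []       J = refl
      edocs-ʳ++ (c ∷ cs) J = trans (edocs-ʳ++ cs (edoc c J)) (edoc-ʳ++ c J (codes cs))

      length-code : ∀ c I → suc (length I) ≤ length (code c I)
      length-code (i , xs) I = ≤-trans (s≤s (go (allFin (ar i)))) (≤-trans (m≤n+m _ (toℕ i)) (≤-reflexive (sym (length-reps (inj₁ true) (toℕ i) _))))
        where
        go : ∀ js → length I ≤ length (names i xs js I)
        go []       = ≤-refl
        go (j ∷ js) = ≤-trans (go js) (≤-trans (≤-trans (n≤1+n _) (m≤n+m _ (toℕ (lookup xs j))))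
                        (≤-reflexive (sym (length-reps (inj₁ true) (toℕ (lookup xs j)) _))))

      -- Each code word is nonempty, so the number of constraints is bounded by the length of the
      -- input.
      length-codes : ∀ cs → length cs ≤ length (codes cs)
      length-codes []       = z≤n
      length-codes (c ∷ cs) = ≤-trans (s≤s (length-codes cs)) (length-code c (codes cs))

    sweepP : Phase → Prog
    sweepP ph = while (top 0F some) (select (handle ph)) ⨾ drain 1F 0F

    visit-cost : ℕ → ℕ
    visit-cost S = suc (m * 3 + handle-cost S)

    sweep-cost iter-cost : ℕ → ℕ → ℕ
    sweep-cost L S = (L * visit-cost S + 1) + (L * 3 + 1)
    iter-cost L S = 2 + (sweep-cost L S + (sweep-cost L S + sweep-cost L S))

    iterP : Prog
    iterP = prim (λ _ → Vec.replicate 11 keep [ 7F ]≔ put (inj₁ false)) ⨾ sweepP force ⨾ sweepP guess ⨾ sweepP correct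

    repeat : ℕ → Prog
    repeat zero    = nop
    repeat (suc t) = iterP ⨾ repeat t

    -- Two clocks that are linear in the number of variables give quadratically many iterations; the
    -- ticks spent by the inner loop are kept on the last stack and restored for the next tick of
    -- the outer one.
    inner outer : ℕ → Prog
    inner c = while (top 9F some) (mv 9F (suc 9F) ⨾ repeat c)
    outer c = while (top 8F some) (prim (λ _ → Vec.replicate 11 keep [ 8F ]≔ remove) ⨾ inner c ⨾ drain (suc 9F) 9F)

    inner-cost outer-cost : ℕ → ℕ → ℕ → ℕ → ℕ
    inner-cost c q L S = q * suc (2 + (c * iter-cost L S + 2)) + 1
    outer-cost c q L S = q * suc (2 + (inner-cost c q L S + (q * 3 + 1))) + 1

    module _ {n : ℕ} (cs : List (Constraint {n})) {L} (cs≤L : length (codes cs) ≤ L) where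

      code-top : ∀ (c : Constraint {n}) I → maybe′ some false (List.head (code c I)) ≡ true
      code-top (i , xs) I with toℕ i
      ... | zero  = refl
      ... | suc _ = refl

      sweep-go : ∀ ph (cs : List (Constraint {n})) σ f J {S} → size′ σ + room f ≤ S → ∀ {P Q Q′} →
        Run (while (top 0F some) (select (handle ph)))
          (st (codes cs) J (table σ) [] [] [] [] (inj₁ f ∷ []) P Q Q′)
          (st [] (foldl (λ J c → edoc c J) J cs) (table (proj₁ (sweep ph cs (σ , f)))) [] [] [] [] (inj₁ (proj₂ (sweep ph cs (σ , f))) ∷ []) P Q Q′)
          (length cs * visit-cost S + 1)
      sweep-go ph [] σ f J le = stop refl
      sweep-go ph (c@(i , xs) ∷ cs) σ f J {S} le = within (≤-reflexive (sym (+-assoc (visit-cost S) _ 1)))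
        (again (code-top c (codes cs))
          (select-run (handle ph) i (handle-run ph i xs σ f le))
          (sweep-go ph cs _ _ _ (≤-trans (visit-size ph σ f c) le)))

      sweep-run : ∀ ph σ f {S} → size′ σ + room f ≤ S → ∀ {P Q Q′} →
        Run (sweepP ph) (st (codes cs) [] (table σ) [] [] [] [] (inj₁ f ∷ []) P Q Q′)
          (st (codes cs) [] (table (proj₁ (sweep ph cs (σ , f)))) [] [] [] [] (inj₁ (proj₂ (sweep ph cs (σ , f))) ∷ []) P Q Q′)
          (sweep-cost L S)
      sweep-run ph σ f {S} le {P} {Q} {Q′} =
        within (+-monoˡ-≤ 1 (*-monoˡ-≤ (visit-cost S) (≤-trans (length-codes cs) cs≤L))) (sweep-go ph cs σ f [] le) ⨾
        within (+-monoˡ-≤ 1 (*-monoˡ-≤ 3 (≤-trans (≤-reflexive eqn) cs≤L)))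
          (drain-J J₁ ▸ cong (λ I → st I [] (table (proj₁ (sweep ph cs (σ , f)))) [] [] [] [] (inj₁ (proj₂ (sweep ph cs (σ , f))) ∷ []) P Q Q′) (edocs-ʳ++ cs []))
        where
        J₁ = foldl (λ J c → edoc c J) [] cs
        eqn : length J₁ ≡ length (codes cs)
        eqn = trans (sym (+-identityʳ _)) (trans (sym (List.length-ʳ++ J₁)) (cong length (edocs-ʳ++ cs [])))

      iter-run : ∀ σ f {S} → suc (size′ σ) ≤ S → ∀ {P Q Q′} →
        Run iterP (st (codes cs) [] (table σ) [] [] [] [] (inj₁ f ∷ []) P Q Q′)
          (st (codes cs) [] (table (proj₁ (iter cs σ))) [] [] [] [] (inj₁ (proj₂ (iter cs σ)) ∷ []) P Q Q′)
          (iter-cost L S)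
      iter-run σ f le = prim ⨾ sweep-run force σ false le₁ ⨾ sweep-run guess _ _ le₂ ⨾ sweep-run correct _ _ le₃
        where
        le₁ = ≤-trans (≤-reflexive (+-comm _ 1)) le
        le₂ = ≤-trans (sweep-size force cs (σ , false)) le₁
        le₃ = ≤-trans (sweep-size guess cs (sweep force cs (σ , false))) le₂

      loop-+ : ∀ t u (s : State {n} × Bool) → loop cs (t + u) s ≡ loop cs u (loop cs t s)
      loop-+ zero    u s       = refl
      loop-+ (suc t) u (σ , f) = loop-+ t u (iter cs σ)

      loop-size : ∀ t s → size′ (proj₁ (loop cs t s)) ≤ t + size′ (proj₁ s)
      loop-size zero    s       = ≤-refl
      loop-size (suc t) (σ , f) = ≤-trans (loop-size t (iter cs σ)) (≤-trans (+-monoʳ-≤ t (iter-size cs σ)) (≤-reflexive (+-suc t _)))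

      at : State {n} × Bool → (P Q Q′ : List Elem) → Store
      at (σ , f) = st (codes cs) [] (table σ) [] [] [] [] (inj₁ f ∷ [])

      repeat-run : ∀ t (s : State {n} × Bool) {S} → t + size′ (proj₁ s) ≤ S → ∀ {P Q Q′} →
        Run (repeat t) (at s P Q Q′) (at (loop cs t s) P Q Q′) (t * iter-cost L S + 2)
      repeat-run zero    s       le = prim
      repeat-run (suc t) (σ , f) {S} le = within (≤-reflexive (sym (+-assoc (iter-cost L S) _ 2)))
        (iter-run σ f (≤-trans (s≤s (m≤n+m _ t)) le) ⨾
         repeat-run t (iter cs σ) (≤-trans (+-monoʳ-≤ t (iter-size cs σ)) (≤-trans (≤-reflexive (+-suc t _)) le)))

      inner-run : ∀ c q (s : State {n} × Bool) {S} → q * c + size′ (proj₁ s) ≤ S → ∀ {P Q′} →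
        Run (inner c) (at s P (reps tk q []) Q′) (at (loop cs (q * c) s) P [] (reps tk q Q′)) (inner-cost c q L S)
      inner-run c zero    s le = stop refl
      inner-run c (suc q) s {S} le {P} {Q′} = within (≤-reflexive (sym (+-assoc (suc (2 + (c * iter-cost L S + 2))) _ 1)))
        (again refl (prim ⨾ repeat-run c s (≤-trans (+-monoˡ-≤ (size′ (proj₁ s)) (m≤m+n c (q * c))) le))
          (inner-run c q (loop cs c s) (≤-trans (+-monoʳ-≤ (q * c) (loop-size c s)) (≤-trans (≤-reflexive (eqn (q * c) c (size′ (proj₁ s)))) le)) ▸
            cong₂ (λ s Q′ → at s P [] Q′) (sym (loop-+ c (q * c) s)) (reps-∷ tk q Q′)))
        where
        open import Data.Nat.Tactic.RingSolver using (solve-∀)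
        eqn : ∀ x c z → x + (c + z) ≡ c + x + z
        eqn = solve-∀

      drain-Q′ : ∀ q (s : State {n} × Bool) {P Q} → Run (drain (suc 9F) 9F) (at s P Q (reps tk q [])) (at s P (reps tk q Q) []) (q * 3 + 1)
      drain-Q′ zero    s = stop refl
      drain-Q′ (suc q) s {P} {Q} = again refl prim (drain-Q′ q s ▸ cong (λ Q → at s P Q []) (reps-∷ tk q Q))

      outer-run : ∀ c p q (s : State {n} × Bool) {S} → p * (q * c) + size′ (proj₁ s) ≤ S →
        Run (outer c) (at s (reps tk p []) (reps tk q []) []) (at (loop cs (p * (q * c)) s) [] (reps tk q []) []) (p * suc (2 + (inner-cost c q L S + (q * 3 + 1))) + 1)
      outer-run c zero    q s le = stop refl
      outer-run c (suc p) q s {S} le = within (≤-reflexive (sym (+-assoc (suc (2 + (inner-cost c q L S + (q * 3 + 1)))) _ 1)))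
        (again refl (prim ⨾ inner-run c q s (≤-trans (+-monoˡ-≤ (size′ (proj₁ s)) (m≤m+n (q * c) _)) le) ⨾ drain-Q′ q (loop cs (q * c) s))
          (outer-run c p q (loop cs (q * c) s) (≤-trans (+-monoʳ-≤ (p * (q * c)) (loop-size (q * c) s)) (≤-trans (≤-reflexive (eqn (p * (q * c)) (q * c) (size′ (proj₁ s)))) le)) ▸
            cong (λ s → at s [] (reps tk q []) []) (sym (loop-+ (q * c) (p * (q * c)) s))))
        where
        open import Data.Nat.Tactic.RingSolver using (solve-∀)
        eqn : ∀ x c z → x + (c + z) ≡ c + x + z
        eqn = solve-∀

    -- The three clocks are read off the unary number of variables at the start of the input.
    setup-step finish : Tops → Vec Op 11
    setup-step _ = (((Vec.replicate 11 keep [ 0F ]≔ remove) [ 2F ]≔ push (inj₂ (sep nothing))) [ 8F ]≔ push tk) [ 9F ]≔ push tk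
    finish     _ = (((Vec.replicate 11 keep [ 0F ]≔ remove) [ 7F ]≔ push (inj₁ true)) [ 8F ]≔ push tk) [ 9F ]≔ push tk

    setup : Prog
    setup = while (top 0F isOne) (prim setup-step) ⨾ prim finish

    table-blank : ∀ n D → reps (inj₂ (sep nothing)) n D ≡ table (blank {n}) ++ D
    table-blank zero    D = refl
    table-blank (suc n) D = cong (inj₂ (sep nothing) ∷_) (table-blank n D)

    setup-run : ∀ n I → Run setup (st (name n I) [] [] [] [] [] [] [] [] [] [])
                           (st I [] (table (blank {n})) [] [] [] [] (inj₁ true ∷ []) (reps tk (suc n) []) (reps tk (suc n) []) []) ((n * 3 + 1) + 2)
    setup-run n I = (go n ⨾ prim) ▸ cong (λ D → st I [] D [] [] [] [] (inj₁ true ∷ []) (reps tk (suc n) []) (reps tk (suc n) []) [])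
                                        (trans (table-blank n []) (List.++-identityʳ _))
      where
      go : ∀ n {D P Q} → Run (while (top 0F isOne) (prim setup-step)) (st (name n I) [] D [] [] [] [] [] P Q [])
                              (st (inj₁ false ∷ I) [] (reps (inj₂ (sep nothing)) n D) [] [] [] [] [] (reps tk n P) (reps tk n Q) []) (n * 3 + 1)
      go zero = stop refl
      go (suc n) {D} {P} {Q} = again refl prim (go n ▸ trans
        (cong₂ (λ D P → st (inj₁ false ∷ I) [] D [] [] [] [] [] P (reps tk n (tk ∷ Q)) []) (reps-∷ (inj₂ (sep nothing)) n D) (reps-∷ tk n P))
        (cong (λ Q → st (inj₁ false ∷ I) [] (reps (inj₂ (sep nothing)) (suc n) D) [] [] [] [] [] (reps tk (suc n) P) Q []) (reps-∷ tk n Q)))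

    table-size : ∀ n → size′ (blank {n}) ≡ n
    table-size zero    = refl
    table-size (suc n) = cong suc (table-size n)

    -- The number of iterations is multiplicity * (n + 1)².
    multiplicity : ℕ
    multiplicity = suc (proj₁ radii)

    main : Prog
    main = setup ⨾ outer multiplicity

    -- The table starts with one symbol per variable and gains at most one per iteration; the input
    -- length bounds the clocks.
    space time : ℕ → ℕ
    space L = L * (L * multiplicity) + L
    time L = suc (((L * 3 + 1) + 2) + outer-cost multiplicity L L (space L))

    -- An unset flag says that the last iteration was quiet, which is the criterion for acceptance.
    verdict : Tops → Bool
    verdict ts = Bool.not (flagOf′ (lookup ts 7F))
      where
      flagOf′ : Maybe Elem → Bool
      flagOf′ (just (inj₁ f)) = f
      flagOf′ _               = true

    abstract
      enc-main : Enc (Maybe (Control main))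
      enc-main = Enc-Maybe (Enc-Control main)

      decider : TuringMachine
      decider = Machine.machine main verdict enc-main

      decides : ∀ {n} (cs : List (Constraint {n})) w → map inj₁ w ≡ name n (codes cs) →
                ∃[ b ] (∀ N → time (length w) ≤ N → run decider N (initial decider w) ≡ just b) ×
                  (b ≡ true → ∃ (Solution cs)) × (∃ (Solution cs) → b ≡ true)
      decides {n} cs w e = Bool.not (proj₂ s) ,
        (λ N le → Machine.machine-run main verdict enc-main w {n = c}
          (subst (λ I → Run main (st I [] [] [] [] [] [] [] [] [] []) (at cs cs≤L s [] (reps tk q []) []) c) (sym e)
            (setup-run n (codes cs) ⨾ outer-run cs cs≤L multiplicity q q (blank , true) space-ok))
          N (≤-trans (s≤s time-ok) le)) ,
        (λ h → proj₁ right (not-true h)) , (λ h → cong Bool.not (proj₂ right h))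
        where
        L : ℕ
        L = length w
        q : ℕ
        q = suc n
        len : L ≡ n + suc (length (codes cs))
        len = trans (sym (List.length-map inj₁ w)) (trans (cong length e) (length-reps (inj₁ true) n _))
        q≤L : q ≤ L
        q≤L = ≤-trans (s≤s (m≤m+n n _)) (≤-reflexive (sym (trans len (+-suc n _))))
        n≤L : n ≤ L
        n≤L = ≤-trans (n≤1+n n) q≤L
        cs≤L : length (codes cs) ≤ L
        cs≤L = ≤-trans (≤-trans (n≤1+n _) (m≤n+m _ n)) (≤-reflexive (sym len))
        t : ℕ
        t = q * (q * multiplicity)
        s : State {n} × Bool
        s = loop cs t (blank , true)
        space-ok : t + size′ (blank {n}) ≤ space L
        space-ok = +-mono-≤ (*-mono-≤ q≤L (*-monoˡ-≤ multiplicity q≤L)) (≤-trans (≤-reflexive (table-size n)) n≤L)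
        c : ℕ
        c = ((n * 3 + 1) + 2) + (q * suc (2 + (inner-cost multiplicity q L (space L) + (q * 3 + 1))) + 1)
        time-ok : c ≤ ((L * 3 + 1) + 2) + outer-cost multiplicity L L (space L)
        time-ok = +-mono-≤ (+-monoˡ-≤ 2 (+-monoˡ-≤ 1 (*-monoˡ-≤ 3 n≤L)))
          (+-monoˡ-≤ 1 (*-mono-≤ q≤L (s≤s (+-monoʳ-≤ 2 (+-mono-≤ (+-monoˡ-≤ 1 (*-monoˡ-≤ _ q≤L)) (+-monoˡ-≤ 1 (*-monoˡ-≤ 3 q≤L)))))))
        not-true : ∀ {b} → Bool.not b ≡ true → b ≡ false
        not-true {false} _ = refl
        -- The iterations must exceed the initial potential by at least one, so that a quiet one is
        -- among them.
        enough : ∃[ u ] t ≡ suc u × n * suc (n * proj₁ radii) ≤ u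
        enough = _ , refl , go n (proj₁ radii)
          where
          open import Data.Nat.Tactic.RingSolver using (solve-∀)
          go : ∀ n K → n * suc (n * K) ≤ K + n * suc K + n * (suc n * suc K)
          go n K = ≤-by _ (eqn n K)
            where
            eqn : ∀ n K → K + n * suc K + n * (suc n * suc K) ≡ n * suc (n * K) + (K + n * K + n * K + n * n + n)
            eqn = solve-∀
        right : (proj₂ s ≡ false → ∃ (Solution cs)) × (∃ (Solution cs) → proj₂ s ≡ false)
        right with u , eq , le ← enough = subst (λ t → (proj₂ (loop cs t (blank , true)) ≡ false → ∃ (Solution cs)) ×
                                                     (∃ (Solution cs) → proj₂ (loop cs t (blank , true)) ≡ false)) (sym eq) (correctness cs u true le)

-- Polynomial time bounds, and sentences as lists of constraints.

module Reduction where

  open import Defs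
  open Locality
  open Tameness
  open Descent using (module Algorithm)
  open Programs using (module Program)
  open Decision using (module Decider)
  open import Data.Integer.Base as ℤ using (ℤ; +_; -_; _-_; _⊓_; _⊔_)
  open import Data.Integer.Tactic.RingSolver using (solve-∀)
  open import Data.List.Base as List using (foldr; length; allFin)
  open import Data.List.Relation.Unary.All as All using (All; []; _∷_)
  open import Data.Nat.Base as ℕ using (_+_; _*_; _^_; _≤_; s≤s; NonZero)
  open import Data.Vec.Base as Vec using (zipWith; toList)
  open import Relation.Nullary using (does)

  -- The base `suc x` is at least 1, so exponents can be raised to a common one and closure under
  -- sums and products is immediate.
  PolyBounded : (ℕ → ℕ) → Set
  PolyBounded f = ∃[ c ] ∃[ k ] ∀ x → f x ≤ c * suc x ^ k

  1≤suc^ : ∀ x k → 1 ≤ suc x ^ k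
  1≤suc^ x k = ℕ.m^n>0 (suc x) k

  con : ∀ n → PolyBounded (λ _ → n)
  con n = n , 0 , λ x → ℕ.≤-reflexive (sym (ℕ.*-identityʳ n))

  var : PolyBounded id
  var = 1 , 1 , λ x → ℕ.≤-trans (ℕ.n≤1+n x) (ℕ.≤-reflexive (sym (trans (ℕ.*-identityˡ _) (ℕ.*-identityʳ (suc x)))))

  _⊕_ : ∀ {f g} → PolyBounded f → PolyBounded g → PolyBounded (λ x → f x + g x)
  _⊕_ {f} {g} (c , k , f≤) (c′ , k′ , g≤) = c + c′ , k + k′ , λ x → begin
    f x + g x                                         ≤⟨ ℕ.+-mono-≤ (f≤ x) (g≤ x) ⟩
    c * suc x ^ k + c′ * suc x ^ k′                   ≤⟨ ℕ.+-mono-≤ (ℕ.*-monoʳ-≤ c (ℕ.^-monoʳ-≤ (suc x) (ℕ.m≤m+n k k′)))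
                                                                    (ℕ.*-monoʳ-≤ c′ (ℕ.^-monoʳ-≤ (suc x) (ℕ.m≤n+m k′ k))) ⟩
    c * suc x ^ (k + k′) + c′ * suc x ^ (k + k′)      ≡⟨ sym (ℕ.*-distribʳ-+ (suc x ^ (k + k′)) c c′) ⟩
    (c + c′) * suc x ^ (k + k′)                       ∎
    where open ℕ.≤-Reasoning

  _⊗_ : ∀ {f g} → PolyBounded f → PolyBounded g → PolyBounded (λ x → f x * g x)
  _⊗_ {f} {g} (c , k , f≤) (c′ , k′ , g≤) = c * c′ , k + k′ , λ x → begin
    f x * g x                              ≤⟨ ℕ.*-mono-≤ (f≤ x) (g≤ x) ⟩
    c * suc x ^ k * (c′ * suc x ^ k′)      ≡⟨ ℕ.[m*n]*[o*p]≡[m*o]*[n*p] c (suc x ^ k) c′ (suc x ^ k′) ⟩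
    c * c′ * (suc x ^ k * suc x ^ k′)      ≡⟨ cong (c * c′ *_) (sym (ℕ.^-distribˡ-+-* (suc x) k k′)) ⟩
    c * c′ * suc x ^ (k + k′)              ∎
    where open ℕ.≤-Reasoning

  infixr 5 _⊕_
  infixr 6 _⊗_

  ^-distribʳ-* : ∀ k x y → (x * y) ^ k ≡ x ^ k * y ^ k
  ^-distribʳ-* zero    x y = refl
  ^-distribʳ-* (suc k) x y = trans (cong (x * y *_) (^-distribʳ-* k x y)) (ℕ.[m*n]*[o*p]≡[m*o]*[n*p] x y (x ^ k) (y ^ k))

  -- For positive `x` the base `suc x` is at most `2 * x`, which costs the factor `2 ^ k`; the
  -- additive constant covers `x = 0`.
  polynomial : ∀ {f} → PolyBounded f → ∃[ c ] ∃[ k ] ∀ x → f x ≤ c * x ^ k + c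
  polynomial {f} (c , k , f≤) = c * 2 ^ k , k , λ x → ℕ.≤-trans (f≤ x) (go x)
    where
    open ℕ.≤-Reasoning
    go : ∀ x → c * suc x ^ k ≤ c * 2 ^ k * x ^ k + c * 2 ^ k
    go zero    = begin
      c * 1 ^ k                         ≡⟨ cong (c *_) (ℕ.^-zeroˡ k) ⟩
      c * 1                             ≤⟨ ℕ.*-monoʳ-≤ c (1≤suc^ 1 k) ⟩
      c * 2 ^ k                         ≤⟨ ℕ.m≤n+m _ _ ⟩
      c * 2 ^ k * 0 ^ k + c * 2 ^ k     ∎
    go (suc x) = begin
      c * suc (suc x) ^ k                        ≤⟨ ℕ.*-monoʳ-≤ c (ℕ.^-monoˡ-≤ k (s≤s (ℕ.≤-trans (s≤s (ℕ.m≤m+n x (x + 0))) (ℕ.≤-reflexive (sym (ℕ.+-suc x (x + 0))))))) ⟩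
      c * (2 * suc x) ^ k                        ≡⟨ cong (c *_) (^-distribʳ-* k 2 (suc x)) ⟩
      c * (2 ^ k * suc x ^ k)                    ≡⟨ sym (ℕ.*-assoc c (2 ^ k) (suc x ^ k)) ⟩
      c * 2 ^ k * suc x ^ k                      ≤⟨ ℕ.m≤m+n _ _ ⟩
      c * 2 ^ k * suc x ^ k + c * 2 ^ k          ∎

  module _ {d : ℕ} .{{_ : NonZero d}} {m : ℕ} (ar : Fin m → ℕ)
           (R : ∀ i → (Fin (ar i) → ℤ) → Set) (T : ∀ i → Tame d (R i)) where

    open Decider ar R T
    open Program ar R T using (read-cost; write-cost; seek-cost)

    time-bounded : PolyBounded time
    time-bounded = con 1 ⊕ ((var ⊗ con 3 ⊕ con 1) ⊕ con 2) ⊕ outerP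
      where
      S : PolyBounded space
      S = (var ⊗ var ⊗ con multiplicity) ⊕ var
      S3 : PolyBounded (λ L → space L * 3 + 1)
      S3 = S ⊗ con 3 ⊕ con 1
      seekP : PolyBounded (seek-cost ∘ space)
      seekP = (S ⊗ con 6 ⊕ con 1) ⊕ con 2
      readP : PolyBounded (read-cost ∘ space)
      readP = seekP ⊕ S3 ⊕ con 2 ⊕ S3 ⊕ S3
      writeP : PolyBounded (write-cost ∘ space)
      writeP = seekP ⊕ S3 ⊕ con 2 ⊕ S3
      handleP : PolyBounded (handle-cost ∘ space)
      handleP = con 2 ⊕ (con a ⊗ readP ⊕ con 2) ⊕ ((con a ⊗ S) ⊗ con 3 ⊕ con 1) ⊕ con 2 ⊕
                (con a ⊗ (con 2 ⊕ S3) ⊕ con 2) ⊕ (con a ⊗ writeP ⊕ con 2) ⊕ con 2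
      sweepP′ : PolyBounded (λ L → sweep-cost L (space L))
      sweepP′ = (var ⊗ (con 1 ⊕ con (m * 3) ⊕ handleP) ⊕ con 1) ⊕ (var ⊗ con 3 ⊕ con 1)
      iterP′ : PolyBounded (λ L → iter-cost L (space L))
      iterP′ = con 2 ⊕ sweepP′ ⊕ sweepP′ ⊕ sweepP′
      innerP : PolyBounded (λ L → inner-cost multiplicity L L (space L))
      innerP = var ⊗ (con 1 ⊕ con 2 ⊕ con multiplicity ⊗ iterP′ ⊕ con 2) ⊕ con 1
      outerP : PolyBounded (λ L → outer-cost multiplicity L L (space L))
      outerP = var ⊗ (con 1 ⊕ con 2 ⊕ innerP ⊕ (var ⊗ con 3 ⊕ con 1)) ⊕ con 1

    abstract
      time-polynomial : ∃[ c ] ∃[ k ] ∀ x → time x ≤ c * x ^ k + c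
      time-polynomial = polynomial time-bounded

  -- The case of a maximum is reduced to that of a minimum by the reflection s = -_.
  module Reduct (τ : Signature) (Γ : Structure τ ℤ) (reduct : IsReduct Γ) (d : ℕ) .{{_ : NonZero d}}
                (op : ℤ → ℤ → ℤ) (preserves : Preserves Γ op) (s : ℤ → ℤ)
                (s-involutive : ∀ x → s (s x) ≡ x)
                (s-close : ∀ {K n} (f g : Fin n → ℤ) → Close K f g → Close K (s ∘ f) (s ∘ g))
                (s-op : ∀ x y → op (s x) (s y) ≡ s (min[ d ] x y)) where

    -- Equality joins the relations as index 0, so that indices coincide with the codes used by
    -- `encodeAtom`.
    ar : Fin (suc (size τ)) → ℕ
    ar zero    = 2
    ar (suc i) = arity τ i

    R : ∀ i → (Fin (ar i) → ℤ) → Set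
    R zero    f = s (f zero) ≡ s (f (suc zero))
    R (suc i) f = Γ i (tabulate (s ∘ f))

    local : ∀ i → Local (Γ i)
    local i with φ , e ← reduct i = Local-⇔ (λ v → mk⇔ (Equivalence.from (e v)) (Equivalence.to (e v))) (Holds-local φ)

    zipWith-tabulate : ∀ {n} (f g : Fin n → ℤ) → zipWith op (tabulate f) (tabulate g) ≡ tabulate (λ i → op (f i) (g i))
    zipWith-tabulate {zero}  f g = refl
    zipWith-tabulate {suc n} f g = cong (op (f zero) (g zero) ∷_) (zipWith-tabulate (f ∘ suc) (g ∘ suc))

    close-tabulate : ∀ {K n} (f g : Fin n → ℤ) → Close K f g → Close K (lookup (tabulate f)) (lookup (tabulate g))
    close-tabulate {K} f g c i j = subst₂ (Sim K)
      (sym (cong₂ _-_ (lookup∘tabulate f i) (lookup∘tabulate f j))) (sym (cong₂ _-_ (lookup∘tabulate g i) (lookup∘tabulate g j))) (c i j)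

    tame : ∀ i → Tame d (R i)
    tame zero = record
      { range  = radius eq₂
      ; rigid  = λ f g c → stable eq₂ (s (f zero) ∷ s (f (suc zero)) ∷ []) (s (g zero) ∷ s (g (suc zero)) ∷ [])
                   λ { zero zero → s-close f g c zero zero ; zero (suc zero) → s-close f g c zero (suc zero)
                     ; (suc zero) zero → s-close f g c (suc zero) zero ; (suc zero) (suc zero) → s-close f g c (suc zero) (suc zero) }
      ; decide = λ f → _ ℤ.≟ _
      ; closed = λ f g p q → cong s (cong₂ min[ d ] (cancel p) (cancel q))
      }
      where
      eq₂ : Local (λ v → lookup v zero ≡ lookup v (suc zero))
      eq₂ = Local-≡ {2} zero (suc zero)
      cancel : ∀ {x y} → s x ≡ s y → x ≡ y
      cancel {x} {y} p = trans (sym (s-involutive x)) (trans (cong s p) (s-involutive y))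
    tame (suc i) = record
      { range  = radius (local i)
      ; rigid  = λ f g c → stable (local i) (tabulate (s ∘ f)) (tabulate (s ∘ g)) (close-tabulate (s ∘ f) (s ∘ g) (s-close f g c))
      ; decide = λ f → dec (local i) (tabulate (s ∘ f))
      ; closed = λ f g p q → subst (Γ i)
                   (trans (zipWith-tabulate (s ∘ f) (s ∘ g)) (tabulate-cong (λ j → s-op (f j) (g j))))
                   (preserves i (tabulate (s ∘ f)) (tabulate (s ∘ g)) p q)
      }

    open Algorithm ar R tame using (Constraint; Solution)
    open Program ar R tame using (name; names; reps; Elem)
    open Decider ar R tame

    constraint : ∀ {n} → Atom τ n → Constraint {n}
    constraint (rel i xs) = suc i , xs
    constraint (eq x y)   = zero , x ∷ y ∷ []

    map-tabulate : ∀ {n k} (f : Fin n → ℤ) (xs : Vec (Fin n) k) → tabulate (f ∘ lookup xs) ≡ Vec.map f xs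
    map-tabulate f []       = refl
    map-tabulate f (x ∷ xs) = cong (f x ∷_) (map-tabulate f xs)

    map-cong : ∀ {n k} {f g : Fin n → ℤ} → (∀ x → f x ≡ g x) → (xs : Vec (Fin n) k) → Vec.map f xs ≡ Vec.map g xs
    map-cong e []       = refl
    map-cong e (x ∷ xs) = cong₂ _∷_ (e x) (map-cong e xs)

    Atom⇒ : ∀ {n} (v : Vec ℤ n) a → HoldsAtom Γ v a → R (proj₁ (constraint a)) (s ∘ lookup v ∘ lookup (proj₂ (constraint a)))
    Atom⇒ v (rel i xs) h = subst (Γ i) (trans (map-cong (λ x → sym (s-involutive (lookup v x))) xs)
                                              (sym (map-tabulate (s ∘ s ∘ lookup v) xs))) h
    Atom⇒ v (eq x y)   h = cong (s ∘ s) h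

    Atom⇐ : ∀ {n} (z : Fin n → ℤ) a → R (proj₁ (constraint a)) (z ∘ lookup (proj₂ (constraint a))) → HoldsAtom Γ (tabulate (s ∘ z)) a
    Atom⇐ z (rel i xs) h = subst (Γ i) (trans (map-tabulate (s ∘ z) xs) (map-cong (λ x → sym (lookup∘tabulate (s ∘ z) x)) xs)) h
    Atom⇐ z (eq x y)   h = trans (lookup∘tabulate (s ∘ z) x) (trans h (sym (lookup∘tabulate (s ∘ z) y)))

    solution⇒ : ∀ {n} (as : List (Atom τ n)) v → All (HoldsAtom Γ v) as → Solution (List.map constraint as) (s ∘ lookup v)
    solution⇒ []       v []       = []
    solution⇒ (a ∷ as) v (h ∷ hs) = Atom⇒ v a h ∷ solution⇒ as v hs

    solution⇐ : ∀ {n} (as : List (Atom τ n)) z → Solution (List.map constraint as) z → All (HoldsAtom Γ (tabulate (s ∘ z))) as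
    solution⇐ []       z []       = []
    solution⇐ (a ∷ as) z (h ∷ hs) = Atom⇐ z a h ∷ solution⇐ as z hs

    bits : List Bool → List Elem
    bits = List.map inj₁

    bits-unary : ∀ x w → bits (unary x List.++ w) ≡ name x (bits w)
    bits-unary zero    w = refl
    bits-unary (suc x) w = cong (inj₁ true ∷_) (bits-unary x w)

    bits-names : ∀ {n} (xs : List (Fin n)) w →
                 bits (List.concatMap (unary ∘ toℕ) xs List.++ w) ≡ foldr (name ∘ toℕ) (bits w) xs
    bits-names []       w = refl
    bits-names (x ∷ xs) w = trans (cong bits (List.++-assoc (unary (toℕ x)) (List.concatMap (unary ∘ toℕ) xs) w))
      (trans (bits-unary (toℕ x) (List.concatMap (unary ∘ toℕ) xs List.++ w)) (cong (name (toℕ x)) (bits-names xs w)))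

    names-toList : ∀ {n} i (xs : Vec (Fin n) (ar i)) I → names i xs (allFin (ar i)) I ≡ foldr (name ∘ toℕ) I (toList xs)
    names-toList i xs I = trans (go id) (cong (foldr (name ∘ toℕ) I) (sym (toList-tabulate xs)))
      where
      go : ∀ {k} (g : Fin k → Fin (ar i)) → names i xs (List.tabulate g) I ≡ foldr (name ∘ toℕ) I (List.tabulate (lookup xs ∘ g))
      go {zero}  g = refl
      go {suc k} g = cong (name (toℕ (lookup xs (g zero)))) (go (g ∘ suc))
      toList-tabulate : ∀ {A : Set} {k} (xs : Vec A k) → toList xs ≡ List.tabulate (lookup xs)
      toList-tabulate []       = refl
      toList-tabulate (x ∷ xs) = cong (x ∷_) (toList-tabulate xs)

    bits-atom : ∀ {n} (a : Atom τ n) w → bits (encodeAtom a List.++ w) ≡ code (constraint a) (bits w)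
    bits-atom (rel i xs) w = trans (cong bits (List.++-assoc (unary (suc (toℕ i))) (List.concatMap (unary ∘ toℕ) (toList xs)) w))
      (trans (bits-unary (suc (toℕ i)) (List.concatMap (unary ∘ toℕ) (toList xs) List.++ w))
        (cong (name (suc (toℕ i))) (trans (bits-names (toList xs) w) (sym (names-toList (suc i) xs (bits w))))))
    bits-atom (eq x y) w = trans (cong bits (List.++-assoc (unary 0) (unary (toℕ x) List.++ unary (toℕ y)) w))
      (cong (inj₁ false ∷_) (trans (cong bits (List.++-assoc (unary (toℕ x)) (unary (toℕ y)) w))
        (trans (bits-unary (toℕ x) (unary (toℕ y) List.++ w)) (cong (name (toℕ x)) (bits-unary (toℕ y) w)))))

    bits-atoms : ∀ {n} (as : List (Atom τ n)) → bits (List.concatMap encodeAtom as) ≡ codes (List.map constraint as)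
    bits-atoms []       = refl
    bits-atoms (a ∷ as) = trans (bits-atom a (List.concatMap encodeAtom as)) (cong (code (constraint a)) (bits-atoms as))

    bits-encode : ∀ φ → bits (encode φ) ≡ name (vars φ) (codes (List.map constraint (atoms φ)))
    bits-encode φ = trans (bits-unary (vars φ) (List.concatMap encodeAtom (atoms φ))) (cong (name (vars φ)) (bits-atoms (atoms φ)))

    solvable : CSPSolvableInPolynomialTime Γ
    solvable = decider , proj₁ bound , proj₁ (proj₂ bound) , λ φ → answer φ (decides (List.map constraint (atoms φ)) (encode φ) (bits-encode φ))
      where
      bound = time-polynomial ar R tame
      answer : ∀ φ →
        (∃[ b ] (∀ N → time (length (encode φ)) ≤ N → run decider N (initial decider (encode φ)) ≡ just b) ×
          (b ≡ true → ∃ (Solution (List.map constraint (atoms φ)))) × (∃ (Solution (List.map constraint (atoms φ))) → b ≡ true)) →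
        ∃[ b ] (run decider (proj₁ bound * length (encode φ) ^ proj₁ (proj₂ bound) + proj₁ bound) (initial decider (encode φ)) ≡ just b
                × (b ≡ true ⇔ Γ ⊨ φ))
      answer φ (b , e , sound , complete) = b , e _ (proj₂ (proj₂ bound) (length (encode φ))) ,
        mk⇔ (λ p → tabulate (s ∘ proj₁ (sound p)) , solution⇐ (atoms φ) (proj₁ (sound p)) (proj₂ (sound p)))
            (λ (v , hs) → complete (s ∘ lookup v , solution⇒ (atoms φ) v hs))

  module _ (d : ℕ) .{{_ : NonZero d}} where

    max-neg : ∀ x y → max[ d ] (- x) (- y) ≡ - min[ d ] x y
    max-neg x y = go (+ d ∣? (- x - - y)) (+ d ∣? (x - y))
      where
      e₁ : ∀ x y → - (- x - - y) ≡ x - y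
      e₁ = solve-∀
      e₂ : ∀ x y → - (x - y) ≡ - x - - y
      e₂ = solve-∀
      go : (p? : Dec (+ d ∣ - x - - y)) (q? : Dec (+ d ∣ x - y)) →
           (if does p? then - x ⊔ - y else - x) ≡ - (if does q? then x ⊓ y else x)
      go (yes p) (yes q) = sym (ℤ.neg-distrib-⊓-⊔ x y)
      go (yes p) (no ¬q) = contradiction (subst (+ d ∣_) (e₁ x y) (∣m⇒∣-m p)) ¬q
      go (no ¬p) (yes q) = contradiction (subst (+ d ∣_) (e₂ x y) (∣m⇒∣-m q)) ¬p
      go (no ¬p) (no ¬q) = refl

  Close-neg : ∀ {K n} (f g : Fin n → ℤ) → Close K f g → Close K (-_ ∘ f) (-_ ∘ g)
  Close-neg {K} f g c i j = subst₂ (Sim K) (eqn (f i) (f j)) (eqn (g i) (g j)) (Sim-neg (c i j))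
    where
    eqn : ∀ x y → - (x - y) ≡ - x - - y
    eqn = solve-∀

open import Defs
open import Data.Integer using (ℤ)
open import Data.Nat using (ℕ; NonZero)
open import Data.Sum using (_⊎_)

mainTheorem18 : (τ : Signature) (Γ : Structure τ ℤ) → IsReduct Γ →
    (d : ℕ) .{{_ : NonZero d}} → Preserves Γ max[ d ] ⊎ Preserves Γ min[ d ] →
    CSPSolvableInPolynomialTime Γ
mainTheorem18 τ Γ reduct d (inj₁ p) = Reduction.Reduct.solvable τ Γ reduct d max[ d ] p ℤ.-_ ℤ.neg-involutive Reduction.Close-neg (Reduction.max-neg d)
mainTheorem18 τ Γ reduct d (inj₂ p) = Reduction.Reduct.solvable τ Γ reduct d min[ d ] p id (λ _ → refl) (λ _ _ c → c) (λ _ _ → refl)
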